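{- Let $d$ be a positive integer, let $\nu\in\mathbb{Q}$ and write $\nu=[a_0;a_1,\ldots,a_n]$ as a finite continued fraction. Let $\mathcal{M}$ be a sub-$S_\nu$-module of $S_\nu^d$. Then $\mathrm{Max}(\mathcal{M})$ is generated, as an $S_\nu$-module, by at most $$d\cdot\Big(2+\sum_{i=1}^{\lfloor n/2\rfloor}a_{2i}\Big)$$ elements.
   Context: $R$ is a complete discrete valuation ring with uniformizer $\pi$ and fraction field $K$; $v_K$ is the valuation on $K$ with $v_K(\pi)=1$. Write $\nu=\beta/\alpha$ with $\alpha\ge1$ and $\alpha,\beta$ coprime integers. $S_\nu=\{\sum_{i\ge 0}a_iu^i\in K[[u]] : v_K(a_i)+\nu i\ge 0\ \forall i\}$. $[a_0;a_1,\ldots,a_n]=a_0+\cfrac{1}{a_1+\cfrac{1}{\ddots+\cfrac1{a_n}}}$ with $a_0\in\mathbb{Z}$ and $a_1,\ldots,a_n$ positive integers; the expansion is normalized so that $a_n\ne1$ (when $n\ge1$), which makes it unique. A morphism of finitely generated $S_\nu$-modules is a quasi-isomorphism if its kernel and cokernel have finite length. For a finitely generated torsion-free $S_\nu$-module $\mathcal{M}$, $\mathrm{Max}(\mathcal{M})$ is the finitely generated torsion-free module (unique up to isomorphism) equipped with a quasi-isomorphism $f:\mathcal{M}\to\mathrm{Max}(\mathcal{M})$ such that for every finitely generated torsion-free $\mathcal{N}$ and every quasi-isomorphism $f':\mathcal{M}\to\mathcal{N}$ there is $g:\mathcal{N}\to\mathrm{Max}(\mathcal{M})$ with $g\circ f'=f$.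 For $\mathcal{M}\subset S_\nu^d$ it is realized as $\{x\in S_\nu^d:\exists n\in\mathbb{N},\ \pi^nx\in\mathcal{M}\text{ and }(u^\alpha/\pi^\beta)^nx\in\mathcal{M}\}$. -}

module Defs where

open import Algebra.Bundles using (AbelianGroup; CommutativeMonoid; CommutativeRing)
open import Algebra.Module.Bundles using (LeftModule)
open import Algebra.Module.Bundles.Raw using (RawLeftModule)
open import Algebra.Module.Morphism.Structures using (module LeftModuleMorphisms)
open import Algebra.Morphism.Structures using (IsRingMonomorphism)
open import Data.Fin.Base as Fin using (Fin; toℕ)
open import Data.Fin.Properties using (toℕ≤pred[n])
open import Data.Integer.Base as ℤ using (ℤ; +_; 0ℤ; 1ℤ)
open import Data.List.Base using (List; []; _∷_)
open import Data.Maybe.Base using (zipWith)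
open import Data.Nat.Base as ℕ using (ℕ; zero; suc; _∸_)
open import Data.Product.Base using (Σ; ∃; ∃₂; _×_; _,_; proj₁; proj₂)
open import Data.Rational.Base as ℚ using (ℚ; 0ℚ; 1/_)
open import Data.Sum.Base using (_⊎_; inj₁; inj₂)
open import Function.Base using (_∘_; id)
open import Function.Bundles using (_⇔_; Equivalence)
open import Level using (Level; _⊔_) renaming (suc to lsuc)
open import Relation.Binary.PropositionalEquality as ≡ using (_≡_; refl; cong; cong₂; subst)
open import Relation.Nullary using (¬_; yes; no; contradiction)
open import Relation.Nullary.Construct.Add.Supremum using (_⁺; ⊤⁺; [_]; []-injective)
open import Relation.Unary using (Pred)

import Algebra.Construct.Pointwise as Pointwise
import Algebra.Module.Morphism.LeftModuleMonomorphism as LeftModuleMonomorphism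
import Algebra.Module.Properties.LeftModule as LeftModuleProperties
import Algebra.Morphism.RingMonomorphism as RingMonomorphism
import Algebra.Properties.AbelianGroup as AbelianGroupProperties
import Algebra.Properties.CommutativeSemigroup as CommutativeSemigroupProperties
import Algebra.Properties.Group as GroupProperties
import Algebra.Properties.Monoid.Sum as MonoidSum
import Algebra.Properties.Ring as RingProperties
import Data.Integer.Properties as ℤ
import Data.Integer.Tactic.RingSolver as ℤ-Solver
import Data.Nat.Properties as ℕ
import Data.Rational.Properties as ℚ
import Data.Rational.Unnormalised.Base as ℚᵘ
import Data.Rational.Unnormalised.Properties as ℚᵘ
import Relation.Binary.Construct.Add.Supremum.NonStrict as Supremum
import Relation.Binary.Reasoning.Setoid as SetoidReasoning

private
  variable
    a : Level

-- The value at 0ℚ is a convention; it is never reached in a continued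
-- fraction whose entries after the first are positive.
recip : ℚ → ℚ
recip q with q ℚ.≟ 0ℚ
... | yes _   = 0ℚ
... | no  q≢0 = 1/_ q {{ℚ.≢-nonZero q≢0}}

-- ⟦ a₀ ⨾ a₁ ∷ … ∷ aₙ ∷ [] ⟧ is [a₀; a₁, …, aₙ].
⟦_⨾_⟧ : ℤ → List ℕ → ℚ
⟦ a₀ ⨾ []     ⟧ = a₀ ℚ./ 1
⟦ a₀ ⨾ b ∷ bs ⟧ = a₀ ℚ./ 1 ℚ.+ recip ⟦ + b ⨾ bs ⟧

-- For a₁ ∷ … ∷ aₙ ∷ [] this is a₂ + a₄ + … + a_{2⌊n/2⌋}.
evenSum : List ℕ → ℕ
evenSum []           = 0
evenSum (_ ∷ [])     = 0
evenSum (_ ∷ b ∷ bs) = b ℕ.+ evenSum bs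

ℤ∞ : Set
ℤ∞ = ℤ ⁺

open Supremum ℤ._≤_ public using (_≤⁺_)

infixl 6 _+⁺_
infixl 6 _⊓⁺_

_+⁺_ : ℤ∞ → ℤ∞ → ℤ∞
_+⁺_ = zipWith ℤ._+_

_⊓⁺_ : ℤ∞ → ℤ∞ → ℤ∞
⊤⁺    ⊓⁺ y     = y
[ m ] ⊓⁺ ⊤⁺    = [ m ]
[ m ] ⊓⁺ [ n ] = [ m ℤ.⊓ n ]

record IsField (K : CommutativeRing a a) : Set a where
  open CommutativeRing K
  field
    1≉0     : ¬ (1# ≈ 0#)
    inverse : ∀ x → ¬ (x ≈ 0#) → ∃ λ y → x * y ≈ 1#

record IsFractionField (R K : CommutativeRing a a)
                       (ι : CommutativeRing.Carrier R → CommutativeRing.Carrier K) : Set a where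
  private
    module R = CommutativeRing R
    module K = CommutativeRing K
  field
    isField            : IsField K
    isRingMonomorphism : IsRingMonomorphism R.rawRing K.rawRing ι
    fraction           : ∀ x → ∃₂ λ r s → ¬ (s R.≈ R.0#) × (ι s K.* x K.≈ ι r)

  open IsField isField public

record IsValuation (K : CommutativeRing a a)
                   (v : CommutativeRing.Carrier K → ℤ∞) : Set a where
  open CommutativeRing K
  field
    v-cong : ∀ {x y} → x ≈ y → v x ≡ v y
    v-⊤    : ∀ x → v x ≡ ⊤⁺ ⇔ x ≈ 0#
    v-*    : ∀ x y → v (x * y) ≡ v x +⁺ v y
    v-+    : ∀ x y → v x ⊓⁺ v y ≤⁺ v (x + y)

-- R is the valuation ring of a discrete valuation v on its fraction
-- field K, and is complete.  The field v-π makes v surjective onto ℤ∞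
-- and π a uniformizer, and it determines v.
record CompleteDVR a : Set (lsuc a) where
  field
    R K             : CommutativeRing a a
    ι               : CommutativeRing.Carrier R → CommutativeRing.Carrier K
    isFractionField : IsFractionField R K ι

  module R = CommutativeRing R
  module K = CommutativeRing K

  field
    v             : K.Carrier → ℤ∞
    isValuation   : IsValuation K v
    valuationRing : ∀ x → [ 0ℤ ] ≤⁺ v x ⇔ ∃ λ r → ι r K.≈ x
    π             : R.Carrier
    v-π           : v (ι π) ≡ [ 1ℤ ]

  Cauchy : (ℕ → R.Carrier) → Set
  Cauchy x = ∀ N → ∃ λ n₀ → ∀ m n → n₀ ℕ.≤ m → n₀ ℕ.≤ n → [ N ] ≤⁺ v (ι (x m R.- x n))

  _ConvergesTo_ : (ℕ → R.Carrier) → R.Carrier → Set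
  x ConvergesTo y = ∀ N → ∃ λ n₀ → ∀ n → n₀ ℕ.≤ n → [ N ] ≤⁺ v (ι (x n R.- y))

  field
    complete : ∀ x → Cauchy x → ∃ λ y → x ConvergesTo y

  open IsFractionField isFractionField public
  open IsValuation isValuation public

-- A function f : ℕ → K stands for the formal power series Σ f(i) uⁱ.
module PowerSeries (K : CommutativeRing a a) where
  open CommutativeRing K renaming (refl to ≈-refl; sym to ≈-sym; trans to ≈-trans)
  open MonoidSum +-monoid using (sum; sum-cong-≋)
  open SetoidReasoning setoid

  infixl 7 _*ₚ_
  infix 4 _≈ₚ_

  _≈ₚ_ : (f g : ℕ → Carrier) → Set a
  f ≈ₚ g = ∀ i → f i ≈ g i

  _*ₚ_ : (f g : ℕ → Carrier) → ℕ → Carrier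
  (f *ₚ g) i = sum {suc i} λ j → f (toℕ j) * g (i ∸ toℕ j)

  1ₚ : ℕ → Carrier
  1ₚ zero    = 1#
  1ₚ (suc _) = 0#

  private
    infixl 6 _+ₚ_
    _+ₚ_ : (f g : ℕ → Carrier) → ℕ → Carrier
    (f +ₚ g) i = f i + g i

    open CommutativeSemigroupProperties
      (CommutativeMonoid.commutativeSemigroup +-commutativeMonoid) using (interchange)

    *ₚ-cong : ∀ {f f′ g g′} → f ≈ₚ f′ → g ≈ₚ g′ → f *ₚ g ≈ₚ f′ *ₚ g′
    *ₚ-cong p q i = sum-cong-≋ {suc i} λ j → *-cong (p (toℕ j)) (q (i ∸ toℕ j))

    distribʳₚ : ∀ h f g → (f +ₚ g) *ₚ h ≈ₚ (f *ₚ h) +ₚ (g *ₚ h)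
    distribʳₚ h f g zero = begin
      (f 0 + g 0) * h 0 + 0#                ≈⟨ +-cong (distribʳ _ _ _) (≈-sym (+-identityˡ 0#)) ⟩
      (f 0 * h 0 + g 0 * h 0) + (0# + 0#)   ≈⟨ interchange _ _ _ _ ⟩
      (f 0 * h 0 + 0#) + (g 0 * h 0 + 0#)   ∎
    distribʳₚ h f g (suc i) = begin
      (f 0 + g 0) * h (suc i) + ((f ∘ suc +ₚ g ∘ suc) *ₚ h) i
        ≈⟨ +-cong (distribʳ _ _ _) (distribʳₚ h (f ∘ suc) (g ∘ suc) i) ⟩
      (f 0 * h (suc i) + g 0 * h (suc i)) + ((f ∘ suc *ₚ h) i + (g ∘ suc *ₚ h) i)
        ≈⟨ interchange _ _ _ _ ⟩
      (f *ₚ h) (suc i) + (g *ₚ h) (suc i) ∎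

    *ₚ-unfoldʳ : ∀ f g i → (f *ₚ g) (suc i) ≈ f (suc i) * g 0 + (f *ₚ g ∘ suc) i
    *ₚ-unfoldʳ f g zero = begin
      f 0 * g 1 + (f 1 * g 0 + 0#) ≈⟨ +-congˡ (+-identityʳ _) ⟩
      f 0 * g 1 + f 1 * g 0        ≈⟨ +-comm _ _ ⟩
      f 1 * g 0 + f 0 * g 1        ≈⟨ +-congˡ (≈-sym (+-identityʳ _)) ⟩
      f 1 * g 0 + (f 0 * g 1 + 0#) ∎
    *ₚ-unfoldʳ f g (suc i) = begin
      f 0 * g (suc (suc i)) + (f ∘ suc *ₚ g) (suc i)
        ≈⟨ +-congˡ (*ₚ-unfoldʳ (f ∘ suc) g i) ⟩
      f 0 * g (suc (suc i)) + (f (suc (suc i)) * g 0 + (f ∘ suc *ₚ g ∘ suc) i)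
        ≈⟨ ≈-sym (+-assoc _ _ _) ⟩
      (f 0 * g (suc (suc i)) + f (suc (suc i)) * g 0) + (f ∘ suc *ₚ g ∘ suc) i
        ≈⟨ +-congʳ (+-comm _ _) ⟩
      (f (suc (suc i)) * g 0 + f 0 * g (suc (suc i))) + (f ∘ suc *ₚ g ∘ suc) i
        ≈⟨ +-assoc _ _ _ ⟩
      f (suc (suc i)) * g 0 + (f *ₚ g ∘ suc) (suc i) ∎

    *ₚ-comm : ∀ f g → f *ₚ g ≈ₚ g *ₚ f
    *ₚ-comm f g zero    = +-congʳ (*-comm _ _)
    *ₚ-comm f g (suc i) = begin
      f 0 * g (suc i) + (f ∘ suc *ₚ g) i ≈⟨ +-cong (*-comm _ _) (*ₚ-comm (f ∘ suc) g i) ⟩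
      g (suc i) * f 0 + (g *ₚ f ∘ suc) i ≈⟨ ≈-sym (*ₚ-unfoldʳ g f i) ⟩
      (g *ₚ f) (suc i)                   ∎

    *ₚ-scaleˡ : ∀ c f g i → ((λ j → c * f j) *ₚ g) i ≈ c * (f *ₚ g) i
    *ₚ-scaleˡ c f g zero = begin
      (c * f 0) * g 0 + 0#     ≈⟨ +-cong (*-assoc _ _ _) (≈-sym (zeroʳ c)) ⟩
      c * (f 0 * g 0) + c * 0# ≈⟨ ≈-sym (distribˡ _ _ _) ⟩
      c * (f 0 * g 0 + 0#)     ∎
    *ₚ-scaleˡ c f g (suc i) = begin
      (c * f 0) * g (suc i) + ((λ j → c * f (suc j)) *ₚ g) i
        ≈⟨ +-cong (*-assoc _ _ _) (*ₚ-scaleˡ c (f ∘ suc) g i) ⟩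
      c * (f 0 * g (suc i)) + c * (f ∘ suc *ₚ g) i
        ≈⟨ ≈-sym (distribˡ _ _ _) ⟩
      c * (f *ₚ g) (suc i) ∎

    *ₚ-assoc : ∀ f g h → (f *ₚ g) *ₚ h ≈ₚ f *ₚ (g *ₚ h)
    *ₚ-assoc f g h zero = begin
      (f 0 * g 0 + 0#) * h 0 + 0# ≈⟨ +-congʳ (*-congʳ (+-identityʳ _)) ⟩
      (f 0 * g 0) * h 0 + 0#      ≈⟨ +-congʳ (*-assoc _ _ _) ⟩
      f 0 * (g 0 * h 0) + 0#      ≈⟨ +-congʳ (*-congˡ (≈-sym (+-identityʳ _))) ⟩
      f 0 * (g 0 * h 0 + 0#) + 0# ∎
    *ₚ-assoc f g h (suc i) = begin
      (f 0 * g 0 + 0#) * h (suc i) + (((λ j → f 0 * g (suc j)) +ₚ (f ∘ suc *ₚ g)) *ₚ h) i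
        ≈⟨ +-cong (*-congʳ (+-identityʳ _)) (distribʳₚ h (λ j → f 0 * g (suc j)) (f ∘ suc *ₚ g) i) ⟩
      (f 0 * g 0) * h (suc i) + (((λ j → f 0 * g (suc j)) *ₚ h) i + ((f ∘ suc *ₚ g) *ₚ h) i)
        ≈⟨ ≈-sym (+-assoc _ _ _) ⟩
      ((f 0 * g 0) * h (suc i) + ((λ j → f 0 * g (suc j)) *ₚ h) i) + ((f ∘ suc *ₚ g) *ₚ h) i
        ≈⟨ +-cong (+-cong (*-assoc _ _ _) (*ₚ-scaleˡ (f 0) (g ∘ suc) h i)) (*ₚ-assoc (f ∘ suc) g h i) ⟩
      (f 0 * (g 0 * h (suc i)) + f 0 * (g ∘ suc *ₚ h) i) + (f ∘ suc *ₚ (g *ₚ h)) i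
        ≈⟨ +-congʳ (≈-sym (distribˡ _ _ _)) ⟩
      (f *ₚ (g *ₚ h)) (suc i) ∎

    *ₚ-zeroˡ : ∀ f i → ((λ _ → 0#) *ₚ f) i ≈ 0#
    *ₚ-zeroˡ f zero    = ≈-trans (+-identityʳ _) (zeroˡ _)
    *ₚ-zeroˡ f (suc i) = ≈-trans (+-cong (zeroˡ _) (*ₚ-zeroˡ f i)) (+-identityʳ 0#)

    *ₚ-identityˡ : ∀ f → 1ₚ *ₚ f ≈ₚ f
    *ₚ-identityˡ f zero    = ≈-trans (+-identityʳ _) (*-identityˡ _)
    *ₚ-identityˡ f (suc i) =
      ≈-trans (+-cong (*-identityˡ _) (*ₚ-zeroˡ f i)) (+-identityʳ _)

    distribˡₚ : ∀ h f g → h *ₚ (f +ₚ g) ≈ₚ (h *ₚ f) +ₚ (h *ₚ g)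
    distribˡₚ h f g i = begin
      (h *ₚ (f +ₚ g)) i         ≈⟨ *ₚ-comm h (f +ₚ g) i ⟩
      ((f +ₚ g) *ₚ h) i         ≈⟨ distribʳₚ h f g i ⟩
      (f *ₚ h) i + (g *ₚ h) i   ≈⟨ +-cong (*ₚ-comm f h i) (*ₚ-comm g h i) ⟩
      (h *ₚ f) i + (h *ₚ g) i   ∎

  powerSeries : CommutativeRing a a
  powerSeries = record
    { Carrier = ℕ → Carrier
    ; _≈_     = _≈ₚ_
    ; _+_     = _+ₚ_
    ; _*_     = _*ₚ_
    ; -_      = λ f i → - f i
    ; 0#      = λ _ → 0#
    ; 1#      = 1ₚ
    ; isCommutativeRing = record
      { isRing = record
        { +-isAbelianGroup = Pointwise.isAbelianGroup ℕ +-isAbelianGroup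
        ; *-cong           = *ₚ-cong
        ; *-assoc          = *ₚ-assoc
        ; *-identity       = *ₚ-identityˡ , λ f i → ≈-trans (*ₚ-comm f 1ₚ i) (*ₚ-identityˡ f i)
        ; distrib          = distribˡₚ , distribʳₚ
        }
      ; *-comm = *ₚ-comm
      }
    }

record Subring {a} (A : CommutativeRing a a) p : Set (a ⊔ lsuc p) where
  open CommutativeRing A
  field
    _∈S : Pred Carrier p
    +∈S : ∀ {x y} → x ∈S → y ∈S → (x + y) ∈S
    *∈S : ∀ {x y} → x ∈S → y ∈S → (x * y) ∈S
    -∈S : ∀ {x} → x ∈S → (- x) ∈S
    0∈S : 0# ∈S
    1∈S : 1# ∈S

  toCommutativeRing : CommutativeRing (a ⊔ p) a
  toCommutativeRing = record
    { Carrier = Σ Carrier _∈S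
    ; _≈_     = λ x y → proj₁ x ≈ proj₁ y
    ; _+_     = λ (x , p) (y , q) → x + y , +∈S p q
    ; _*_     = λ (x , p) (y , q) → x * y , *∈S p q
    ; -_      = λ (x , p) → - x , -∈S p
    ; 0#      = 0# , 0∈S
    ; 1#      = 1# , 1∈S
    ; isCommutativeRing = RingMonomorphism.isCommutativeRing {⟦_⟧ = proj₁} mono isCommutativeRing
    }
    where
    mono = record
      { isRingHomomorphism = record
        { isSemiringHomomorphism = record
          { isNearSemiringHomomorphism = record
            { +-isMonoidHomomorphism = record
              { isMagmaHomomorphism = record
                { isRelHomomorphism = record { cong = id }
                ; homo = λ _ _ → CommutativeRing.refl A
                }
              ; ε-homo = CommutativeRing.refl A
              }
            ; *-homo = λ _ _ → CommutativeRing.refl A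
            }
          ; 1#-homo = CommutativeRing.refl A
          }
        ; -‿homo = λ _ → CommutativeRing.refl A
        }
      ; injective = id
      }

private
  toℚᵘ-/1 : ∀ m → ℚ.toℚᵘ (m ℚ./ 1) ℚᵘ.≃ ℚᵘ.mkℚᵘ m 0
  toℚᵘ-/1 m = ℚ.toℚᵘ-fromℚᵘ (ℚᵘ.mkℚᵘ m 0)

  /1-mono : ∀ {m n} → m ℤ.≤ n → m ℚ./ 1 ℚ.≤ n ℚ./ 1
  /1-mono {m} {n} m≤n = ℚ.toℚᵘ-cancel-≤ (ℚᵘ.≤-respˡ-≃ (ℚᵘ.≃-sym (toℚᵘ-/1 m))
    (ℚᵘ.≤-respʳ-≃ (ℚᵘ.≃-sym (toℚᵘ-/1 n)) (ℚᵘ.*≤* (ℤ.*-monoʳ-≤-nonNeg (+ 1) m≤n))))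

  /1-+ : ∀ m n → (m ℤ.+ n) ℚ./ 1 ≡ m ℚ./ 1 ℚ.+ n ℚ./ 1
  /1-+ m n = ℚ.toℚᵘ-injective (begin
    ℚ.toℚᵘ ((m ℤ.+ n) ℚ./ 1)                 ≈⟨ toℚᵘ-/1 (m ℤ.+ n) ⟩
    ℚᵘ.mkℚᵘ (m ℤ.+ n) 0                      ≈⟨ ℚᵘ.*≡* (lem m n) ⟩
    ℚᵘ.mkℚᵘ m 0 ℚᵘ.+ ℚᵘ.mkℚᵘ n 0             ≈⟨ ℚᵘ.+-cong (toℚᵘ-/1 m) (toℚᵘ-/1 n) ⟨
    ℚ.toℚᵘ (m ℚ./ 1) ℚᵘ.+ ℚ.toℚᵘ (n ℚ./ 1)   ≈⟨ ℚ.toℚᵘ-homo-+ (m ℚ./ 1) (n ℚ./ 1) ⟨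
    ℚ.toℚᵘ (m ℚ./ 1 ℚ.+ n ℚ./ 1)             ∎)
    where
    open SetoidReasoning ℚᵘ.≃-setoid
    lem : ∀ m n → (m ℤ.+ n) ℤ.* + 1 ≡ (m ℤ.* + 1 ℤ.+ n ℤ.* + 1) ℤ.* + 1
    lem = ℤ-Solver.solve-∀

  double-injective : ∀ k m → k ℤ.+ k ≡ m ℤ.+ m → k ≡ m
  double-injective k m eq = ℤ.*-cancelˡ-≡ (+ 2) k m
    (≡.trans (two k) (≡.trans eq (≡.sym (two m))))
    where
    two : ∀ j → + 2 ℤ.* j ≡ j ℤ.+ j
    two = ℤ-Solver.solve-∀

  ⊓⁺-≤-sel : ∀ {y z m} → y ⊓⁺ z ≤⁺ [ m ] → (y ≤⁺ [ m ]) ⊎ (z ≤⁺ [ m ])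
  ⊓⁺-≤-sel {⊤⁺}    {z}     p = inj₂ p
  ⊓⁺-≤-sel {[ k ]} {⊤⁺}    p = inj₁ p
  ⊓⁺-≤-sel {[ k ]} {[ l ]} p with ℤ.⊓-sel k l
  ... | inj₁ eq = inj₁ (subst (λ j → [ j ] ≤⁺ _) eq p)
  ... | inj₂ eq = inj₂ (subst (λ j → [ j ] ≤⁺ _) eq p)

  +⁺-finite : ∀ y z {m} → y +⁺ z ≡ [ m ] →
              ∃₂ λ k l → (y ≡ [ k ]) × (z ≡ [ l ]) × (k ℤ.+ l ≡ m)
  +⁺-finite [ k ] [ l ] eq = k , l , refl , refl , []-injective eq
  +⁺-finite ⊤⁺    [ l ] ()
  +⁺-finite ⊤⁺    ⊤⁺    ()
  +⁺-finite [ k ] ⊤⁺    ()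

module _ (D : CompleteDVR a) (ν : ℚ) where
  open CompleteDVR D
  open PowerSeries K
  open MonoidSum K.+-monoid using (sum)

  -- v(x) + ν i ≥ 0, which holds trivially when v(x) = ∞.
  Bound : ℕ → K.Carrier → Set
  Bound i x = ∀ m → v x ≡ [ m ] → 0ℚ ℚ.≤ m ℚ./ 1 ℚ.+ ν ℚ.* (+ i ℚ./ 1)

  private
    bound-0 : ∀ i → Bound i K.0#
    bound-0 i m eq with () ← ≡.trans (≡.sym eq) (Equivalence.from (v-⊤ K.0#) K.refl)

    bound-≤ : ∀ i x {m} → Bound i x → v x ≤⁺ [ m ] → 0ℚ ℚ.≤ m ℚ./ 1 ℚ.+ ν ℚ.* (+ i ℚ./ 1)
    bound-≤ i x b p with v x
    bound-≤ i x b Supremum.[ k≤m ] | [ k ] =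
      ℚ.≤-trans (b k refl) (ℚ.+-monoˡ-≤ (ν ℚ.* (+ i ℚ./ 1)) (/1-mono k≤m))

    bound-+ : ∀ i {x y} → Bound i x → Bound i y → Bound i (x K.+ y)
    bound-+ i {x} {y} p q m eq with ⊓⁺-≤-sel {v x} {v y} (subst (v x ⊓⁺ v y ≤⁺_) eq (v-+ x y))
    ... | inj₁ r = bound-≤ i x p r
    ... | inj₂ r = bound-≤ i y q r

    bound-* : ∀ i j {x y} → Bound i x → Bound j y → Bound (i ℕ.+ j) (x K.* y)
    bound-* i j {x} {y} p q m eq with +⁺-finite (v x) (v y) (≡.trans (≡.sym (v-* x y)) eq)
    ... | k , l , vx , vy , refl = subst (0ℚ ℚ.≤_) (≡.sym split) (ℚ.+-mono-≤ (p k vx) (q l vy))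
      where
      open ≡.≡-Reasoning
      open CommutativeSemigroupProperties
        (CommutativeMonoid.commutativeSemigroup ℚ.+-0-commutativeMonoid) using (interchange)
      νi = ν ℚ.* (+ i ℚ./ 1)
      νj = ν ℚ.* (+ j ℚ./ 1)
      split : (k ℤ.+ l) ℚ./ 1 ℚ.+ ν ℚ.* (+ (i ℕ.+ j) ℚ./ 1) ≡
              (k ℚ./ 1 ℚ.+ νi) ℚ.+ (l ℚ./ 1 ℚ.+ νj)
      split = begin
        (k ℤ.+ l) ℚ./ 1 ℚ.+ ν ℚ.* (+ (i ℕ.+ j) ℚ./ 1)
          ≡⟨ cong₂ ℚ._+_ (/1-+ k l) (cong (ν ℚ.*_) (/1-+ (+ i) (+ j))) ⟩
        (k ℚ./ 1 ℚ.+ l ℚ./ 1) ℚ.+ ν ℚ.* (+ i ℚ./ 1 ℚ.+ + j ℚ./ 1)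
          ≡⟨ cong ((k ℚ./ 1 ℚ.+ l ℚ./ 1) ℚ.+_) (ℚ.*-distribˡ-+ ν _ _) ⟩
        (k ℚ./ 1 ℚ.+ l ℚ./ 1) ℚ.+ (νi ℚ.+ νj)
          ≡⟨ interchange (k ℚ./ 1) (l ℚ./ 1) νi νj ⟩
        (k ℚ./ 1 ℚ.+ νi) ℚ.+ (l ℚ./ 1 ℚ.+ νj) ∎

    bound-neg : ∀ i {x} → Bound i x → Bound i (K.- x)
    bound-neg i {x} p m eq = go (+⁺-finite (v x) (v x) square)
      where
      open RingProperties K.ring using (-‿distribˡ-*; -‿distribʳ-*; -‿involutive)
      -x*-x≈x*x : K.- x K.* K.- x K.≈ x K.* x
      -x*-x≈x*x = K.trans (K.sym (-‿distribˡ-* x (K.- x)))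
        (K.trans (K.-‿cong (K.sym (-‿distribʳ-* x x))) (-‿involutive (x K.* x)))
      square : v x +⁺ v x ≡ [ m ℤ.+ m ]
      square = begin
        v x +⁺ v x             ≡⟨ v-* x x ⟨
        v (x K.* x)            ≡⟨ v-cong -x*-x≈x*x ⟨
        v (K.- x K.* K.- x)    ≡⟨ v-* (K.- x) (K.- x) ⟩
        v (K.- x) +⁺ v (K.- x) ≡⟨ cong₂ _+⁺_ eq eq ⟩
        [ m ℤ.+ m ]            ∎
        where open ≡.≡-Reasoning
      go : (∃₂ λ k l → (v x ≡ [ k ]) × (v x ≡ [ l ]) × (k ℤ.+ l ≡ m ℤ.+ m)) →
           0ℚ ℚ.≤ m ℚ./ 1 ℚ.+ ν ℚ.* (+ i ℚ./ 1)
      go (k , l , vx , vx′ , eq′) with refl ← []-injective (≡.trans (≡.sym vx) vx′) =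
        p m (≡.trans vx (cong [_] (double-injective k m eq′)))

    bound-1 : Bound 0 K.1#
    bound-1 m eq = subst (λ n → 0ℚ ℚ.≤ n ℚ./ 1 ℚ.+ ν ℚ.* (+ 0 ℚ./ 1)) (≡.sym m≡0)
      (subst (0ℚ ℚ.≤_) (≡.sym (cong (0ℚ ℚ.+_) (ℚ.*-zeroʳ ν))) ℚ.≤-refl)
      where
      open ≡.≡-Reasoning
      m≡0 : m ≡ 0ℤ
      m≡0 = GroupProperties.identityʳ-unique
        (AbelianGroup.group ℤ.+-0-abelianGroup) m m ([]-injective (begin
        [ m ] +⁺ [ m ]   ≡⟨ cong₂ _+⁺_ eq eq ⟨
        v K.1# +⁺ v K.1# ≡⟨ v-* K.1# K.1# ⟨
        v (K.1# K.* K.1#) ≡⟨ v-cong (K.*-identityˡ K.1#) ⟩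
        v K.1#           ≡⟨ eq ⟩
        [ m ]            ∎))

    bound-sum : ∀ i n (t : Fin n → K.Carrier) → (∀ j → Bound i (t j)) → Bound i (sum t)
    bound-sum i zero    t p = bound-0 i
    bound-sum i (suc n) t p =
      bound-+ i (p Fin.zero) (bound-sum i n (t ∘ Fin.suc) (p ∘ Fin.suc))

    bound-*ₚ : ∀ f g → (∀ i → Bound i (f i)) → (∀ i → Bound i (g i)) → ∀ i → Bound i ((f *ₚ g) i)
    bound-*ₚ f g p q i = bound-sum i (suc i) _ λ j →
      subst (λ n → Bound n (f (toℕ j) K.* g (i ∸ toℕ j))) (ℕ.m+[n∸m]≡n (toℕ≤pred[n] j))
        (bound-* (toℕ j) (i ∸ toℕ j) (p (toℕ j)) (q (i ∸ toℕ j)))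

    bound-1ₚ : ∀ i → Bound i (1ₚ i)
    bound-1ₚ zero    = bound-1
    bound-1ₚ (suc i) = bound-0 (suc i)

  -- The subring S_ν of K[[u]].
  S : CommutativeRing a a
  S = Subring.toCommutativeRing {A = powerSeries} record
    { _∈S = λ f → ∀ i → Bound i (f i)
    ; +∈S = λ p q i → bound-+ i (p i) (q i)
    ; *∈S = λ {f} {g} → bound-*ₚ f g
    ; -∈S = λ p i → bound-neg i (p i)
    ; 0∈S = bound-0
    ; 1∈S = bound-1ₚ
    }

-- A module over a commutative ring is rendered as a LeftModule over the
-- underlying ring.
module Modules (A : CommutativeRing a a) where
  private
    module A = CommutativeRing A

  Mod : Set (lsuc a)
  Mod = LeftModule A.ring a a

  module _ (M : Mod) where
    open LeftModule M
    open MonoidSum +ᴹ-monoid using (sum)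

    GeneratedBy : ℕ → Set a
    GeneratedBy k = ∃ λ (g : Fin k → Carrierᴹ) →
      ∀ x → ∃ λ (c : Fin k → A.Carrier) → x ≈ᴹ sum λ i → c i *ₗ g i

    GeneratedByAtMost : ℕ → Set a
    GeneratedByAtMost n = ∃ λ k → k ℕ.≤ n × GeneratedBy k

    FinitelyGenerated : Set a
    FinitelyGenerated = ∃ λ k → GeneratedBy k

    TorsionFree : Set a
    TorsionFree = ∀ s x → s *ₗ x ≈ᴹ 0ᴹ → s A.≈ A.0# ⊎ x ≈ᴹ 0ᴹ

  Free : ℕ → Mod
  Free d = record
    { Carrierᴹ = Fin d → A.Carrier
    ; _≈ᴹ_     = λ x y → ∀ i → x i A.≈ y i
    ; _+ᴹ_     = λ x y i → x i A.+ y i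
    ; _*ₗ_     = λ s x i → s A.* x i
    ; 0ᴹ       = λ _ → A.0#
    ; -ᴹ_      = λ x i → A.- x i
    ; isLeftModule = record
      { isLeftSemimodule = record
        { +ᴹ-isCommutativeMonoid = Pointwise.isCommutativeMonoid (Fin d) A.+-isCommutativeMonoid
        ; isPreleftSemimodule = record
          { *ₗ-cong      = λ p q i → A.*-cong p (q i)
          ; *ₗ-zeroˡ     = λ x i → A.zeroˡ (x i)
          ; *ₗ-distribʳ  = λ x s t i → A.distribʳ (x i) s t
          ; *ₗ-identityˡ = λ x i → A.*-identityˡ (x i)
          ; *ₗ-assoc     = λ s t x i → A.*-assoc s t (x i)
          ; *ₗ-zeroʳ     = λ s i → A.zeroʳ s
          ; *ₗ-distribˡ  = λ s x y i → A.distribˡ s (x i) (y i)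
          }
        }
      ; -ᴹ‿cong    = λ p i → A.-‿cong (p i)
      ; -ᴹ‿inverse = (λ x i → A.-‿inverseˡ (x i)) , (λ x i → A.-‿inverseʳ (x i))
      }
    }

  record Hom (M N : Mod) : Set a where
    private
      module M = LeftModule M
      module N = LeftModule N
    open LeftModuleMorphisms M.rawLeftModule N.rawLeftModule using (IsLeftModuleHomomorphism)
    field
      ⟦_⟧   : M.Carrierᴹ → N.Carrierᴹ
      isHom : IsLeftModuleHomomorphism ⟦_⟧

    open LeftModuleMorphisms.IsLeftModuleHomomorphism isHom public

  record Submodule (M : Mod) : Set (lsuc a) where
    open LeftModule M
    infix 4 _∈N
    field
      _∈N    : Pred Carrierᴹ a
      ∈-resp : ∀ {x y} → x ≈ᴹ y → x ∈N → y ∈N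
      0∈N    : 0ᴹ ∈N
      +∈N    : ∀ {x y} → x ∈N → y ∈N → x +ᴹ y ∈N
      *∈N    : ∀ s {x} → x ∈N → s *ₗ x ∈N

    private
      -1*x≈-x : ∀ x → (A.- A.1#) *ₗ x ≈ᴹ -ᴹ x
      -1*x≈-x x = LeftModuleProperties.inverseˡ-uniqueᴹ M _ _ (begin
        (A.- A.1#) *ₗ x +ᴹ x           ≈⟨ +ᴹ-congˡ (*ₗ-identityˡ x) ⟨
        (A.- A.1#) *ₗ x +ᴹ A.1# *ₗ x   ≈⟨ *ₗ-distribʳ x _ _ ⟨
        ((A.- A.1#) A.+ A.1#) *ₗ x     ≈⟨ *ₗ-cong (A.-‿inverseˡ A.1#) ≈ᴹ-refl ⟩
        A.0# *ₗ x                      ≈⟨ *ₗ-zeroˡ x ⟩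
        0ᴹ                             ∎)
        where open SetoidReasoning ≈ᴹ-setoid

    -∈N : ∀ {x} → x ∈N → -ᴹ x ∈N
    -∈N {x} p = ∈-resp (-1*x≈-x x) (*∈N (A.- A.1#) p)

  module _ {M : Mod} (N : Submodule M) where
    open LeftModule M
    open Submodule N

    -- N as a module in its own right.
    ⌊_⌋ : Mod
    ⌊_⌋ = record
      { Carrierᴹ = Σ Carrierᴹ _∈N
      ; _≈ᴹ_     = λ x y → proj₁ x ≈ᴹ proj₁ y
      ; _+ᴹ_     = λ (x , p) (y , q) → x +ᴹ y , +∈N p q
      ; _*ₗ_     = λ s (x , p) → s *ₗ x , *∈N s p
      ; 0ᴹ       = 0ᴹ , 0∈N
      ; -ᴹ_      = λ (x , p) → -ᴹ x , -∈N p
      ; isLeftModule = LeftModuleMonomorphism.isLeftModule mono A.isRing isLeftModule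
      }
      where
      raw : RawLeftModule A.Carrier a a
      raw = record
        { _≈ᴹ_     = λ x y → proj₁ x ≈ᴹ proj₁ y
        ; _+ᴹ_     = λ (x , p) (y , q) → x +ᴹ y , +∈N p q
        ; _*ₗ_     = λ s (x , p) → s *ₗ x , *∈N s p
        ; 0ᴹ       = 0ᴹ , 0∈N
        ; -ᴹ_      = λ (x , p) → -ᴹ x , -∈N p
        }
      mono : LeftModuleMorphisms.IsLeftModuleMonomorphism raw rawLeftModule proj₁
      mono = record
        { isLeftModuleHomomorphism = record
          { +ᴹ-isGroupHomomorphism = record
            { isMonoidHomomorphism = record
              { isMagmaHomomorphism = record
                { isRelHomomorphism = record { cong = id }
                ; homo = λ _ _ → ≈ᴹ-refl
                }
              ; ε-homo = ≈ᴹ-refl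
              }
            ; ⁻¹-homo = λ _ → ≈ᴹ-refl
            }
          ; *ₗ-homo = λ _ _ → ≈ᴹ-refl
          }
        ; injective = id
        }

    private
      infix 4 _~_
      _~_ : Carrierᴹ → Carrierᴹ → Set a
      x ~ y = x +ᴹ -ᴹ y ∈N

      open SetoidReasoning ≈ᴹ-setoid
      open AbelianGroupProperties +ᴹ-abelianGroup
        renaming (⁻¹-involutive to -ᴹ-involutive; ⁻¹-∙-comm to -ᴹ-+ᴹ-comm)
      open CommutativeSemigroupProperties
        (CommutativeMonoid.commutativeSemigroup +ᴹ-commutativeMonoid) using (interchange)

      ~-reflexive : ∀ {x y} → x ≈ᴹ y → x ~ y
      ~-reflexive {x} {y} p = ∈-resp
        (≈ᴹ-sym (≈ᴹ-trans (+ᴹ-congʳ p) (-ᴹ‿inverseʳ y))) 0∈N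

      ~-sym : ∀ {x y} → x ~ y → y ~ x
      ~-sym {x} {y} p = ∈-resp (begin
        -ᴹ (x +ᴹ -ᴹ y)     ≈⟨ -ᴹ-+ᴹ-comm x (-ᴹ y) ⟨
        -ᴹ x +ᴹ -ᴹ (-ᴹ y)  ≈⟨ +ᴹ-congˡ (-ᴹ-involutive y) ⟩
        -ᴹ x +ᴹ y          ≈⟨ +ᴹ-comm _ _ ⟩
        y +ᴹ -ᴹ x          ∎) (-∈N p)

      ~-trans : ∀ {x y z} → x ~ y → y ~ z → x ~ z
      ~-trans {x} {y} {z} p q = ∈-resp (begin
        (x +ᴹ -ᴹ y) +ᴹ (y +ᴹ -ᴹ z)  ≈⟨ +ᴹ-assoc x _ _ ⟩
        x +ᴹ (-ᴹ y +ᴹ (y +ᴹ -ᴹ z))  ≈⟨ +ᴹ-congˡ (+ᴹ-assoc _ _ _) ⟨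
        x +ᴹ ((-ᴹ y +ᴹ y) +ᴹ -ᴹ z)  ≈⟨ +ᴹ-congˡ (+ᴹ-congʳ (-ᴹ‿inverseˡ y)) ⟩
        x +ᴹ (0ᴹ +ᴹ -ᴹ z)           ≈⟨ +ᴹ-congˡ (+ᴹ-identityˡ _) ⟩
        x +ᴹ -ᴹ z                   ∎) (+∈N p q)

      ~-+ : ∀ {x x′ y y′} → x ~ x′ → y ~ y′ → x +ᴹ y ~ x′ +ᴹ y′
      ~-+ {x} {x′} {y} {y′} p q = ∈-resp (begin
        (x +ᴹ -ᴹ x′) +ᴹ (y +ᴹ -ᴹ y′)  ≈⟨ interchange x (-ᴹ x′) y (-ᴹ y′) ⟩
        (x +ᴹ y) +ᴹ (-ᴹ x′ +ᴹ -ᴹ y′)  ≈⟨ +ᴹ-congˡ (-ᴹ-+ᴹ-comm x′ y′) ⟩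
        (x +ᴹ y) +ᴹ -ᴹ (x′ +ᴹ y′)     ∎) (+∈N p q)

      ~-neg : ∀ {x y} → x ~ y → -ᴹ x ~ -ᴹ y
      ~-neg {x} {y} p = ∈-resp (≈ᴹ-sym (-ᴹ-+ᴹ-comm x (-ᴹ y))) (-∈N p)

      ~-* : ∀ s {x y} → x ~ y → s *ₗ x ~ s *ₗ y
      ~-* s {x} {y} p = ∈-resp (begin
        s *ₗ (x +ᴹ -ᴹ y)              ≈⟨ *ₗ-distribˡ s x (-ᴹ y) ⟩
        s *ₗ x +ᴹ s *ₗ (-ᴹ y)         ≈⟨ +ᴹ-congˡ s*-y ⟩
        s *ₗ x +ᴹ -ᴹ (s *ₗ y)         ∎) (*∈N s p)
        where
        s*-y : s *ₗ (-ᴹ y) ≈ᴹ -ᴹ (s *ₗ y)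
        s*-y = LeftModuleProperties.inverseˡ-uniqueᴹ M _ _ (begin
          s *ₗ (-ᴹ y) +ᴹ s *ₗ y  ≈⟨ *ₗ-distribˡ s (-ᴹ y) y ⟨
          s *ₗ (-ᴹ y +ᴹ y)       ≈⟨ *ₗ-cong A.refl (-ᴹ‿inverseˡ y) ⟩
          s *ₗ 0ᴹ                ≈⟨ *ₗ-zeroʳ s ⟩
          0ᴹ                     ∎)

    -- M / N: the elements of M, with x and y identified when x - y ∈ N.
    Quotient : Mod
    Quotient = record
      { Carrierᴹ = Carrierᴹ
      ; _≈ᴹ_     = λ x y → x +ᴹ -ᴹ y ∈N
      ; _+ᴹ_     = _+ᴹ_
      ; _*ₗ_     = _*ₗ_
      ; 0ᴹ       = 0ᴹ
      ; -ᴹ_      = -ᴹ_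
      ; isLeftModule = record
        { isLeftSemimodule = record
          { +ᴹ-isCommutativeMonoid = record
            { isMonoid = record
              { isSemigroup = record
                { isMagma = record
                  { isEquivalence = record
                    { refl = ~-reflexive ≈ᴹ-refl ; sym = ~-sym ; trans = ~-trans }
                  ; ∙-cong = ~-+
                  }
                ; assoc = λ x y z → ~-reflexive (+ᴹ-assoc x y z)
                }
              ; identity = (λ x → ~-reflexive (+ᴹ-identityˡ x))
                         , (λ x → ~-reflexive (+ᴹ-identityʳ x))
              }
            ; comm = λ x y → ~-reflexive (+ᴹ-comm x y)
            }
          ; isPreleftSemimodule = record
            { *ₗ-cong      = λ {s} {t} p q → ~-trans (~-* s q) (~-reflexive (*ₗ-cong p ≈ᴹ-refl))
            ; *ₗ-zeroˡ     = λ x → ~-reflexive (*ₗ-zeroˡ x)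
            ; *ₗ-distribʳ  = λ x s t → ~-reflexive (*ₗ-distribʳ x s t)
            ; *ₗ-identityˡ = λ x → ~-reflexive (*ₗ-identityˡ x)
            ; *ₗ-assoc     = λ s t x → ~-reflexive (*ₗ-assoc s t x)
            ; *ₗ-zeroʳ     = λ s → ~-reflexive (*ₗ-zeroʳ s)
            ; *ₗ-distribˡ  = λ s x y → ~-reflexive (*ₗ-distribˡ s x y)
            }
          }
        ; -ᴹ‿cong    = ~-neg
        ; -ᴹ‿inverse = (λ x → ~-reflexive (-ᴹ‿inverseˡ x)) , (λ x → ~-reflexive (-ᴹ‿inverseʳ x))
        }
      }

  module _ {M N : Mod} (f : Hom M N) where
    private
      module M = LeftModule M
      module N = LeftModule N
    open Hom f

    Kernel : Mod
    Kernel = ⌊_⌋ {M} record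
      { _∈N    = λ x → ⟦ x ⟧ N.≈ᴹ N.0ᴹ
      ; ∈-resp = λ x≈y p → N.≈ᴹ-trans (⟦⟧-cong (M.≈ᴹ-sym x≈y)) p
      ; 0∈N    = 0ᴹ-homo
      ; +∈N    = λ p q → N.≈ᴹ-trans (+ᴹ-homo _ _) (N.≈ᴹ-trans (N.+ᴹ-cong p q) (N.+ᴹ-identityˡ N.0ᴹ))
      ; *∈N    = λ s p → N.≈ᴹ-trans (*ₗ-homo s _) (N.≈ᴹ-trans (N.*ₗ-cong A.refl p) (N.*ₗ-zeroʳ s))
      }

    Cokernel : Mod
    Cokernel = Quotient {N} record
      { _∈N    = λ y → ∃ λ x → ⟦ x ⟧ N.≈ᴹ y
      ; ∈-resp = λ y≈z (x , p) → x , N.≈ᴹ-trans p y≈z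
      ; 0∈N    = M.0ᴹ , 0ᴹ-homo
      ; +∈N    = λ (x , p) (y , q) → x M.+ᴹ y , N.≈ᴹ-trans (+ᴹ-homo x y) (N.+ᴹ-cong p q)
      ; *∈N    = λ s (x , p) → s M.*ₗ x , N.≈ᴹ-trans (*ₗ-homo s x) (N.*ₗ-cong A.refl p)
      }

  record Simple (M : Mod) : Set (lsuc a) where
    open LeftModule M
    field
      nontrivial : ∃ λ x → ¬ (x ≈ᴹ 0ᴹ)
      minimal    : (N : Submodule M) (let open Submodule N) →
                   (∀ x → x ∈N → x ≈ᴹ 0ᴹ) ⊎ (∀ x → x ∈N)

  -- A composition series M ⊋ N ⊋ … ⊋ 0 with simple quotients, read from
  -- the top.
  data FiniteLength : Mod → Set (lsuc a) where
    trivial : ∀ {M} (let open LeftModule M) → (∀ x → x ≈ᴹ 0ᴹ) → FiniteLength M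
    extend  : ∀ {M} (N : Submodule M) → Simple (Quotient N) → FiniteLength ⌊ N ⌋ → FiniteLength M

  IsQuasiIsomorphism : ∀ {M N} → Hom M N → Set (lsuc a)
  IsQuasiIsomorphism f = FiniteLength (Kernel f) × FiniteLength (Cokernel f)

  -- X, together with f, is Max(M).
  record IsMax (M X : Mod) (f : Hom M X) : Set (lsuc a) where
    private
      module M = LeftModule M
      module X = LeftModule X
    field
      finitelyGenerated  : FinitelyGenerated X
      torsionFree        : TorsionFree X
      isQuasiIsomorphism : IsQuasiIsomorphism f
      universal          : ∀ N → FinitelyGenerated N → TorsionFree N →
                           (f′ : Hom M N) → IsQuasiIsomorphism f′ →
                           ∃ λ (g : Hom N X) → ∀ x →
                             Hom.⟦_⟧ g (Hom.⟦_⟧ f′ x) X.≈ᴹ Hom.⟦_⟧ f x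

{-# OPTIONS --safe #-}
module Submission where

-- The idea: with ν = β / α, filter K[[u]] by the weight α v(aᵢ) + β i, so that
-- S_ν is the part F 0 of weight ≥ 0.  Realise Max(M) as P ⊂ K[[u]]^d; it is
-- saturated: z ∈ P as soon as π z and (u^α / π^β) z are in P.  With
-- X j = { z : F (- j) z ⊂ P }, saturation makes multiplication by u injective
-- on the graded pieces X j / X (j + 1).  Hence elements z₁, …, z_r of pieces
-- X j₁, …, X j_r that form a minimal homogeneous generating system modulo
-- (F 1 , u) are linearly independent over K[[u]], so r ≤ d, and by Nakayama
-- P = Σ F (- jₛ) zₛ.  Each F j is generated by monomials uⁱ πᵐ, and a
-- continued fraction recursion on the lattice points (i , α m + β i) of a
-- quadrant shows that 2 + a₂ + a₄ + … of them suffice.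

open import Defs
open import Algebra.Bundles using (CommutativeMonoid; CommutativeRing)
open import Algebra.Module.Bundles using (LeftModule)
open import Algebra.Morphism.Structures using (IsRingMonomorphism)
open import Axiom.ExcludedMiddle using (ExcludedMiddle)
open import Data.Fin.Base as Fin using (Fin; toℕ; punchIn; punchOut)
open import Data.Fin.Properties using (punchIn-punchOut; toℕ≤pred[n]) renaming (_≟_ to _≟ᶠ_)
open import Data.Integer.Base as ℤ using (ℤ; +_; 0ℤ; 1ℤ)
open import Data.List.Base as List using (List; []; _∷_; [_]; length; map; tabulate; last)
open import Data.List.Properties using (length-map; length-++)
open import Data.List.Relation.Unary.All as All using (All; []; _∷_)
open import Data.List.Relation.Unary.Any as Any using (Any; here; there)
open import Data.Maybe.Base using (just)
open import Data.Nat.Base as ℕ using (ℕ; zero; suc; _∸_)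
open import Data.Product.Base using (Σ; ∃; ∃₂; _×_; _,_; proj₁; proj₂)
open import Data.Rational.Base as ℚ using (ℚ; 0ℚ; 1ℚ; fromℚᵘ; toℚᵘ)
open import Data.Rational.Unnormalised.Base as ℚᵘ using (mkℚᵘ; *≡*; *≤*; _≃_)
open import Data.Sum.Base using (_⊎_; inj₁; inj₂; [_,_]′)
open import Data.Vec.Functional using () renaming (_∷_ to _◂_)
open import Function.Base using (_∘_; _$_)
open import Function.Bundles using (_⇔_; mk⇔; Equivalence)
open import Level using () renaming (suc to lsuc)
open import Relation.Binary.PropositionalEquality as ≡
  using (_≡_; _≢_; refl; sym; trans; cong; cong₂; subst; subst₂; module ≡-Reasoning)
open import Relation.Nullary using (¬_; Dec; yes; no; contradiction)
open import Relation.Nullary.Construct.Add.Supremum using (⊤⁺; []-injective) renaming ([_] to [_]⁺)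
open import Relation.Nullary.Decidable using (decidable-stable)
open import Relation.Unary using (Pred)

import Algebra.Module.Properties.LeftModule as LeftModuleProperties
import Algebra.Properties.CommutativeSemigroup as CommutativeSemigroupProperties
import Algebra.Properties.Monoid.Sum as MonoidSum
import Algebra.Properties.Ring as RingProperties
import Algebra.Solver.Ring.NaturalCoefficients.Default as SemiringSolver
import Data.Integer.DivMod as ℤ
import Data.Integer.Properties as ℤ
import Data.Integer.Tactic.RingSolver as ℤ-Solver
import Data.List.Relation.Unary.All.Properties as All
import Data.List.Relation.Unary.Any.Properties as Any
import Data.Nat.Properties as ℕ
import Data.Rational.Properties as ℚ
import Data.Rational.Unnormalised.Properties as ℚᵘ
import Relation.Binary.Construct.Add.Supremum.NonStrict as Supremum
import Relation.Binary.Reasoning.Setoid as SetoidReasoning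

-- `Max(M)` is given only by a universal property, so saturation has to be extracted from it. If the
-- maximal ideal sends `w` into `P`, then `P + S_ν w` is again quasi-isomorphic to `M`, hence maps
-- back to `Max(M)` over `M`, and this forces `w ∈ P`. A `z ∉ P` with `ϖ z` and `η z` in `P` would
-- have a multiple that is such a `w`.
--
-- `S_ν` is not regular when `ν` is not an integer, so `P` cannot be expected to be free and its
-- rank does not count generators. The ideals `F j` take the place of `S_ν`, and the rank enters
-- through independence over `K[[u]]`.
--
-- Only even quotients cost points. For `α = a₁ β + γ` a shear of the lattice absorbs `a₁`; for
-- `β = a₂ γ + δ` every subtraction of `γ` from the height of the origin creates one corner of the
-- staircase. The summand 2 pays for bringing that height from below `α` to below `β`, and for the
-- innermost origin. The origin must be arbitrary because the degrees `jₛ` are.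

-- Lattice points of a quadrant and continued fractions.

module LatticePoints where
  open import Data.Integer.Base using (_+_; _-_; _*_; _≤_; _<_; +≤+)

  private
    gap : ∀ {x y} → x ≤ y → 0ℤ ≤ y - x
    gap = ℤ.i≤j⇒0≤j-i

    gap< : ∀ {x y} → x < y → 0ℤ ≤ y - x - 1ℤ
    gap< {x} {y} p = subst (0ℤ ≤_) (lem x y) (gap (ℤ.i<j⇒suc[i]≤j p))
      where
      lem : ∀ x y → y - (1ℤ + x) ≡ y - x - 1ℤ
      lem = ℤ-Solver.solve-∀

    infixr 5 _⊕_
    _⊕_ : ∀ {x y} → 0ℤ ≤ x → 0ℤ ≤ y → 0ℤ ≤ x + y
    _⊕_ = ℤ.+-mono-≤

    infixr 6 _⊛_
    _⊛_ : ∀ {x y} → 0ℤ ≤ x → 0ℤ ≤ y → 0ℤ ≤ x * y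
    _⊛_ {+ m} {+ n} _ _ = subst (0ℤ ≤_) (ℤ.pos-* m n) (+≤+ ℕ.z≤n)

    by : ∀ {x y e} → 0ℤ ≤ e → e ≡ y - x → x ≤ y
    by p eq = ℤ.0≤i-j⇒j≤i (subst (0ℤ ≤_) eq p)

    by< : ∀ {x y e} → 0ℤ ≤ e → e ≡ y - x - 1ℤ → x < y
    by< {x} {y} p eq = ℤ.suc[i]≤j⇒i<j (by p (trans eq (lem x y)))
      where
      lem : ∀ x y → y - x - 1ℤ ≡ y - (1ℤ + x)
      lem = ℤ-Solver.solve-∀

    -- Integrality: `z + 1 > 0` rounds to `z ≥ 0`. It turns an estimate that is off by less than one
    -- multiple of `c` into an exact comparison of coordinates.
    cancel : ∀ {c z} → 0ℤ ≤ c → 0ℤ < c * (z + 1ℤ) → 0ℤ ≤ z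
    cancel {+ c} {z} _ p = by (gap< 0<z+1) (lem z)
      where
      0<z+1 : 0ℤ < z + 1ℤ
      0<z+1 = ℤ.*-cancelˡ-<-nonNeg (+ c) (subst (_< + c * (z + 1ℤ)) (sym (ℤ.*-zeroʳ (+ c))) p)
      lem : ∀ z → z + 1ℤ - 0ℤ - 1ℤ ≡ z - 0ℤ
      lem = ℤ-Solver.solve-∀

  -- For `x = - k` this is the weight of `uⁱ π⁻ᵐ` minus `k`, so non-negative height means that the
  -- monomial lies in `F k`, for the slope `β / α`.
  height : (α β x i m : ℤ) → ℤ
  height α β x i m = x + β * i - α * m

  -- The upper bound is no restriction on minimal points, since raising `m` by one lowers the height
  -- by `α` and keeps `i`. It is recorded because `descend` can only transport points of height
  -- below `γ`.
  Valid : (α β x : ℤ) → ℤ × ℤ → Set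
  Valid α β x (i , m) = 0ℤ ≤ i × 0ℤ ≤ height α β x i m × height α β x i m < α

  Below : (α β x i m : ℤ) → ℤ × ℤ → Set
  Below α β x i m (i′ , m′) = i′ ≤ i × height α β x i′ m′ ≤ height α β x i m

  -- The lattice points (i , t) = (i , x + β i - α m) of the quadrant i, t ≥ 0,
  -- in the product order, are dominated by a list of at most B of them.
  record Cover (α β x : ℤ) (B : ℕ) : Set where
    field
      points  : List (ℤ × ℤ)
      bounded : length points ℕ.≤ B
      valid   : All (Valid α β x) points
      covers  : ∀ i m → 0ℤ ≤ i → 0ℤ ≤ height α β x i m → Any (Below α β x i m) points

  open Cover

  both : ∀ {P Q : ℤ × ℤ → Set} {ps} → All P ps → Any Q ps → Any (λ p → P p × Q p) ps
  both (p ∷ _)  (here q)  = here (p , q)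
  both (_ ∷ ps) (there q) = there (both ps q)

  weaken : ∀ {α β x B C} → B ℕ.≤ C → Cover α β x B → Cover α β x C
  weaken p c = record { Cover c ; bounded = ℕ.≤-trans (bounded c) p }

  singleton : ∀ {α β x B} → 0ℤ ≤ x → x < α →
              (∀ i m → 0ℤ ≤ i → 0ℤ ≤ height α β x i m → x ≤ height α β x i m) → Cover α β x (suc B)
  singleton {α} {β} {x} 0≤x x<α least = record
    { points  = [ 0ℤ , 0ℤ ]
    ; bounded = ℕ.s≤s ℕ.z≤n
    ; valid   = (ℤ.≤-refl , subst (0ℤ ≤_) (sym eq) 0≤x , subst (_< α) (sym eq) x<α) ∷ []
    ; covers  = λ i m 0≤i 0≤t → here (0≤i , subst (_≤ height α β x i m) (sym eq) (least i m 0≤i 0≤t))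
    }
    where
    lem : ∀ α β x → x + β * 0ℤ - α * 0ℤ ≡ x
    lem = ℤ-Solver.solve-∀
    eq = lem α β x

  -- Only (0 , 0) is needed for m ≤ 0; the points with m ≥ 1 have i ≥ i₁, so
  -- (i₁ , 1) can be taken as the origin for them.
  peel : ∀ {α β x i₁ x₁ B} → 0ℤ ≤ α → 0ℤ ≤ β → 0ℤ ≤ i₁ → 0ℤ ≤ x → x < α →
         x₁ ≡ x + β * i₁ - α → x₁ < β → Cover α β x₁ B → Cover α β x (suc B)
  peel {α} {β} {x} {i₁} {x₁} 0≤α 0≤β 0≤i₁ 0≤x x<α refl x₁<β c = record
    { points  = (0ℤ , 0ℤ) ∷ map shift (points c)
    ; bounded = ℕ.s≤s (subst (ℕ._≤ _) (sym (length-map shift (points c))) (bounded c))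
    ; valid   = (ℤ.≤-refl , subst (0ℤ ≤_) (sym (origin α β x)) 0≤x , subst (_< α) (sym (origin α β x)) x<α)
              ∷ All.map⁺ (All.map shift-valid (valid c))
    ; covers  = cov
    }
    where
    shift : ℤ × ℤ → ℤ × ℤ
    shift (i , m) = i + i₁ , m + 1ℤ
    origin : ∀ α β x → x + β * 0ℤ - α * 0ℤ ≡ x
    origin = ℤ-Solver.solve-∀
    height-shift : ∀ α β x i₁ i m →
      (x + β * i₁ - α) + β * i - α * m ≡ x + β * (i + i₁) - α * (m + 1ℤ)
    height-shift = ℤ-Solver.solve-∀
    shift-valid : ∀ {p} → Valid α β x₁ p → Valid α β x (shift p)
    shift-valid {i , m} (p , q , r) = p ⊕ 0≤i₁
      , subst (0ℤ ≤_) (height-shift α β x i₁ i m) q , subst (_< α) (height-shift α β x i₁ i m) r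
    back : ∀ i j → i - j + j ≡ i
    back = ℤ-Solver.solve-∀
    unshift : ∀ i m → height α β x₁ (i - i₁) (m - 1ℤ) ≡ height α β x i m
    unshift i m = trans (height-shift α β x i₁ (i - i₁) (m - 1ℤ))
      (trans (cong (λ k → height α β x k (m - 1ℤ + 1ℤ)) (back i i₁)) (cong (height α β x i) (back m 1ℤ)))
    cov : ∀ i m → 0ℤ ≤ i → 0ℤ ≤ height α β x i m →
          Any (Below α β x i m) ((0ℤ , 0ℤ) ∷ map shift (points c))
    cov i m 0≤i 0≤t with m ℤ.≤? 0ℤ
    ... | yes m≤0 = here (0≤i , by (0≤β ⊛ 0≤i ⊕ 0≤α ⊛ gap m≤0) (lem α β x i m))
      where
      lem : ∀ α β x i m → β * i + α * (0ℤ - m) ≡ (x + β * i - α * m) - (x + β * 0ℤ - α * 0ℤ)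
      lem = ℤ-Solver.solve-∀
    ... | no m≰0 = there $ Any.map⁺ $ Any.map (λ {p} → shift-below {p}) $
                     covers c (i - i₁) (m - 1ℤ) 0≤i-i₁ (subst (0ℤ ≤_) (sym (unshift i m)) 0≤t)
      where
      0<m : 0ℤ < m
      0<m = ℤ.≰⇒> m≰0
      lem : ∀ α β x i₁ i m →
        (β - (x + β * i₁ - α) - 1ℤ) + (x + β * i - α * m) + α * (m - 0ℤ - 1ℤ) ≡ β * (i - i₁ + 1ℤ) - 0ℤ - 1ℤ
      lem = ℤ-Solver.solve-∀
      0≤i-i₁ : 0ℤ ≤ i - i₁
      -- The point `(i₁ - 1 , 1)` has height `x₁ - β < 0`, and a larger `m` only lowers the height.
      0≤i-i₁ = cancel 0≤β (by< ((gap< x₁<β ⊕ 0≤t) ⊕ 0≤α ⊛ gap< 0<m) (lem α β x i₁ i m))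
      shift-below : ∀ {p} → Below α β x₁ (i - i₁) (m - 1ℤ) p → Below α β x i m (shift p)
      shift-below {i′ , m′} (p , q) =
        by (gap p) (assoc i i₁ i′) ,
        subst (_≤ _) (height-shift α β x i₁ i′ m′) (subst (_ ≤_) (unshift i m) q)
        where
        assoc : ∀ i j k → i - j - k ≡ i - (k + j)
        assoc = ℤ-Solver.solve-∀

  -- Two steps of the continued fraction algorithm: on the points of height below
  -- γ the change of coordinates i = n + a₁ m, m = l + a₂ n respects the order.
  descend : ∀ {α β γ δ a₁ a₂ x B} → α ≡ a₁ * β + γ → β ≡ a₂ * γ + δ →
            0ℤ < γ → γ ≤ β → 0ℤ ≤ a₁ → γ ≤ α → 0ℤ ≤ x → x < γ →
            Cover γ δ x B → Cover α β x B
  descend {α} {β} {γ} {δ} {a₁} {a₂} {x} α≡ β≡ 0<γ γ≤β 0≤a₁ γ≤α 0≤x x<γ c = record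
    { points  = map lift (points c)
    ; bounded = subst (ℕ._≤ _) (sym (length-map lift (points c))) (bounded c)
    ; valid   = All.map⁺ (All.map (λ {p} → lift-valid {p}) (valid c))
    ; covers  = cov
    }
    where
    0≤γ = ℤ.<⇒≤ 0<γ
    0≤β = ℤ.≤-trans 0≤γ γ≤β
    0≤α = ℤ.≤-trans 0≤γ γ≤α
    lift : ℤ × ℤ → ℤ × ℤ
    lift (n , l) = n + a₁ * (l + a₂ * n) , l + a₂ * n
    height-lift : ∀ n l → height γ δ x n l ≡ height α β x (n + a₁ * (l + a₂ * n)) (l + a₂ * n)
    height-lift n l rewrite α≡ | β≡ = lem γ δ a₁ a₂ x n l
      where
      lem : ∀ γ δ a₁ a₂ x n l → x + δ * n - γ * l ≡
        x + (a₂ * γ + δ) * (n + a₁ * (l + a₂ * n)) - (a₁ * (a₂ * γ + δ) + γ) * (l + a₂ * n)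
      lem = ℤ-Solver.solve-∀
    height-mid : ∀ n m → height α β x (n + a₁ * m) m ≡ x + β * n - γ * m
    height-mid n m rewrite α≡ = lem β γ a₁ x n m
      where
      lem : ∀ β γ a₁ x n m → x + β * (n + a₁ * m) - (a₁ * β + γ) * m ≡ x + β * n - γ * m
      lem = ℤ-Solver.solve-∀
    height-low : ∀ n m → height γ δ x n (m - a₂ * n) ≡ x + β * n - γ * m
    height-low n m rewrite β≡ = lem γ δ a₂ x n m
      where
      lem : ∀ γ δ a₂ x n m → x + δ * n - γ * (m - a₂ * n) ≡ x + (a₂ * γ + δ) * n - γ * m
      lem = ℤ-Solver.solve-∀
    lift-valid : ∀ {p} → Valid γ δ x p → Valid α β x (lift p)
    lift-valid {n , l} (0≤n , 0≤t , t<γ) = 0≤n ⊕ 0≤a₁ ⊛ 0≤m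
      , subst (0ℤ ≤_) (height-lift n l) 0≤t
      , ℤ.<-≤-trans (subst (_< γ) (height-lift n l) t<γ) γ≤α
      where
      0≤m : 0ℤ ≤ l + a₂ * n
      0≤m = cancel 0≤γ (by< (0≤x ⊕ 0≤β ⊛ 0≤n ⊕ gap< t<γ)
        (trans (cong (λ b → x + (b * n + (γ - height γ δ x n l - 1ℤ))) β≡) (lem γ δ a₂ x n l)))
        where
        lem : ∀ γ δ a₂ x n l → x + ((a₂ * γ + δ) * n + (γ - (x + δ * n - γ * l) - 1ℤ)) ≡
              γ * (l + a₂ * n + 1ℤ) - 0ℤ - 1ℤ
        lem = ℤ-Solver.solve-∀
    cov-low : ∀ i m → 0ℤ ≤ i → 0ℤ ≤ height α β x i m → height α β x i m < γ →
              Any (Below α β x i m) (map lift (points c))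
    cov-low i m 0≤i 0≤t t<γ = Any.map⁺ (Any.map (λ {p} → lift-below {p})
        (both (valid c) (covers c n (m - a₂ * n) 0≤n (subst (0ℤ ≤_) (sym t≡low) 0≤t))))
      where
      n = i - a₁ * m
      t≡mid : height α β x i m ≡ x + β * n - γ * m
      t≡mid = trans (cong (λ k → height α β x k m) (lem i (a₁ * m))) (height-mid n m)
        where
        lem : ∀ i j → i ≡ i - j + j
        lem = ℤ-Solver.solve-∀
      t≡low : height γ δ x n (m - a₂ * n) ≡ height α β x i m
      t≡low = trans (height-low n m) (sym t≡mid)
      0≤m : 0ℤ ≤ m
      0≤m = cancel 0≤α (by< (0≤x ⊕ 0≤β ⊛ 0≤i ⊕ gap< (ℤ.<-≤-trans t<γ γ≤α)) (lem α β x i m))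
        where
        lem : ∀ α β x i m → x + (β * i + (α - (x + β * i - α * m) - 1ℤ)) ≡ α * (m + 1ℤ) - 0ℤ - 1ℤ
        lem = ℤ-Solver.solve-∀
      0≤n : 0ℤ ≤ n
      0≤n = cancel 0≤β (by< (subst (0ℤ ≤_) t≡mid 0≤t ⊕ 0≤γ ⊛ 0≤m ⊕ gap< (ℤ.<-≤-trans x<γ γ≤β)) (lem β γ x n m))
        where
        lem : ∀ β γ x n m → (x + β * n - γ * m) + (γ * m + (β - x - 1ℤ)) ≡ β * (n + 1ℤ) - 0ℤ - 1ℤ
        lem = ℤ-Solver.solve-∀
      lift-below : ∀ {p} → Valid γ δ x p × Below γ δ x n (m - a₂ * n) p → Below α β x i m (lift p)
      lift-below {n′ , l′} ((_ , 0≤s , _) , n′≤n , t′≤t) = i′≤i , t′≤t″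
        where
        m′ = l′ + a₂ * n′
        i′ = n′ + a₁ * m′
        t  = height α β x i m
        t′ = height α β x i′ m′
        0≤t′ : 0ℤ ≤ t′
        0≤t′ = subst (0ℤ ≤_) (height-lift n′ l′) 0≤s
        t′≤t″ : t′ ≤ t
        t′≤t″ = subst (_≤ t) (height-lift n′ l′) (subst (_ ≤_) t≡low t′≤t)
        -- `γ (m - m′) = β (n - n′) + t′ - t`, and `t - t′ < γ`. This is where the restriction to
        -- heights below `γ` makes the change of coordinates monotone.
        m′≤m : m′ ≤ m
        m′≤m = ℤ.0≤i-j⇒j≤i (cancel 0≤γ (by< (0≤β ⊛ gap n′≤n ⊕ gap< t<γ ⊕ 0≤t′) eq))
          where
          eq : β * (n - n′) + ((γ - t - 1ℤ) + t′) ≡ γ * (m - m′ + 1ℤ) - 0ℤ - 1ℤ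
          eq = trans (cong (λ s → β * (n - n′) + ((γ - s - 1ℤ) + t′)) t≡mid)
              (trans (cong (λ s → β * (n - n′) + ((γ - (x + β * n - γ * m) - 1ℤ) + s)) (height-mid n′ m′))
                     (lem β γ x n m n′ m′))
            where
            lem : ∀ β γ x n m n′ m′ →
              β * (n - n′) + ((γ - (x + β * n - γ * m) - 1ℤ) + (x + β * n′ - γ * m′)) ≡
              γ * (m - m′ + 1ℤ) - 0ℤ - 1ℤ
            lem = ℤ-Solver.solve-∀
        i′≤i : i′ ≤ i
        i′≤i = ℤ.0≤i-j⇒j≤i (cancel 0≤β
          (by< (gap t′≤t″ ⊕ 0≤α ⊛ gap m′≤m ⊕ gap< (ℤ.<-≤-trans 0<γ γ≤β)) (lem α β x i m i′ m′)))
          where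
          lem : ∀ α β x i m i′ m′ →
            ((x + β * i - α * m) - (x + β * i′ - α * m′)) + (α * (m - m′) + (β - 0ℤ - 1ℤ)) ≡
            β * (i - i′ + 1ℤ) - 0ℤ - 1ℤ
          lem = ℤ-Solver.solve-∀
    cov : ∀ i m → 0ℤ ≤ i → 0ℤ ≤ height α β x i m → Any (Below α β x i m) (map lift (points c))
    cov i m 0≤i 0≤t with height α β x i m ℤ.<? γ
    ... | yes t<γ = cov-low i m 0≤i 0≤t t<γ
    -- A point of height at least `γ` lies above the origin, whose height is `x < γ`, so whatever
    -- dominates the origin dominates it too.
    ... | no  t≮γ = Any.map (λ (p , q) → ℤ.≤-trans p 0≤i , ℤ.≤-trans q (ℤ.≤-trans origin≤γ (ℤ.≮⇒≥ t≮γ)))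
                      (cov-low 0ℤ 0ℤ ℤ.≤-refl (subst (0ℤ ≤_) (sym origin) 0≤x) (subst (_< γ) (sym origin) x<γ))
      where
      lem : ∀ α β x → x + β * 0ℤ - α * 0ℤ ≡ x
      lem = ℤ-Solver.solve-∀
      origin = lem α β x
      origin≤γ = subst (_≤ γ) (sym origin) (ℤ.<⇒≤ x<γ)

  -- One extra point buys all `x < α`: once the origin is split off, the first point of the row
  -- `m = 1` has height `(x - α) mod β`, which is below `β`. For `β = 0` the height does not depend
  -- on `i`, and the origin alone suffices.
  extend-start : ∀ {α B} β → 0ℤ < α → 0ℤ ≤ β → (∀ x → 0ℤ ≤ x → x < β → Cover α β x B) →
                 ∀ x → 0ℤ ≤ x → x < α → Cover α β x (suc B)
  extend-start {α} (+ zero) 0<α _ _ x 0≤x x<α = singleton 0≤x x<α least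
    where
    least : ∀ i m → 0ℤ ≤ i → 0ℤ ≤ height α 0ℤ x i m → x ≤ height α 0ℤ x i m
    least i m _ 0≤t = by (0≤α ⊛ cancel 0≤α (by< (0≤t ⊕ gap< x<α) (lem₁ α x i m))) (lem₂ α x i m)
      where
      0≤α = ℤ.<⇒≤ 0<α
      lem₁ : ∀ α x i m → (x + 0ℤ * i - α * m) + (α - x - 1ℤ) ≡ α * (ℤ.- m + 1ℤ) - 0ℤ - 1ℤ
      lem₁ = ℤ-Solver.solve-∀
      lem₂ : ∀ α x i m → α * (ℤ.- m) ≡ (x + 0ℤ * i - α * m) - x
      lem₂ = ℤ-Solver.solve-∀
  extend-start {α} β@(+ suc b) 0<α 0≤β H x 0≤x x<α with x ℤ.<? β
  ... | yes x<β = weaken (ℕ.n≤1+n _) (H x 0≤x x<β)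
  ... | no  x≮β = peel (ℤ.<⇒≤ 0<α) 0≤β 0≤i₁ 0≤x x<α x₁≡ r<β (H (+ r) (+≤+ ℕ.z≤n) r<β)
    where
    r = (x - α) ℤ.%ℕ suc b
    q = (x - α) ℤ./ℕ suc b
    i₁ = ℤ.- q
    r<β : + r < β
    r<β = ℤ.+<+ (ℤ.n%ℕd<d (x - α) (suc b))
    divMod : x - α ≡ + r + q * β
    divMod = ℤ.a≡a%ℕn+[a/ℕn]*n (x - α) (suc b)
    x₁≡ : + r ≡ x + β * i₁ - α
    x₁≡ = trans (lem₁ (+ r) q β) (trans (cong (λ z → z - q * β) (sym divMod)) (lem₂ x α q β))
      where
      lem₁ : ∀ r q β → r ≡ (r + q * β) - q * β
      lem₁ = ℤ-Solver.solve-∀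
      lem₂ : ∀ x α q β → (x - α) - q * β ≡ x + β * (ℤ.- q) - α
      lem₂ = ℤ-Solver.solve-∀
    0≤i₁ : 0ℤ ≤ i₁
    0≤i₁ = cancel 0≤β (by< (gap< x<α ⊕ +≤+ {0} {r} ℕ.z≤n ⊕ 0≤β)
             (trans (cong (λ z → (α - x - 1ℤ) + (z + β)) x₁≡) (lem x α q β)))
      where
      lem : ∀ x α q β → (α - x - 1ℤ) + ((x + β * (ℤ.- q) - α) + β) ≡ β * (ℤ.- q + 1ℤ) - 0ℤ - 1ℤ
      lem = ℤ-Solver.solve-∀

  -- Denominator first: the pair `(α , β)` stands for `β / α = [0; as]`, and the recursion is
  -- `1 / (b + β / α) = α / (b α + β)`.
  frac : List ℕ → ℕ × ℕ
  frac []       = 1 , 0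
  frac (b ∷ bs) = let (α , β) = frac bs in b ℕ.* α ℕ.+ β , α

  num den : List ℕ → ℤ
  num = +_ ∘ proj₂ ∘ frac
  den = +_ ∘ proj₁ ∘ frac

  den-∷ : ∀ b bs → den (b ∷ bs) ≡ + b * den bs + num bs
  den-∷ b bs = trans (ℤ.pos-+ (b ℕ.* proj₁ (frac bs)) _) (cong (_+ num bs) (ℤ.pos-* b _))

  den-positive : ∀ as → All (0 ℕ.<_) as → 0 ℕ.< proj₁ (frac as)
  den-positive []       _        = ℕ.s≤s ℕ.z≤n
  den-positive (b ∷ bs) (p ∷ ps) = ℕ.≤-trans (ℕ.*-mono-≤ p (den-positive bs ps)) (ℕ.m≤m+n _ _)

  num≤den : ∀ as → All (0 ℕ.<_) as → proj₂ (frac as) ℕ.≤ proj₁ (frac as)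
  num≤den []       _        = ℕ.z≤n
  num≤den (b ∷ bs) (p ∷ ps) = ℕ.≤-trans
    (ℕ.≤-trans (ℕ.≤-reflexive (sym (ℕ.*-identityˡ _))) (ℕ.*-monoˡ-≤ _ p)) (ℕ.m≤m+n _ _)

  -- Induction by two quotients at a time. `descend` absorbs `a₁` for free. Since `x < a₂ γ + δ`, at
  -- most `a₂` subtractions of `γ` bring `x` into the range of the induction hypothesis, and each
  -- costs one point.
  cover-small : ∀ as → All (0 ℕ.<_) as → ∀ x → 0ℤ ≤ x → x < num as →
                Cover (den as) (num as) x (suc (evenSum as))
  cover-small [] _ x 0≤x x<0 = contradiction x<0 (ℤ.≤⇒≯ 0≤x)
  cover-small as@(a ∷ []) ps x 0≤x x<1 =
    singleton 0≤x (ℤ.<-≤-trans x<1 (+≤+ (num≤den as ps))) (λ i m _ 0≤t → ℤ.≤-trans x≤0 0≤t)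
    where
    x≤0 : x ≤ 0ℤ
    x≤0 = by (gap< x<1) (lem x)
      where
      lem : ∀ x → 1ℤ - x - 1ℤ ≡ 0ℤ - x
      lem = ℤ-Solver.solve-∀
  cover-small as@(a₁ ∷ a₂ ∷ bs) ps@(p₁ ∷ p₂ ∷ pbs) x 0≤x x<β =
    subst (Cover α β x) (ℕ.+-suc a₂ (evenSum bs))
      (go a₂ (ℤ.≤-reflexive (sym (den-∷ a₂ bs))) x 0≤x (subst (x <_) (den-∷ a₂ bs) x<β))
    where
    α = den as
    β = num as
    γ = den bs
    δ = num bs
    B = suc (evenSum bs)
    0<γ : 0ℤ < γ
    0<γ = ℤ.+<+ (den-positive bs pbs)
    γ≤β : γ ≤ β
    γ≤β = +≤+ (num≤den (a₂ ∷ bs) (p₂ ∷ pbs))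
    β≤α : β ≤ α
    β≤α = +≤+ (num≤den as ps)
    low : ∀ {x B} → 0ℤ ≤ x → x < γ → Cover γ δ x B → Cover α β x B
    low = descend {a₁ = + a₁} {a₂ = + a₂} (den-∷ a₁ (a₂ ∷ bs)) (den-∷ a₂ bs) 0<γ γ≤β
            (+≤+ ℕ.z≤n) (ℤ.≤-trans γ≤β β≤α)
    go : ∀ a → + a * γ + δ ≤ β → ∀ x → 0ℤ ≤ x → x < + a * γ + δ → Cover α β x (a ℕ.+ B)
    go zero _ x 0≤x x<δ = low 0≤x (ℤ.<-≤-trans x<δ′ (+≤+ (num≤den bs pbs))) (cover-small bs pbs x 0≤x x<δ′)
      where
      x<δ′ : x < δ
      x<δ′ = subst (x <_) (trans (cong (_+ δ) (ℤ.*-zeroˡ γ)) (ℤ.+-identityˡ δ)) x<δ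
    go (suc a) bnd x 0≤x x<r with x ℤ.<? γ
    -- The point spent by `extend-start` is covered by the count `suc a`, none of which is used up
    -- by further peeling.
    ... | yes x<γ = weaken (ℕ.s≤s (ℕ.m≤n+m B a)) (low 0≤x x<γ
            (extend-start δ 0<γ (+≤+ ℕ.z≤n) (cover-small bs pbs) x 0≤x x<γ))
    -- The new origin is `(a₁ , 1)`, of height `x + β a₁ - α = x - γ`.
    ... | no x≮γ = peel (ℤ.≤-trans (ℤ.<⇒≤ 0<γ) (ℤ.≤-trans γ≤β β≤α)) (+≤+ ℕ.z≤n) (+≤+ ℕ.z≤n)
            0≤x (ℤ.<-≤-trans x<β″ β≤α) eq (ℤ.≤-<-trans (by (ℤ.<⇒≤ 0<γ) (lem₃ x γ)) x<β″)
            (go a (ℤ.≤-trans (by (ℤ.<⇒≤ 0<γ) (lem₂ (+ a) γ δ)) bnd)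
               (x - γ) (gap (ℤ.≮⇒≥ x≮γ)) (by< (gap< x<r) (lem₁ (+ a) γ δ x)))
      where
      x<β″ : x < β
      x<β″ = ℤ.<-≤-trans x<r bnd
      lem₁ : ∀ a γ δ x → (1ℤ + a) * γ + δ - x - 1ℤ ≡ a * γ + δ - (x - γ) - 1ℤ
      lem₁ = ℤ-Solver.solve-∀
      lem₂ : ∀ a γ δ → γ ≡ (1ℤ + a) * γ + δ - (a * γ + δ)
      lem₂ = ℤ-Solver.solve-∀
      lem₃ : ∀ x γ → γ ≡ x - (x - γ)
      lem₃ = ℤ-Solver.solve-∀
      eq : x - γ ≡ x + β * + a₁ - α
      eq = trans (lem₄ x β γ (+ a₁)) (cong (λ z → x + β * + a₁ - z) (sym (den-∷ a₁ (a₂ ∷ bs))))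
        where
        lem₄ : ∀ x β γ a → x - γ ≡ x + β * a - (a * β + γ)
        lem₄ = ℤ-Solver.solve-∀

  -- Writing `x = r + q α`, the translation `m ↦ m + q` reduces to the residue `r < α`. The 2 is one
  -- point from `extend-start` and one from `cover-small`.
  cover : ∀ as → All (0 ℕ.<_) as → ∀ x → Cover (den as) (num as) x (2 ℕ.+ evenSum as)
  cover as ps x = record
    { points  = map shift (points c)
    ; bounded = subst (ℕ._≤ _) (sym (length-map shift (points c))) (bounded c)
    ; valid   = All.map⁺ (All.map (λ {(i , m)} (p , q , r) →
                  p , subst (0ℤ ≤_) (eq i m) q , subst (_< α) (eq i m) r) (valid c))
    ; covers  = λ i m 0≤i 0≤t → Any.map⁺ (Any.map
                  (λ {(i′ , m′)} (p , q) → p , subst (_≤ height α β x i m) (eq i′ m′)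
                    (subst (_ ≤_) (eq′ i m) q))
                  (covers c i (m - q) 0≤i (subst (0ℤ ≤_) (sym (eq′ i m)) 0≤t)))
    }
    where
    instance
      nz : ℕ.NonZero (proj₁ (frac as))
      nz = ℕ.>-nonZero (den-positive as ps)
    α = den as
    β = num as
    r = x ℤ.%ℕ proj₁ (frac as)
    q = x ℤ./ℕ proj₁ (frac as)
    c : Cover α β (+ r) (2 ℕ.+ evenSum as)
    c = extend-start β (ℤ.+<+ (den-positive as ps)) (+≤+ ℕ.z≤n)
          (cover-small as ps) (+ r) (+≤+ ℕ.z≤n) (ℤ.+<+ (ℤ.n%ℕd<d x (proj₁ (frac as))))
    shift : ℤ × ℤ → ℤ × ℤ
    shift (i , m) = i , m + q
    eq : ∀ i m → height α β (+ r) i m ≡ height α β x i (m + q)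
    eq i m = trans (lem α β (+ r) q i m)
      (cong (λ z → z + β * i - α * (m + q)) (sym (ℤ.a≡a%ℕn+[a/ℕn]*n x (proj₁ (frac as)))))
      where
      lem : ∀ α β r q i m → r + β * i - α * m ≡ (r + q * α) + β * i - α * (m + q)
      lem = ℤ-Solver.solve-∀
    eq′ : ∀ i m → height α β (+ r) i (m - q) ≡ height α β x i m
    eq′ i m = trans (eq i (m - q)) (cong (height α β x i) (lem m q))
      where
      lem : ∀ m q → m - q + q ≡ m
      lem = ℤ-Solver.solve-∀

-- The value of a continued fraction, and clearing of denominators.

module Fractions where
  open LatticePoints using (frac; den-positive; num; den; den-∷)

  private
    recip-fraction : ∀ n d → recip (fromℚᵘ (mkℚᵘ (+ suc n) d)) ≡ fromℚᵘ (mkℚᵘ (+ suc d) n)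
    recip-fraction n d = go
      where
      q = fromℚᵘ (mkℚᵘ (+ suc n) d)
      r = fromℚᵘ (mkℚᵘ (+ suc d) n)
      q*r≡1 : q ℚ.* r ≡ 1ℚ
      q*r≡1 = ℚ.toℚᵘ-injective (begin
        toℚᵘ (q ℚ.* r)                             ≈⟨ ℚ.toℚᵘ-homo-* q r ⟩
        toℚᵘ q ℚᵘ.* toℚᵘ r
          ≈⟨ ℚᵘ.*-cong (ℚ.toℚᵘ-fromℚᵘ (mkℚᵘ (+ suc n) d)) (ℚ.toℚᵘ-fromℚᵘ (mkℚᵘ (+ suc d) n)) ⟩
        mkℚᵘ (+ suc n) d ℚᵘ.* mkℚᵘ (+ suc d) n     ≈⟨ *≡* (lem (+ suc n) (+ suc d)) ⟩
        toℚᵘ 1ℚ                                    ∎)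
        where
        open SetoidReasoning ℚᵘ.≃-setoid
        lem : ∀ x y → x ℤ.* y ℤ.* 1ℤ ≡ 1ℤ ℤ.* (y ℤ.* x)
        lem = ℤ-Solver.solve-∀
      go : recip q ≡ r
      go with q ℚ.≟ 0ℚ
      ... | yes q≡0 = contradiction (trans (sym (trans (cong (ℚ._* r) q≡0) (ℚ.*-zeroˡ r))) q*r≡1) λ ()
      ... | no  q≢0 = begin
        1/q                  ≡⟨ ℚ.*-identityʳ 1/q ⟨
        1/q ℚ.* 1ℚ           ≡⟨ cong (1/q ℚ.*_) q*r≡1 ⟨
        1/q ℚ.* (q ℚ.* r)    ≡⟨ ℚ.*-assoc 1/q q r ⟨
        (1/q ℚ.* q) ℚ.* r    ≡⟨ cong (ℚ._* r) (ℚ.*-inverseˡ q {{ℚ.≢-nonZero q≢0}}) ⟩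
        1ℚ ℚ.* r             ≡⟨ ℚ.*-identityˡ r ⟩
        r                    ∎
        where
        open ≡-Reasoning
        1/q = ℚ.1/_ q {{ℚ.≢-nonZero q≢0}}

    mkℚᵘ≃ : ∀ {n n′} {d d′} → n ≡ n′ → d ≡ d′ → mkℚᵘ n d ≃ mkℚᵘ n′ d′
    mkℚᵘ≃ refl refl = *≡* refl

  -- In short, `ν = a₀ + num / den`. The predecessor appears because `mkℚᵘ` stores a denominator
  -- minus one.
  value : ∀ a₀ as → All (0 ℕ.<_) as → ⟦ a₀ ⨾ as ⟧ ≡ fromℚᵘ (mkℚᵘ (num as ℤ.+ a₀ ℤ.* den as) (ℕ.pred (proj₁ (frac as))))
  value a₀ [] [] = ℚ.fromℚᵘ-cong (mkℚᵘ≃ (lem a₀) refl)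
    where
    lem : ∀ a → a ≡ 0ℤ ℤ.+ a ℤ.* 1ℤ
    lem = ℤ-Solver.solve-∀
  value a₀ (b ∷ bs) (pb ∷ ps) = begin
    a₀ ℚ./ 1 ℚ.+ recip ⟦ + b ⨾ bs ⟧                    ≡⟨ cong (λ q → a₀ ℚ./ 1 ℚ.+ recip q) inner ⟩
    a₀ ℚ./ 1 ℚ.+ recip (fromℚᵘ (mkℚᵘ (+ suc n) d))     ≡⟨ cong (a₀ ℚ./ 1 ℚ.+_) (recip-fraction n d) ⟩
    fromℚᵘ (mkℚᵘ a₀ 0) ℚ.+ fromℚᵘ (mkℚᵘ (+ suc d) n)   ≡⟨ outer ⟩
    fromℚᵘ (mkℚᵘ (+ suc d ℤ.+ a₀ ℤ.* + suc n) n)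
      ≡⟨ ℚ.fromℚᵘ-cong (mkℚᵘ≃ (cong₂ (λ k l → + k ℤ.+ a₀ ℤ.* + l) suc-d suc-n) refl) ⟩
    fromℚᵘ (mkℚᵘ (num (b ∷ bs) ℤ.+ a₀ ℤ.* den (b ∷ bs)) n) ∎
    where
    open ≡-Reasoning
    d = ℕ.pred (proj₁ (frac bs))
    n = ℕ.pred (proj₁ (frac (b ∷ bs)))
    suc-d : suc d ≡ proj₁ (frac bs)
    suc-d = ℕ.suc-pred (proj₁ (frac bs)) {{ℕ.>-nonZero (den-positive bs ps)}}
    suc-n : suc n ≡ proj₁ (frac (b ∷ bs))
    suc-n = ℕ.suc-pred (proj₁ (frac (b ∷ bs))) {{ℕ.>-nonZero (den-positive (b ∷ bs) (pb ∷ ps))}}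
    inner : ⟦ + b ⨾ bs ⟧ ≡ fromℚᵘ (mkℚᵘ (+ suc n) d)
    inner = trans (value (+ b) bs ps) (ℚ.fromℚᵘ-cong (mkℚᵘ≃
      (trans (ℤ.+-comm (num bs) (+ b ℤ.* den bs)) (trans (sym (den-∷ b bs)) (cong +_ (sym suc-n)))) refl))
    outer : fromℚᵘ (mkℚᵘ a₀ 0) ℚ.+ fromℚᵘ (mkℚᵘ (+ suc d) n) ≡ fromℚᵘ (mkℚᵘ (+ suc d ℤ.+ a₀ ℤ.* + suc n) n)
    outer = ℚ.toℚᵘ-injective (S.begin
      toℚᵘ (fromℚᵘ (mkℚᵘ a₀ 0) ℚ.+ fromℚᵘ (mkℚᵘ (+ suc d) n))
        S.≈⟨ ℚ.toℚᵘ-homo-+ (fromℚᵘ (mkℚᵘ a₀ 0)) (fromℚᵘ (mkℚᵘ (+ suc d) n)) ⟩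
      toℚᵘ (fromℚᵘ (mkℚᵘ a₀ 0)) ℚᵘ.+ toℚᵘ (fromℚᵘ (mkℚᵘ (+ suc d) n))
        S.≈⟨ ℚᵘ.+-cong (ℚ.toℚᵘ-fromℚᵘ (mkℚᵘ a₀ 0)) (ℚ.toℚᵘ-fromℚᵘ (mkℚᵘ (+ suc d) n)) ⟩
      mkℚᵘ a₀ 0 ℚᵘ.+ mkℚᵘ (+ suc d) n
        S.≈⟨ *≡* (trans (lem a₀ (+ suc d) (+ suc n)) 
            (cong (λ k → (+ suc d ℤ.+ a₀ ℤ.* + suc n) ℤ.* + suc k) (sym (ℕ.+-identityʳ n)))) ⟩
      mkℚᵘ (+ suc d ℤ.+ a₀ ℤ.* + suc n) n
        S.≈⟨ ℚ.toℚᵘ-fromℚᵘ (mkℚᵘ (+ suc d ℤ.+ a₀ ℤ.* + suc n) n) ⟨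
      toℚᵘ (fromℚᵘ (mkℚᵘ (+ suc d ℤ.+ a₀ ℤ.* + suc n) n)) S.∎)
      where
      module S = SetoidReasoning ℚᵘ.≃-setoid
      lem : ∀ a d n → (a ℤ.* n ℤ.+ d ℤ.* 1ℤ) ℤ.* n ≡ (d ℤ.+ a ℤ.* n) ℤ.* n
      lem = ℤ-Solver.solve-∀

  -- Multiplication by the positive denominator makes the defining inequality of `S_ν` integral, so
  -- that all weights below are integers.
  nonneg⇔ : ∀ β α-1 m i → 0ℚ ℚ.≤ m ℚ./ 1 ℚ.+ fromℚᵘ (mkℚᵘ β α-1) ℚ.* (+ i ℚ./ 1) ⇔
                         0ℤ ℤ.≤ + suc α-1 ℤ.* m ℤ.+ β ℤ.* + i
  nonneg⇔ β a m i = mk⇔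
    (λ p → subst₂ ℤ._≤_ refl (lem₂ (+ suc a) m β (+ i)) (drop (ℚᵘ.≤-respʳ-≃ eq (ℚ.toℚᵘ-mono-≤ p))))
    (λ p → ℚ.toℚᵘ-cancel-≤ (ℚᵘ.≤-respʳ-≃ (ℚᵘ.≃-sym eq) (*≤* (subst₂ ℤ._≤_ refl (sym (lem₂ (+ suc a) m β (+ i))) p))))
    where
    open SetoidReasoning ℚᵘ.≃-setoid
    X = + suc a ℤ.* m ℤ.+ β ℤ.* + i
    ν = fromℚᵘ (mkℚᵘ β a)
    lem₁ : ∀ a m b i → (m ℤ.* (a ℤ.* 1ℤ) ℤ.+ b ℤ.* i ℤ.* 1ℤ) ℤ.* a ≡ (a ℤ.* m ℤ.+ b ℤ.* i) ℤ.* (1ℤ ℤ.* (a ℤ.* 1ℤ))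
    lem₁ = ℤ-Solver.solve-∀
    lem₂ : ∀ a m b i → (a ℤ.* m ℤ.+ b ℤ.* i) ℤ.* 1ℤ ≡ a ℤ.* m ℤ.+ b ℤ.* i
    lem₂ = ℤ-Solver.solve-∀
    eq : toℚᵘ (m ℚ./ 1 ℚ.+ ν ℚ.* (+ i ℚ./ 1)) ≃ mkℚᵘ X a
    eq = begin
      toℚᵘ (m ℚ./ 1 ℚ.+ ν ℚ.* (+ i ℚ./ 1))                  ≈⟨ ℚ.toℚᵘ-homo-+ (m ℚ./ 1) (ν ℚ.* (+ i ℚ./ 1)) ⟩
      toℚᵘ (m ℚ./ 1) ℚᵘ.+ toℚᵘ (ν ℚ.* (+ i ℚ./ 1))
        ≈⟨ ℚᵘ.+-cong (ℚ.toℚᵘ-fromℚᵘ (mkℚᵘ m 0)) (ℚᵘ.≃-trans (ℚ.toℚᵘ-homo-* ν (+ i ℚ./ 1))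
            (ℚᵘ.*-cong (ℚ.toℚᵘ-fromℚᵘ (mkℚᵘ β a)) (ℚ.toℚᵘ-fromℚᵘ (mkℚᵘ (+ i) 0)))) ⟩
      mkℚᵘ m 0 ℚᵘ.+ mkℚᵘ β a ℚᵘ.* mkℚᵘ (+ i) 0              ≈⟨ *≡* (lem₁ (+ suc a) m β (+ i)) ⟩
      mkℚᵘ X a                                              ∎
    drop : toℚᵘ 0ℚ ℚᵘ.≤ mkℚᵘ X a → 0ℤ ℤ.≤ X ℤ.* 1ℤ
    drop (*≤* p) = subst (ℤ._≤ X ℤ.* 1ℤ) (ℤ.*-zeroˡ (+ suc a)) p

-- The valuation of `K`, scaled by `α`.

module Weights {a} (D : CompleteDVR a) (α-1 : ℕ) where
  open CompleteDVR D using (K; v; v-cong; v-⊤; v-*; v-+; v-π; π; ι; 1≉0; inverse)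
  open CommutativeRing K renaming (refl to ≈-refl; sym to ≈-sym; trans to ≈-trans)
  open MonoidSum +-monoid using (sum)

  α : ℤ
  α = + suc α-1

  -- α v(x) ≥ j, vacuously so when v(x) = ∞.
  Wt : ℤ → Carrier → Set
  Wt j x = ∀ m → v x ≡ [ m ]⁺ → j ℤ.≤ α ℤ.* m

  wt-resp : ∀ {j x y} → x ≈ y → Wt j x → Wt j y
  wt-resp x≈y w m eq = w m (≡.trans (v-cong x≈y) eq)

  Wt≡ : ∀ {j k x} → j ≡ k → Wt j x → Wt k x
  Wt≡ refl w = w

  wt-mono : ∀ {j k x} → k ℤ.≤ j → Wt j x → Wt k x
  wt-mono k≤j w m eq = ℤ.≤-trans k≤j (w m eq)

  v-0 : v 0# ≡ ⊤⁺
  v-0 = Equivalence.from (v-⊤ 0#) ≈-refl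

  ≈0? : ∀ x → Dec (x ≈ 0#)
  ≈0? x with v x in eq
  ... | ⊤⁺     = yes (Equivalence.to (v-⊤ x) eq)
  ... | [ m ]⁺ = no λ x≈0 → contradiction (≡.trans (≡.sym eq) (Equivalence.from (v-⊤ x) x≈0)) λ ()

  v-finite : ∀ {x} → ¬ (x ≈ 0#) → ∃ λ m → v x ≡ [ m ]⁺
  v-finite {x} x≉0 with v x in eq
  ... | ⊤⁺     = contradiction (Equivalence.to (v-⊤ x) eq) x≉0
  ... | [ m ]⁺ = m , refl

  finite-≉0 : ∀ {x m} → v x ≡ [ m ]⁺ → ¬ (x ≈ 0#)
  finite-≉0 {x} eq x≈0 = contradiction (≡.trans (≡.sym eq) (Equivalence.from (v-⊤ x) x≈0)) λ ()

  wt-0 : ∀ {j} → Wt j 0#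
  wt-0 m eq = contradiction (≡.trans (≡.sym v-0) eq) λ ()

  wt-+ : ∀ {j x y} → Wt j x → Wt j y → Wt j (x + y)
  wt-+ {j} {x} {y} wx wy m eq with v x in ex | v y in ey | subst (v x ⊓⁺ v y ≤⁺_) eq (v-+ x y)
  ... | ⊤⁺     | ⊤⁺     | ()
  ... | ⊤⁺     | [ l ]⁺ | Supremum.[ p ] = ℤ.≤-trans (wy l refl) (ℤ.*-monoˡ-≤-nonNeg α p)
  ... | [ k ]⁺ | ⊤⁺     | Supremum.[ p ] = ℤ.≤-trans (wx k refl) (ℤ.*-monoˡ-≤-nonNeg α p)
  ... | [ k ]⁺ | [ l ]⁺ | Supremum.[ p ] with ℤ.⊓-sel k l
  ...   | inj₁ e = ℤ.≤-trans (wx k refl) (ℤ.*-monoˡ-≤-nonNeg α (subst (ℤ._≤ m) e p))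
  ...   | inj₂ e = ℤ.≤-trans (wy l refl) (ℤ.*-monoˡ-≤-nonNeg α (subst (ℤ._≤ m) e p))

  v-*⁻¹ : ∀ {x y m} → v (x * y) ≡ [ m ]⁺ →
          ∃₂ λ k l → v x ≡ [ k ]⁺ × v y ≡ [ l ]⁺ × k ℤ.+ l ≡ m
  v-*⁻¹ {x} {y} eq with v x | v y | ≡.trans (≡.sym (v-* x y)) eq
  ... | [ k ]⁺ | [ l ]⁺ | e  = k , l , refl , refl , []-injective e
  ... | ⊤⁺     | [ _ ]⁺ | ()
  ... | ⊤⁺     | ⊤⁺     | ()
  ... | [ _ ]⁺ | ⊤⁺     | ()

  wt-* : ∀ {j k x y} → Wt j x → Wt k y → Wt (j ℤ.+ k) (x * y)
  wt-* {j} {k} wx wy m eq with v-*⁻¹ eq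
  ... | p , q , ex , ey , refl = subst (j ℤ.+ k ℤ.≤_) (≡.sym (ℤ.*-distribˡ-+ α p q))
                                   (ℤ.+-mono-≤ (wx p ex) (wy q ey))

  private
    double-zero : ∀ {m} → m ℤ.+ m ≡ 0ℤ → m ≡ 0ℤ
    double-zero {m} eq = ℤ.*-cancelˡ-≡ (+ 2) m 0ℤ (≡.trans (two m) eq)
      where
      two : ∀ m → + 2 ℤ.* m ≡ m ℤ.+ m
      two = ℤ-Solver.solve-∀

  v-1 : v 1# ≡ [ 0ℤ ]⁺
  v-1 with v-finite 1≉0
  ... | m , e = ≡.trans e (cong [_]⁺ (idempotent m ([]-injective
                 (≡.trans (≡.sym (cong₂ _+⁺_ e e)) (≡.trans (≡.sym (v-* 1# 1#)) (≡.trans (v-cong (*-identityˡ 1#)) e))))))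
    where
    idempotent : ∀ m → m ℤ.+ m ≡ m → m ≡ 0ℤ
    idempotent m eq = ≡.trans (lem m) (≡.trans (cong (ℤ._- m) eq) (ℤ.+-inverseʳ m))
      where
      lem : ∀ m → m ≡ m ℤ.+ m ℤ.- m
      lem = ℤ-Solver.solve-∀

  -- From `(-1)² = 1` the value `k` of `-1` satisfies `k + k = 0`.
  v-negate-1 : v (- 1#) ≡ [ 0ℤ ]⁺
  v-negate-1 with v-*⁻¹ (≡.trans (v-cong square) v-1)
    where
    open RingProperties ring using (-‿distribˡ-*; -‿distribʳ-*; -‿involutive)
    square : - 1# * - 1# ≈ 1#
    square = ≈-trans (≈-sym (-‿distribˡ-* 1# (- 1#))) (≈-trans (-‿cong (*-identityˡ (- 1#))) (-‿involutive 1#))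
  ... | k , l , ek , el , k+l≡0 with refl ← []-injective (≡.trans (≡.sym ek) el) =
    ≡.trans ek (cong [_]⁺ (double-zero k+l≡0))

  wt-exact : ∀ {x m} → v x ≡ [ m ]⁺ → Wt (α ℤ.* m) x
  wt-exact {m = m} e k eq with refl ← []-injective (≡.trans (≡.sym e) eq) = ℤ.≤-refl

  wt-1 : Wt 0ℤ 1#
  wt-1 = subst (λ j → Wt j 1#) (ℤ.*-zeroʳ α) (wt-exact v-1)

  wt-neg : ∀ {j x} → Wt j x → Wt j (- x)
  wt-neg {j} {x} w = wt-resp (-1*x≈-x x) 
    (Wt≡ (≡.trans (cong (ℤ._+ j) (ℤ.*-zeroʳ α)) (ℤ.+-identityˡ j)) (wt-* (wt-exact v-negate-1) w))
    where open RingProperties ring using (-1*x≈-x)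

  wt-sum : ∀ {j} n (t : Fin n → Carrier) → (∀ i → Wt j (t i)) → Wt j (sum t)
  wt-sum zero    t w = wt-0
  wt-sum (suc n) t w = wt-+ (w Fin.zero) (wt-sum n (t ∘ Fin.suc) (w ∘ Fin.suc))

  -- A non-zero element has a finite valuation, which cannot exceed every integer.
  wt-⋂ : ∀ {x} j → (∀ n → Wt (j ℤ.+ + n) x) → x ≈ 0#
  wt-⋂ {x} j w with ≈0? x
  ... | yes x≈0 = x≈0
  ... | no  x≉0 with v-finite x≉0
  ...   | m , e = contradiction (ℤ.≤-trans large (w (suc ℤ.∣ α ℤ.* m ℤ.- j ∣) m e)) (ℤ.<⇒≱ (ℤ.suc[i]≤j⇒i<j ℤ.≤-refl))
    where
    n = ℤ.∣ α ℤ.* m ℤ.- j ∣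
    lem : ∀ x j → 1ℤ ℤ.+ x ≡ j ℤ.+ (1ℤ ℤ.+ (x ℤ.- j))
    lem = ℤ-Solver.solve-∀
    i≤∣i∣ : ∀ i → i ℤ.≤ + ℤ.∣ i ∣
    i≤∣i∣ (+ n)         = ℤ.≤-refl
    i≤∣i∣ (ℤ.-[1+ n ]) = ℤ.-≤+
    large : ℤ.suc (α ℤ.* m) ℤ.≤ j ℤ.+ + suc n
    large = subst (ℤ._≤ j ℤ.+ + suc n) (≡.sym (lem (α ℤ.* m) j))
              (ℤ.+-monoʳ-≤ j (ℤ.+-monoʳ-≤ 1ℤ (i≤∣i∣ (α ℤ.* m ℤ.- j))))

  invert : ∀ {x m} → v x ≡ [ m ]⁺ → ∃ λ y → x * y ≈ 1# × v y ≡ [ ℤ.- m ]⁺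
  invert {x} {m} e with inverse x (finite-≉0 e)
  ... | y , xy≈1 with v-*⁻¹ (≡.trans (v-cong xy≈1) v-1)
  ...   | k , l , ek , el , k+l≡0 with refl ← []-injective (≡.trans (≡.sym ek) e) =
    y , xy≈1 , ≡.trans el (cong [_]⁺ (≡.trans (lem k l) (≡.trans (cong (ℤ._- k) k+l≡0) (ℤ.+-identityˡ (ℤ.- k)))))
    where
    lem : ∀ k l → l ≡ k ℤ.+ l ℤ.- k
    lem = ℤ-Solver.solve-∀

  private
    power : ∀ n → ∃ λ x → v x ≡ [ + n ]⁺
    power zero    = 1# , v-1
    power (suc n) with power n
    ... | x , e = ι π * x , ≡.trans (v-* (ι π) x) (cong₂ _+⁺_ v-π e)

  of-value : ∀ m → ∃ λ x → v x ≡ [ m ]⁺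
  of-value (+ n)      = power n
  of-value ℤ.-[1+ n ] with power (suc n)
  ... | x , e with invert e
  ...   | y , _ , ey = y , ey

  -- Kept opaque: only the valuation of `ϖ⟨ m ⟩` matters, and any other element of valuation `m`
  -- would serve equally well.
  abstract
    ϖ⟨_⟩ : ℤ → Carrier
    ϖ⟨ m ⟩ = proj₁ (of-value m)

    v-ϖ : ∀ m → v ϖ⟨ m ⟩ ≡ [ m ]⁺
    v-ϖ m = proj₂ (of-value m)

-- K[[u]] with F j = { Σ aᵢ uⁱ : α v(aᵢ) + β i ≥ j for all i }; ϖ is the
-- uniformizer and η = uᵅ / πᵝ up to a unit.
record SeriesRing {a} (D : CompleteDVR a) (α-1 : ℕ) (β : ℤ) : Set (lsuc a) where
  open Weights D α-1
  module K = CommutativeRing (CompleteDVR.K D)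
  v = CompleteDVR.v D
  field
    A : CommutativeRing a a
  open CommutativeRing A
  field
    F       : ℤ → Carrier → Set
    F-resp  : ∀ {j f g} → f ≈ g → F j f → F j g
    F-mono  : ∀ {j k f} → k ℤ.≤ j → F j f → F k f
    F-+     : ∀ {j f g} → F j f → F j g → F j (f + g)
    F-neg   : ∀ {j f} → F j f → F j (- f)
    F-*     : ∀ {j k f g} → F j f → F k g → F (j ℤ.+ k) (f * g)
    F-0     : ∀ {j} → F j 0#
    F-1     : F 0ℤ 1#
    F-⋂     : ∀ {f} j → (∀ n → F (j ℤ.+ + n) f) → f ≈ 0#

    mono      : ℕ → K.Carrier → Carrier
    mono-cong : ∀ {x y} i → x K.≈ y → mono i x ≈ mono i y
    mono-neg  : ∀ i x → mono i (K.- x) ≈ - mono i x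
    mono-*    : ∀ i k x y → mono i x * mono k y ≈ mono (i ℕ.+ k) (x K.* y)
    mono-F    : ∀ {j x} i → Wt (j ℤ.- β ℤ.* + i) x → F j (mono i x)

    coeff      : ℕ → Carrier → K.Carrier
    tail       : Carrier → Carrier
    head+tail  : ∀ f → f ≈ mono 0 (coeff 0 f) + mono 1 K.1# * tail f
    coeff-tail : ∀ i f → coeff i (tail f) ≡ coeff (suc i) f
    F⇒Wt       : ∀ {j f} i → F j f → Wt (j ℤ.- β ℤ.* + i) (coeff i f)
    Wt⇒F       : ∀ {j f} → (∀ i → Wt (j ℤ.- β ℤ.* + i) (coeff i f)) → F j f

    mono-1     : mono 0 K.1# ≈ 1#
    -- `F 0` is a local ring, with maximal ideal given by a constant term of positive valuation.
    local      : ∀ {f} → F 0ℤ f → (∃ λ e → F 0ℤ e × e * f ≈ 1#) ⊎ Wt 1ℤ (coeff 0 f)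
    -- `ϖ` and `η` lie in the Jacobson radical of `F 0`, in the form in which Nakayama's lemma
    -- consumes it.
    unit       : ∀ {f g} → F 0ℤ f → F 0ℤ g → ∃ λ e → F 0ℤ e ×
                 e * (1# + - (mono 0 ϖ⟨ 1ℤ ⟩ * f + mono (suc α-1) ϖ⟨ ℤ.- β ⟩ * g)) ≈ 1#

  ϖ η u : Carrier
  ϖ = mono 0 ϖ⟨ 1ℤ ⟩
  η = mono (suc α-1) ϖ⟨ ℤ.- β ⟩
  u = mono 1 K.1#

-- Spans over a subring, and Nakayama's lemma.

record IsSubsemiring {a} (A : CommutativeRing a a) (F : CommutativeRing.Carrier A → Set) : Set a where
  open CommutativeRing A
  field
    0∈ : F 0#
    1∈ : F 1#
    +∈ : ∀ {f g} → F f → F g → F (f + g)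
    *∈ : ∀ {f g} → F f → F g → F (f * g)

module Spans {a} {A : CommutativeRing a a} (V : LeftModule (CommutativeRing.ring A) a a)
             (F₀ : CommutativeRing.Carrier A → Set) where
  private module A = CommutativeRing A
  open LeftModule V

  -- Modules over the subring `F₀` are kept as predicates on an `A`-module, so that scalars outside
  -- `F₀` can still act on their elements.
  record IsSub (P : Pred Carrierᴹ a) : Set a where
    field
      resp : ∀ {x y} → x ≈ᴹ y → P x → P y
      0∈   : P 0ᴹ
      +∈   : ∀ {x y} → P x → P y → P (x +ᴹ y)
      *∈   : ∀ {c x} → F₀ c → P x → P (c *ₗ x)

  -- This is `P + F₀ x₁ + … + F₀ xₙ`, nested along the list so that dropping a generator means
  -- dropping one layer.
  _⟨_⟩ : Pred Carrierᴹ a → List Carrierᴹ → Pred Carrierᴹ a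
  P ⟨ [] ⟩     = P
  P ⟨ x ∷ xs ⟩ = λ z → ∃₂ λ c q → F₀ c × (P ⟨ xs ⟩) q × z ≈ᴹ c *ₗ x +ᴹ q

  Zero : Pred Carrierᴹ a
  Zero z = z ≈ᴹ 0ᴹ

module SpanProperties {a} {A : CommutativeRing a a} (V : LeftModule (CommutativeRing.ring A) a a)
             {F₀ : CommutativeRing.Carrier A → Set} (F₀-sub : IsSubsemiring A F₀) where
  private module A = CommutativeRing A
  open IsSubsemiring F₀-sub using () renaming (0∈ to F₀-0; 1∈ to F₀-1; +∈ to F₀-+; *∈ to F₀-*)
  open LeftModule V
  open Spans {A = A} V F₀
  open CommutativeSemigroupProperties
    (CommutativeMonoid.commutativeSemigroup +ᴹ-commutativeMonoid) using (interchange)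
  open SetoidReasoning ≈ᴹ-setoid

  Zero-isSub : IsSub Zero
  Zero-isSub = record
    { resp = λ x≈y x≈0 → ≈ᴹ-trans (≈ᴹ-sym x≈y) x≈0
    ; 0∈   = ≈ᴹ-refl
    ; +∈   = λ p q → ≈ᴹ-trans (+ᴹ-cong p q) (+ᴹ-identityˡ 0ᴹ)
    ; *∈   = λ _ p → ≈ᴹ-trans (*ₗ-cong A.refl p) (*ₗ-zeroʳ _)
    }

  span-isSub : ∀ {P} → IsSub P → ∀ xs → IsSub (P ⟨ xs ⟩)
  span-isSub P-sub []       = P-sub
  span-isSub P-sub (x ∷ xs) = record
    { resp = λ y≈z (c , q , Fc , q∈ , y≈) → c , q , Fc , q∈ , ≈ᴹ-trans (≈ᴹ-sym y≈z) y≈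
    ; 0∈   = A.0# , 0ᴹ , F₀-0 , 0∈ , ≈ᴹ-sym (≈ᴹ-trans (+ᴹ-identityʳ _) (*ₗ-zeroˡ x))
    ; +∈   = λ {y} {z} (c , q , Fc , q∈ , y≈) (d , r , Fd , r∈ , z≈) →
               c A.+ d , q +ᴹ r , F₀-+ Fc Fd , +∈ q∈ r∈ , (begin
                 y +ᴹ z                              ≈⟨ +ᴹ-cong y≈ z≈ ⟩
                 (c *ₗ x +ᴹ q) +ᴹ (d *ₗ x +ᴹ r)      ≈⟨ interchange _ _ _ _ ⟩
                 (c *ₗ x +ᴹ d *ₗ x) +ᴹ (q +ᴹ r)      ≈⟨ +ᴹ-congʳ (*ₗ-distribʳ x c d) ⟨
                 (c A.+ d) *ₗ x +ᴹ (q +ᴹ r)          ∎)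
    ; *∈   = λ {e} {y} Fe (c , q , Fc , q∈ , y≈) →
               e A.* c , e *ₗ q , F₀-* Fe Fc , *∈ Fe q∈ , (begin
                 e *ₗ y                     ≈⟨ *ₗ-cong A.refl y≈ ⟩
                 e *ₗ (c *ₗ x +ᴹ q)         ≈⟨ *ₗ-distribˡ e _ _ ⟩
                 e *ₗ (c *ₗ x) +ᴹ e *ₗ q    ≈⟨ +ᴹ-congʳ (*ₗ-assoc e c x) ⟨
                 (e A.* c) *ₗ x +ᴹ e *ₗ q   ∎)
    }
    where open IsSub (span-isSub P-sub xs)

  span-base : ∀ {P} → IsSub P → ∀ xs {z} → P z → (P ⟨ xs ⟩) z
  span-base P-sub []       p = p
  span-base P-sub (x ∷ xs) {z} p = A.0# , z , F₀-0 , span-base P-sub xs p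
    , ≈ᴹ-sym (≈ᴹ-trans (+ᴹ-congʳ (*ₗ-zeroˡ x)) (+ᴹ-identityˡ z))

  span-mono : ∀ {P Q} → (∀ {z} → P z → Q z) → ∀ xs {z} → (P ⟨ xs ⟩) z → (Q ⟨ xs ⟩) z
  span-mono P⊆Q []       p = P⊆Q p
  span-mono P⊆Q (x ∷ xs) (c , q , Fc , q∈ , z≈) = c , q , Fc , span-mono P⊆Q xs q∈ , z≈

  span-multiple : ∀ {P} → IsSub P → ∀ {xs z} → Any (λ x → ∃ λ c → F₀ c × z ≈ᴹ c *ₗ x) xs → (P ⟨ xs ⟩) z
  span-multiple P-sub {x ∷ xs} (here (c , Fc , z≈)) = c , 0ᴹ , Fc
    , IsSub.0∈ (span-isSub P-sub xs) , ≈ᴹ-trans z≈ (≈ᴹ-sym (+ᴹ-identityʳ _))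
  span-multiple P-sub {x ∷ xs} {z} (there m) = A.0# , z , F₀-0 , span-multiple P-sub m
    , ≈ᴹ-sym (≈ᴹ-trans (+ᴹ-congʳ (*ₗ-zeroˡ x)) (+ᴹ-identityˡ z))

  module _ {P G : Pred Carrierᴹ a} (P-sub : IsSub P) (G-sub : IsSub G) (s t : A.Carrier) (Fs : F₀ s) (Ft : F₀ t)
           (unit : ∀ {f g} → F₀ f → F₀ g → ∃ λ e → F₀ e × e A.* (A.1# A.+ A.- (s A.* f A.+ t A.* g)) A.≈ A.1#)
           (generates : ∀ {z} → P z → ∃₂ λ q x → ∃ λ y → G q × P x × P y × z ≈ᴹ q +ᴹ (s *ₗ x +ᴹ t *ₗ y)) where

    private
      -- Write `x = q₀ + s a + t b` and expand `a` and `b`, with coefficients `f` and `g` on `x`.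
      -- Then `(1 - (s f + t g)) x` lies in the span of the other generators, and the factor is
      -- invertible.
      remove : ∀ x xs → P x → (∀ {z} → P z → (G ⟨ x ∷ xs ⟩) z) → ∀ {z} → P z → (G ⟨ xs ⟩) z
      remove x xs x∈P P⊆ with generates x∈P
      ... | q₀ , a , b , q₀∈ , a∈ , b∈ , x≈ with P⊆ a∈ | P⊆ b∈
      ...   | f , q₁ , Ff , q₁∈ , a≈ | g , q₂ , Fg , q₂∈ , b≈ with unit Ff Fg
      ...     | e , Fe , e*≈1 = λ z∈P → conclude (P⊆ z∈P)
        where
        open IsSub (span-isSub G-sub xs)
        k = s A.* f A.+ t A.* g
        q = q₀ +ᴹ (s *ₗ q₁ +ᴹ t *ₗ q₂)
        q∈ : (G ⟨ xs ⟩) q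
        q∈ = +∈ (span-base G-sub xs q₀∈) (+∈ (*∈ Fs q₁∈) (*∈ Ft q₂∈))
        scale : ∀ {c f q y} → y ≈ᴹ f *ₗ x +ᴹ q → c *ₗ y ≈ᴹ (c A.* f) *ₗ x +ᴹ c *ₗ q
        scale {c} {f} {q} {y} y≈ = begin
          c *ₗ y                     ≈⟨ *ₗ-cong A.refl y≈ ⟩
          c *ₗ (f *ₗ x +ᴹ q)         ≈⟨ *ₗ-distribˡ c _ _ ⟩
          c *ₗ (f *ₗ x) +ᴹ c *ₗ q    ≈⟨ +ᴹ-congʳ (*ₗ-assoc c f x) ⟨
          (c A.* f) *ₗ x +ᴹ c *ₗ q   ∎
        x≈kx+q : x ≈ᴹ k *ₗ x +ᴹ q
        x≈kx+q = begin
          x                                       ≈⟨ x≈ ⟩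
          q₀ +ᴹ (s *ₗ a +ᴹ t *ₗ b)                ≈⟨ +ᴹ-congˡ (+ᴹ-cong (scale a≈) (scale b≈)) ⟩
          q₀ +ᴹ (((s A.* f) *ₗ x +ᴹ s *ₗ q₁) +ᴹ ((t A.* g) *ₗ x +ᴹ t *ₗ q₂))
                                                  ≈⟨ +ᴹ-congˡ (interchange _ _ _ _) ⟩
          q₀ +ᴹ (((s A.* f) *ₗ x +ᴹ (t A.* g) *ₗ x) +ᴹ (s *ₗ q₁ +ᴹ t *ₗ q₂))
                                                  ≈⟨ +ᴹ-congˡ (+ᴹ-congʳ (*ₗ-distribʳ x _ _)) ⟨
          q₀ +ᴹ (k *ₗ x +ᴹ (s *ₗ q₁ +ᴹ t *ₗ q₂))  ≈⟨ +ᴹ-assoc _ _ _ ⟨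
          (q₀ +ᴹ k *ₗ x) +ᴹ (s *ₗ q₁ +ᴹ t *ₗ q₂)  ≈⟨ +ᴹ-congʳ (+ᴹ-comm _ _) ⟩
          (k *ₗ x +ᴹ q₀) +ᴹ (s *ₗ q₁ +ᴹ t *ₗ q₂)  ≈⟨ +ᴹ-assoc _ _ _ ⟩
          k *ₗ x +ᴹ q                             ∎
        1-kx≈q : (A.1# A.+ A.- k) *ₗ x ≈ᴹ q
        1-kx≈q = begin
          (A.1# A.+ A.- k) *ₗ x              ≈⟨ *ₗ-distribʳ x _ _ ⟩
          A.1# *ₗ x +ᴹ (A.- k) *ₗ x          ≈⟨ +ᴹ-congʳ (≈ᴹ-trans (*ₗ-identityˡ x) x≈kx+q) ⟩
          (k *ₗ x +ᴹ q) +ᴹ (A.- k) *ₗ x      ≈⟨ +ᴹ-congʳ (+ᴹ-comm _ _) ⟩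
          (q +ᴹ k *ₗ x) +ᴹ (A.- k) *ₗ x      ≈⟨ +ᴹ-assoc _ _ _ ⟩
          q +ᴹ (k *ₗ x +ᴹ (A.- k) *ₗ x)      ≈⟨ +ᴹ-congˡ (*ₗ-distribʳ x _ _) ⟨
          q +ᴹ (k A.+ A.- k) *ₗ x            ≈⟨ +ᴹ-congˡ (≈ᴹ-trans (*ₗ-cong (A.-‿inverseʳ k) ≈ᴹ-refl) (*ₗ-zeroˡ x)) ⟩
          q +ᴹ 0ᴹ                            ≈⟨ +ᴹ-identityʳ q ⟩
          q                                  ∎
        x∈ : (G ⟨ xs ⟩) x
        x∈ = resp (begin
          e *ₗ q                             ≈⟨ *ₗ-cong A.refl 1-kx≈q ⟨
          e *ₗ ((A.1# A.+ A.- k) *ₗ x)       ≈⟨ *ₗ-assoc _ _ _ ⟨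
          (e A.* (A.1# A.+ A.- k)) *ₗ x      ≈⟨ *ₗ-cong e*≈1 ≈ᴹ-refl ⟩
          A.1# *ₗ x                          ≈⟨ *ₗ-identityˡ x ⟩
          x                                  ∎) (*∈ Fe q∈)
        conclude : ∀ {z} → (G ⟨ x ∷ xs ⟩) z → (G ⟨ xs ⟩) z
        conclude (c , r , Fc , r∈ , z≈) = resp (≈ᴹ-sym z≈) (+∈ (*∈ Fc x∈) r∈)

    nakayama : ∀ xs → All P xs → (∀ {z} → P z → (G ⟨ xs ⟩) z) → ∀ {z} → P z → G z
    nakayama []       _          P⊆ = P⊆
    nakayama (x ∷ xs) (x∈ ∷ xs∈) P⊆ = nakayama xs xs∈ (remove x xs x∈ P⊆)

halves : ∀ {k p q} → k ℕ.+ k ℕ.≤ p ℕ.+ q → k ℕ.≤ p ⊎ k ℕ.≤ q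
halves {k} {p} {q} 2k≤ with k ℕ.≤? p
... | yes k≤p = inj₁ k≤p
... | no  k≰p = inj₂ (ℕ.≮⇒≥ λ q<k → ℕ.<⇒≱ (ℕ.+-mono-< (ℕ.≰⇒> k≰p) q<k) 2k≤)

-- The graded pieces of a saturated module, and independence in them.

module Saturated {a} (em : ∀ {ℓ} → ExcludedMiddle ℓ) {D : CompleteDVR a} {α-1 : ℕ} {β : ℤ}
                 (S : SeriesRing D α-1 β) where
  open SeriesRing S hiding (A; u)
  open SeriesRing S using (u)
  open Weights D α-1
  A = SeriesRing.A S
  module A = CommutativeRing A

  private
    F≡ : ∀ {j k f} → j ≡ k → F j f → F k f
    F≡ refl w = w

  const : K.Carrier → A.Carrier
  const = mono 0

  const-F : ∀ {j x} → Wt j x → F j (const x)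
  const-F {j} w = mono-F 0 (Wt≡ (lem j β) w)
    where
    lem : ∀ j β → j ≡ j ℤ.- β ℤ.* 0ℤ
    lem = ℤ-Solver.solve-∀

  tail-F : ∀ {j f} → F j f → F (j ℤ.- β) (tail f)
  tail-F {j} {f} Ff = Wt⇒F λ i → subst (Wt _) (≡.sym (coeff-tail i f)) (Wt≡ (lem j β (+ i)) (F⇒Wt (suc i) Ff))
    where
    lem : ∀ j β i → j ℤ.- β ℤ.* (1ℤ ℤ.+ i) ≡ j ℤ.- β ℤ.- β ℤ.* i
    lem = ℤ-Solver.solve-∀

  head-Wt : ∀ {j f} → F j f → Wt j (coeff 0 f)
  head-Wt {j} Ff = Wt≡ (lem j β) (F⇒Wt 0 Ff)
    where
    lem : ∀ j β → j ℤ.- β ℤ.* 0ℤ ≡ j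
    lem = ℤ-Solver.solve-∀

  ϖ-F : F α ϖ
  ϖ-F = const-F (Wt≡ (ℤ.*-identityʳ α) (wt-exact (v-ϖ 1ℤ)))

  F₀-sub : IsSubsemiring A (F 0ℤ)
  F₀-sub = record { 0∈ = F-0 ; 1∈ = F-1 ; +∈ = F-+ ; *∈ = F-* }

  module Graded (V : LeftModule A.ring a a)
                {P : Pred (LeftModule.Carrierᴹ V) a} (P-sub : Spans.IsSub {A = A} V (F 0ℤ) P)
                (saturated : ∀ {z} → P (LeftModule._*ₗ_ V ϖ z) → P (LeftModule._*ₗ_ V η z) → P z) where
    open LeftModule V
    open Spans {A = A} V (F 0ℤ)
    open IsSub P-sub
    open MonoidSum +ᴹ-monoid using (sum; sum-cong-≋)
    open CommutativeSemigroupProperties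
      (CommutativeMonoid.commutativeSemigroup +ᴹ-commutativeMonoid) using (interchange)
    open SetoidReasoning ≈ᴹ-setoid

    -- A decreasing filtration with `X 0 = P` and `F i X j ⊂ X (i + j)`. A record rather than a
    -- function type, so that `j` and `z` can be inferred from a proof.
    record X (j : ℤ) (z : Carrierᴹ) : Set a where
      constructor ⟪_⟫
      field multiples : ∀ c → F (ℤ.- j) c → P (c *ₗ z)
    open X

    X≡ : ∀ {j k z} → j ≡ k → X j z → X k z
    X≡ refl w = w

    X-resp : ∀ {j x y} → x ≈ᴹ y → X j x → X j y
    X-resp x≈y ⟪ Xx ⟫ = ⟪ (λ c Fc → resp (*ₗ-cong A.refl x≈y) (Xx c Fc)) ⟫

    X-+ : ∀ {j x y} → X j x → X j y → X j (x +ᴹ y)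
    X-+ ⟪ Xx ⟫ ⟪ Xy ⟫ = ⟪ (λ c Fc → resp (≈ᴹ-sym (*ₗ-distribˡ c _ _)) (+∈ (Xx c Fc) (Xy c Fc))) ⟫

    X-0 : ∀ {j} → X j 0ᴹ
    X-0 = ⟪ (λ c _ → resp (≈ᴹ-sym (*ₗ-zeroʳ c)) 0∈) ⟫

    X-* : ∀ {i j f z} → F i f → X j z → X (i ℤ.+ j) (f *ₗ z)
    X-* {i} {j} {f} {z} Ff ⟪ Xz ⟫ = ⟪ (λ c Fc → resp (*ₗ-assoc c f z) (Xz (c A.* f) (F≡ (lem i j) (F-* Fc Ff)))) ⟫
      where
      lem : ∀ i j → ℤ.- (i ℤ.+ j) ℤ.+ i ≡ ℤ.- j
      lem = ℤ-Solver.solve-∀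

    X-neg : ∀ {j z} → X j z → X j ((A.- A.1#) *ₗ z)
    X-neg {j} Xz = X≡ (ℤ.+-identityˡ j) (X-* (F-neg F-1) Xz)

    P⇒X₀ : ∀ {z} → P z → X 0ℤ z
    P⇒X₀ z∈ = ⟪ (λ c Fc → *∈ Fc z∈) ⟫

    -- Let `c` have weight `- (j + 1)`. Since `ϖ` has weight `α ≥ 1`, the first hypothesis puts
    -- `ϖ c z` in `P`. Since `η = u q` with `q` of weight `- β`, the second puts
    -- `η c z = (q c) (u z)` in `P`. Saturation concludes.
    u-torsion-free : ∀ {j z} → X j z → X (j ℤ.+ 1ℤ ℤ.+ β) (u *ₗ z) → X (j ℤ.+ 1ℤ) z
    u-torsion-free {j} {z} ⟪ Xz ⟫ ⟪ Xuz ⟫ = ⟪ (λ c Fc → saturated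
      (resp (*ₗ-assoc ϖ c z) (Xz (ϖ A.* c) (F-mono ϖ-bound (F-* ϖ-F Fc))))
      (resp (η-split c) (Xuz (q A.* c) (F≡ (lem₂ j β) (F-* q-F Fc))))) ⟫
      where
      q = mono α-1 ϖ⟨ ℤ.- β ⟩
      ϖ-bound : ℤ.- j ℤ.≤ α ℤ.+ ℤ.- (j ℤ.+ 1ℤ)
      ϖ-bound = ℤ.0≤i-j⇒j≤i (subst (0ℤ ℤ.≤_) (lem j (+ α-1)) (ℤ.+≤+ ℕ.z≤n))
        where
        lem : ∀ j n → n ≡ 1ℤ ℤ.+ n ℤ.+ ℤ.- (j ℤ.+ 1ℤ) ℤ.- ℤ.- j
        lem = ℤ-Solver.solve-∀
      q-F : F (ℤ.- β) q
      q-F = mono-F α-1 (Wt≡ (lem (+ α-1) β) (wt-exact (v-ϖ (ℤ.- β))))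
        where
        lem : ∀ n β → (1ℤ ℤ.+ n) ℤ.* ℤ.- β ≡ ℤ.- β ℤ.- β ℤ.* n
        lem = ℤ-Solver.solve-∀
      lem₂ : ∀ j β → ℤ.- β ℤ.+ ℤ.- (j ℤ.+ 1ℤ) ≡ ℤ.- (j ℤ.+ 1ℤ ℤ.+ β)
      lem₂ = ℤ-Solver.solve-∀
      u*q≈η : u A.* q A.≈ η
      u*q≈η = A.trans (mono-* 1 α-1 K.1# ϖ⟨ ℤ.- β ⟩) (mono-cong (suc α-1) (K.*-identityˡ _))
      η-split : ∀ c → (q A.* c) *ₗ (u *ₗ z) ≈ᴹ η *ₗ (c *ₗ z)
      η-split c = begin
        (q A.* c) *ₗ (u *ₗ z)   ≈⟨ *ₗ-assoc _ _ _ ⟨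
        (q A.* c A.* u) *ₗ z    ≈⟨ *ₗ-cong (A.trans (A.*-comm _ u) (A.sym (A.*-assoc u q c))) ≈ᴹ-refl ⟩
        (u A.* q A.* c) *ₗ z    ≈⟨ *ₗ-cong (A.*-congʳ u*q≈η) ≈ᴹ-refl ⟩
        (η A.* c) *ₗ z          ≈⟨ *ₗ-assoc _ _ _ ⟩
        η *ₗ (c *ₗ z)           ∎

    -- The elements of X j vanishing in X / (F 1 + u) X.
    record Y (j : ℤ) (z : Carrierᴹ) : Set a where
      constructor ⟪_⟫ʸ
      field parts : ∃₂ λ x y → X (j ℤ.+ 1ℤ) x × X (j ℤ.- β) y × z ≈ᴹ x +ᴹ u *ₗ y

    Y≡ : ∀ {j k z} → j ≡ k → Y j z → Y k z
    Y≡ refl w = w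

    Y-resp : ∀ {j x y} → x ≈ᴹ y → Y j x → Y j y
    Y-resp x≈y ⟪ p , q , Xp , Xq , x≈ ⟫ʸ = ⟪ p , q , Xp , Xq , ≈ᴹ-trans (≈ᴹ-sym x≈y) x≈ ⟫ʸ

    X⇒Y : ∀ {j z} → X (j ℤ.+ 1ℤ) z → Y j z
    X⇒Y {j} {z} Xz = ⟪ z , 0ᴹ , Xz , X-0 , ≈ᴹ-sym (≈ᴹ-trans (+ᴹ-congˡ (*ₗ-zeroʳ u)) (+ᴹ-identityʳ z)) ⟫ʸ

    Y-+ : ∀ {j x y} → Y j x → Y j y → Y j (x +ᴹ y)
    Y-+ {x = x} {y} ⟪ p , q , Xp , Xq , x≈ ⟫ʸ ⟪ r , s , Xr , Xs , y≈ ⟫ʸ =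
      ⟪ p +ᴹ r , q +ᴹ s , X-+ Xp Xr , X-+ Xq Xs , (begin
        x +ᴹ y                                ≈⟨ +ᴹ-cong x≈ y≈ ⟩
        (p +ᴹ u *ₗ q) +ᴹ (r +ᴹ u *ₗ s)        ≈⟨ interchange _ _ _ _ ⟩
        (p +ᴹ r) +ᴹ (u *ₗ q +ᴹ u *ₗ s)        ≈⟨ +ᴹ-congˡ (*ₗ-distribˡ u q s) ⟨
        (p +ᴹ r) +ᴹ u *ₗ (q +ᴹ s)             ∎) ⟫ʸ

    Y-* : ∀ {i j f z} → F i f → Y j z → Y (i ℤ.+ j) (f *ₗ z)
    Y-* {i} {j} {f} {z} Ff ⟪ p , q , Xp , Xq , z≈ ⟫ʸ = ⟪ f *ₗ p , f *ₗ q
      , X≡ (≡.sym (ℤ.+-assoc i j 1ℤ)) (X-* Ff Xp) , X≡ (≡.sym (ℤ.+-assoc i j (ℤ.- β))) (X-* Ff Xq) , (begin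
        f *ₗ z                     ≈⟨ *ₗ-cong A.refl z≈ ⟩
        f *ₗ (p +ᴹ u *ₗ q)         ≈⟨ *ₗ-distribˡ f _ _ ⟩
        f *ₗ p +ᴹ f *ₗ (u *ₗ q)    ≈⟨ +ᴹ-congˡ (*ₗ-assoc f u q) ⟨
        f *ₗ p +ᴹ (f A.* u) *ₗ q   ≈⟨ +ᴹ-congˡ (*ₗ-cong (A.*-comm f u) ≈ᴹ-refl) ⟩
        f *ₗ p +ᴹ (u A.* f) *ₗ q   ≈⟨ +ᴹ-congˡ (*ₗ-assoc u f q) ⟩
        f *ₗ p +ᴹ u *ₗ (f *ₗ q)    ∎) ⟫ʸ

    -1*z+z≈0 : ∀ z → (A.- A.1#) *ₗ z +ᴹ z ≈ᴹ 0ᴹ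
    -1*z+z≈0 z = begin
      (A.- A.1#) *ₗ z +ᴹ z            ≈⟨ +ᴹ-congˡ (*ₗ-identityˡ z) ⟨
      (A.- A.1#) *ₗ z +ᴹ A.1# *ₗ z    ≈⟨ *ₗ-distribʳ z _ _ ⟨
      ((A.- A.1#) A.+ A.1#) *ₗ z      ≈⟨ *ₗ-cong (A.-‿inverseˡ A.1#) ≈ᴹ-refl ⟩
      A.0# *ₗ z                       ≈⟨ *ₗ-zeroˡ z ⟩
      0ᴹ                              ∎

    move : ∀ {x y z} → x ≈ᴹ y +ᴹ z → (A.- A.1#) *ₗ y +ᴹ x ≈ᴹ z
    move {x} {y} {z} x≈ = begin
      (A.- A.1#) *ₗ y +ᴹ x           ≈⟨ +ᴹ-congˡ x≈ ⟩
      (A.- A.1#) *ₗ y +ᴹ (y +ᴹ z)    ≈⟨ +ᴹ-assoc _ _ _ ⟨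
      ((A.- A.1#) *ₗ y +ᴹ y) +ᴹ z    ≈⟨ +ᴹ-congʳ (-1*z+z≈0 y) ⟩
      0ᴹ +ᴹ z                        ≈⟨ +ᴹ-identityˡ z ⟩
      z                              ∎

    lin : ∀ {r} → (Fin r → Carrierᴹ) → (Fin r → A.Carrier) → Carrierᴹ
    lin zs h = sum λ s → h s *ₗ zs s

    lin-cong : ∀ {r} (zs : Fin r → Carrierᴹ) {h h′} → (∀ s → h s A.≈ h′ s) → lin zs h ≈ᴹ lin zs h′
    lin-cong zs h≈ = sum-cong-≋ λ s → *ₗ-cong (h≈ s) ≈ᴹ-refl

    lin-+ : ∀ {r} (zs : Fin r → Carrierᴹ) h h′ → lin zs (λ s → h s A.+ h′ s) ≈ᴹ lin zs h +ᴹ lin zs h′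
    lin-+ {zero}  zs h h′ = ≈ᴹ-sym (+ᴹ-identityˡ 0ᴹ)
    lin-+ {suc r} zs h h′ = ≈ᴹ-trans
      (+ᴹ-cong (*ₗ-distribʳ _ _ _) (lin-+ (zs ∘ Fin.suc) (h ∘ Fin.suc) (h′ ∘ Fin.suc))) (interchange _ _ _ _)

    lin-* : ∀ {r} (zs : Fin r → Carrierᴹ) c h → lin zs (λ s → c A.* h s) ≈ᴹ c *ₗ lin zs h
    lin-* {zero}  zs c h = ≈ᴹ-sym (*ₗ-zeroʳ c)
    lin-* {suc r} zs c h = ≈ᴹ-trans
      (+ᴹ-cong (*ₗ-assoc _ _ _) (lin-* (zs ∘ Fin.suc) c (h ∘ Fin.suc))) (≈ᴹ-sym (*ₗ-distribˡ c _ _))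

    closed-lin : ∀ {p} {Q : Pred Carrierᴹ p} → Q 0ᴹ → (∀ {x y} → Q x → Q y → Q (x +ᴹ y)) →
                 ∀ {r} (zs : Fin r → Carrierᴹ) h → (∀ s → Q (h s *ₗ zs s)) → Q (lin zs h)
    closed-lin         Q0 Q+ {zero}  zs h Qs = Q0
    closed-lin {Q = Q} Q0 Q+ {suc r} zs h Qs = Q+ (Qs Fin.zero)
      (closed-lin {Q = Q} Q0 Q+ (zs ∘ Fin.suc) (h ∘ Fin.suc) (Qs ∘ Fin.suc))

    record Family (r : ℕ) : Set a where
      field
        js  : Fin r → ℤ
        zs  : Fin r → Carrierᴹ
        mem : ∀ s → X (js s) (zs s)

      Weighted : ℤ → (Fin r → K.Carrier) → Set
      Weighted j c = ∀ s → Wt (j ℤ.- js s) (c s)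

      FWeighted : ℤ → (Fin r → A.Carrier) → Set
      FWeighted j h = ∀ s → F (j ℤ.- js s) (h s)

      lin-X : ∀ {j h} → FWeighted j h → X j (lin zs h)
      lin-X {j} {h} Fh = closed-lin {Q = X j} X-0 X-+ zs h λ s → X≡ (lem j (js s)) (X-* (Fh s) (mem s))
        where
        lem : ∀ j k → j ℤ.- k ℤ.+ k ≡ j
        lem = ℤ-Solver.solve-∀

      lin-head+tail : ∀ h → lin zs h ≈ᴹ lin zs (const ∘ coeff 0 ∘ h) +ᴹ u *ₗ lin zs (tail ∘ h)
      lin-head+tail h = begin
        lin zs h     ≈⟨ lin-cong zs (λ s → head+tail (h s)) ⟩
        lin zs (λ s → const (coeff 0 (h s)) A.+ u A.* tail (h s))
                     ≈⟨ lin-+ zs (const ∘ coeff 0 ∘ h) (λ s → u A.* tail (h s)) ⟩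
        lin zs (const ∘ coeff 0 ∘ h) +ᴹ lin zs (λ s → u A.* tail (h s))
                     ≈⟨ +ᴹ-congˡ (lin-* zs u (tail ∘ h)) ⟩
        lin zs (const ∘ coeff 0 ∘ h) +ᴹ u *ₗ lin zs (tail ∘ h) ∎

      -- Homogeneous independence modulo `Y`: the conclusion says that each coefficient, of degree
      -- `j - js s`, has vanishing leading term.
      Independent : Set a
      Independent = ∀ j c → Weighted j c → Y j (lin zs (const ∘ c)) → Weighted (j ℤ.+ 1ℤ) c

      Spanning : Set a
      Spanning = ∀ j x → X j x → ∃₂ λ c y → Weighted j c × Y j y × x ≈ᴹ lin zs (const ∘ c) +ᴹ y

      -- Induction on the coefficient. The constant terms form a relation modulo `Y`, so they gain
      -- weight and can be subtracted. What is left is `u T` in `X (j + 1)`, and `u-torsion-free`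
      -- allows the division by `u` that exposes the next coefficients.
      leading : Independent → ∀ i j h → FWeighted j h → X (j ℤ.+ 1ℤ) (lin zs h) →
                ∀ s → Wt (j ℤ.+ 1ℤ ℤ.- js s ℤ.- β ℤ.* + i) (coeff i (h s))
      leading ind i j h Fh Xh = go i
        where
        tails-F : FWeighted (j ℤ.- β) (tail ∘ h)
        tails-F s = F≡ (lem j (js s) β) (tail-F (Fh s))
          where
          lem : ∀ j k β → j ℤ.- k ℤ.- β ≡ j ℤ.- β ℤ.- k
          lem = ℤ-Solver.solve-∀
        T = lin zs (tail ∘ h)
        H = lin zs (const ∘ coeff 0 ∘ h)
        X-T : X (j ℤ.- β) T
        X-T = lin-X tails-F
        Y-H : Y j H
        Y-H = ⟪ lin zs h , (A.- A.1#) *ₗ T , Xh , X-neg X-T , (begin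
          H                                        ≈⟨ move (≈ᴹ-trans (lin-head+tail h) (+ᴹ-comm _ _)) ⟨
          (A.- A.1#) *ₗ (u *ₗ T) +ᴹ lin zs h       ≈⟨ +ᴹ-comm _ _ ⟩
          lin zs h +ᴹ (A.- A.1#) *ₗ (u *ₗ T)       ≈⟨ +ᴹ-congˡ (*ₗ-assoc _ _ _) ⟨
          lin zs h +ᴹ ((A.- A.1#) A.* u) *ₗ T      ≈⟨ +ᴹ-congˡ (*ₗ-cong (A.*-comm _ u) ≈ᴹ-refl) ⟩
          lin zs h +ᴹ (u A.* (A.- A.1#)) *ₗ T      ≈⟨ +ᴹ-congˡ (*ₗ-assoc _ _ _) ⟩
          lin zs h +ᴹ u *ₗ ((A.- A.1#) *ₗ T)       ∎) ⟫ʸ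
        heads : Weighted (j ℤ.+ 1ℤ) (coeff 0 ∘ h)
        heads = ind j (coeff 0 ∘ h) (λ s → head-Wt (Fh s)) Y-H
        X-T′ : X (j ℤ.- β ℤ.+ 1ℤ) T
        X-T′ = u-torsion-free X-T (X≡ (lem j β) (X-resp (move (lin-head+tail h))
                 (X-+ (X-neg (lin-X λ s → const-F (heads s))) Xh)))
          where
          lem : ∀ j β → j ℤ.+ 1ℤ ≡ j ℤ.- β ℤ.+ 1ℤ ℤ.+ β
          lem = ℤ-Solver.solve-∀
        go : ∀ i s → Wt (j ℤ.+ 1ℤ ℤ.- js s ℤ.- β ℤ.* + i) (coeff i (h s))
        go zero s = Wt≡ (lem j (js s) β) (heads s)
          where
          lem : ∀ j k β → j ℤ.+ 1ℤ ℤ.- k ≡ j ℤ.+ 1ℤ ℤ.- k ℤ.- β ℤ.* 0ℤ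
          lem = ℤ-Solver.solve-∀
        go (suc i) s = subst (Wt _) (coeff-tail i (h s)) (Wt≡ (lem j (js s) β (+ i))
                         (leading ind i (j ℤ.- β) (tail ∘ h) tails-F X-T′ s))
          where
          lem : ∀ j k β i → j ℤ.- β ℤ.+ 1ℤ ℤ.- k ℤ.- β ℤ.* i ≡ j ℤ.+ 1ℤ ℤ.- k ℤ.- β ℤ.* (1ℤ ℤ.+ i)
          lem = ℤ-Solver.solve-∀

      -- The zero vector lies in every `X j`, so `leading` can be iterated; each round raises the
      -- weight of all coefficients by one, and only 0 has arbitrarily high weight.
      relation-trivial : Independent → ∀ j h → FWeighted j h → lin zs h ≈ᴹ 0ᴹ → ∀ s → h s A.≈ A.0#
      relation-trivial ind j h Fh h≈0 s = F-⋂ (j ℤ.- js s) λ n → F≡ (lem₁ j (+ n) (js s)) (improve n s)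
        where
        lem₁ : ∀ j n k → j ℤ.+ n ℤ.- k ≡ j ℤ.- k ℤ.+ n
        lem₁ = ℤ-Solver.solve-∀
        improve : ∀ n → FWeighted (j ℤ.+ + n) h
        improve zero    s = F≡ (cong (ℤ._- js s) (≡.sym (ℤ.+-identityʳ j))) (Fh s)
        improve (suc n) s = Wt⇒F λ i → Wt≡ (lem j (+ n) (js s) β (+ i))
          (leading ind i (j ℤ.+ + n) h (improve n) (X-resp (≈ᴹ-sym h≈0) X-0) s)
          where
          lem : ∀ j n k β i → j ℤ.+ n ℤ.+ 1ℤ ℤ.- k ℤ.- β ℤ.* i ≡ j ℤ.+ (1ℤ ℤ.+ n) ℤ.- k ℤ.- β ℤ.* i
          lem = ℤ-Solver.solve-∀

    open Family

    cons : ∀ {r} → Family r → ∀ {j x} → X j x → Family (suc r)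
    cons fam {j} {x} Xx = record
      { js  = j ◂ js fam
      ; zs  = x ◂ zs fam
      ; mem = λ where
          Fin.zero    → Xx
          (Fin.suc s) → mem fam s
      }

    Spanned : ∀ {r} → Family r → ℤ → Carrierᴹ → Set a
    Spanned fam j x = ∃₂ λ c y → Weighted fam j c × Y j y × x ≈ᴹ lin (zs fam) (const ∘ c) +ᴹ y

    -- If the coefficient of `x` does not gain weight, its weight is exactly `j′ - j`, and its
    -- inverse in `K` has the opposite weight. Dividing the relation by it expresses `x` through the
    -- family modulo `Y`.
    cons-independent : ∀ {r} (fam : Family r) → Independent fam → ∀ {j x} (Xx : X j x) →
                       ¬ Spanned fam j x → Independent (cons fam Xx)
    cons-independent fam ind {j} {x} Xx ¬span j′ c Wc Yc with em {P = Wt (j′ ℤ.+ 1ℤ ℤ.- j) (c Fin.zero)}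
    ... | yes W₀ = λ where
            Fin.zero    → W₀
            (Fin.suc s) → rest s
      where
      c₀x∈X : X (j′ ℤ.+ 1ℤ) (const (c Fin.zero) *ₗ x)
      c₀x∈X = X≡ (lem (j′ ℤ.+ 1ℤ) j) (X-* (const-F W₀) Xx)
        where
        lem : ∀ j k → j ℤ.- k ℤ.+ k ≡ j
        lem = ℤ-Solver.solve-∀
      rest = ind j′ (c ∘ Fin.suc) (Wc ∘ Fin.suc) (Y-resp (move ≈ᴹ-refl) (Y-+ (X⇒Y (X-neg c₀x∈X)) Yc))
    ... | no ¬W₀ = contradiction spanned ¬span
      where
      c₀ = c Fin.zero
      c₀≉0 : ¬ (c₀ K.≈ K.0#)
      c₀≉0 c₀≈0 = ¬W₀ (wt-resp (K.sym c₀≈0) wt-0)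
      m = proj₁ (v-finite c₀≉0)
      vc₀ = proj₂ (v-finite c₀≉0)
      αm≡ : α ℤ.* m ≡ j′ ℤ.- j
      αm≡ = ℤ.≤-antisym
        (ℤ.≮⇒≥ λ p → ¬W₀ (wt-mono (subst (ℤ._≤ α ℤ.* m) (lem j′ j) (ℤ.i<j⇒suc[i]≤j p)) (wt-exact vc₀)))
        (Wc Fin.zero m vc₀)
        where
        lem : ∀ j k → 1ℤ ℤ.+ (j ℤ.- k) ≡ j ℤ.+ 1ℤ ℤ.- k
        lem = ℤ-Solver.solve-∀
      e = proj₁ (invert vc₀)
      c₀e≈1 = proj₁ (proj₂ (invert vc₀))
      e-Wt : Wt (j ℤ.- j′) e
      e-Wt = Wt≡ (≡.trans (lem₁ α m) (≡.trans (cong ℤ.-_ αm≡) (lem₂ j′ j))) (wt-exact (proj₂ (proj₂ (invert vc₀))))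
        where
        lem₁ : ∀ α m → α ℤ.* ℤ.- m ≡ ℤ.- (α ℤ.* m)
        lem₁ = ℤ-Solver.solve-∀
        lem₂ : ∀ j k → ℤ.- (j ℤ.- k) ≡ k ℤ.- j
        lem₂ = ℤ-Solver.solve-∀
      L = lin (zs fam) (const ∘ c ∘ Fin.suc)
      E = const e *ₗ L
      d : Fin _ → K.Carrier
      d s = K.- (e K.* c (Fin.suc s))
      lin-d : lin (zs fam) (const ∘ d) ≈ᴹ (A.- A.1#) *ₗ E
      lin-d = begin
        lin (zs fam) (const ∘ d)  ≈⟨ lin-cong (zs fam) (λ s → begin-A s) ⟩
        lin (zs fam) (λ s → (A.- A.1#) A.* (const e A.* const (c (Fin.suc s))))
                                  ≈⟨ lin-* (zs fam) _ _ ⟩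
        (A.- A.1#) *ₗ lin (zs fam) (λ s → const e A.* const (c (Fin.suc s)))
                                  ≈⟨ *ₗ-cong A.refl (lin-* (zs fam) _ _) ⟩
        (A.- A.1#) *ₗ E           ∎
        where
        begin-A : ∀ s → const (d s) A.≈ (A.- A.1#) A.* (const e A.* const (c (Fin.suc s)))
        begin-A s = A.trans (mono-neg 0 _) (A.trans (A.-‿cong (A.sym (mono-* 0 0 e (c (Fin.suc s)))))
                      (A.sym (RingProperties.-1*x≈-x A.ring _)))
      y = const e *ₗ (const c₀ *ₗ x +ᴹ L)
      y≈ : y ≈ᴹ E +ᴹ x
      y≈ = begin
        const e *ₗ (const c₀ *ₗ x +ᴹ L)    ≈⟨ *ₗ-distribˡ _ _ _ ⟩
        const e *ₗ (const c₀ *ₗ x) +ᴹ E    ≈⟨ +ᴹ-congʳ (*ₗ-assoc _ _ _) ⟨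
        (const e A.* const c₀) *ₗ x +ᴹ E   ≈⟨ +ᴹ-congʳ (*ₗ-cong (A.trans (mono-* 0 0 e c₀)
                                                (A.trans (mono-cong 0 (K.trans (K.*-comm e c₀) c₀e≈1)) mono-1)) ≈ᴹ-refl) ⟩
        A.1# *ₗ x +ᴹ E                     ≈⟨ +ᴹ-congʳ (*ₗ-identityˡ x) ⟩
        x +ᴹ E                             ≈⟨ +ᴹ-comm x E ⟩
        E +ᴹ x                             ∎
      spanned : Spanned fam j x
      spanned = d , y
        , (λ s → wt-neg (Wt≡ (lem₁ j j′ (js fam s)) (wt-* e-Wt (Wc (Fin.suc s)))))
        , Y≡ (lem₂ j j′) (Y-* (const-F e-Wt) Yc)
        , ≈ᴹ-sym (≈ᴹ-trans (+ᴹ-congʳ lin-d) (move y≈))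
        where
        lem₁ : ∀ j k l → j ℤ.- k ℤ.+ (k ℤ.- l) ≡ j ℤ.- l
        lem₁ = ℤ-Solver.solve-∀
        lem₂ : ∀ j k → j ℤ.- k ℤ.+ k ≡ j
        lem₂ = ℤ-Solver.solve-∀

    lower-bound : ∀ {r} (f : Fin r → ℤ) → ∃ λ j → ∀ s → j ℤ.≤ f s
    lower-bound {zero}  f = 0ℤ , λ ()
    lower-bound {suc r} f with lower-bound (f ∘ Fin.suc)
    ... | j , j≤ = f Fin.zero ℤ.⊓ j , λ where
            Fin.zero    → ℤ.i⊓j≤i _ _
            (Fin.suc s) → ℤ.≤-trans (ℤ.i⊓j≤j (f Fin.zero) j) (j≤ s)

    module _ (d : ℕ)
             (dependent : ∀ (zs : Fin (suc d) → Carrierᴹ) → (∀ s → ∃ λ j → X j (zs s)) →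
               ∃₂ λ c e → (∀ s → F e (c s)) × ¬ (∀ s → c s A.≈ A.0#) × lin zs c ≈ᴹ 0ᴹ) where

      ¬independent : (fam : Family (suc d)) → ¬ Independent fam
      ¬independent fam ind with dependent (zs fam) (λ s → js fam s , mem fam s)
      ... | c , e , Fc , c≉0 , rel with lower-bound (js fam)
      -- The coefficients share the weight `e` but the members have different degrees; with `k`
      -- below all of these, the single total degree `e + k` is admissible.
      ...   | k , k≤ = c≉0 (relation-trivial fam ind (e ℤ.+ k) c (λ s → F-mono (bound s) (Fc s)) rel)
        where
        bound : ∀ s → e ℤ.+ k ℤ.- js fam s ℤ.≤ e
        bound s = ℤ.0≤i-j⇒j≤i (subst (0ℤ ℤ.≤_) (lem e k (js fam s)) (ℤ.i≤j⇒0≤j-i (k≤ s)))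
          where
          lem : ∀ e k j → j ℤ.- k ≡ e ℤ.- (e ℤ.+ k ℤ.- j)
          lem = ℤ-Solver.solve-∀

      -- Greedy choice: adjoin any element not yet spanned, as long as there is one. The counter `k`
      -- is `d + 1 - r`, and at 0 the family would be independent with `d + 1` members.
      spanning-family : ∃₂ λ r (fam : Family r) → r ℕ.≤ d × Spanning fam
      spanning-family = go (suc d) 0 refl empty (λ _ _ _ _ ())
        where
        empty : Family 0
        empty = record { js = λ () ; zs = λ () ; mem = λ () }
        go : ∀ k r → r ℕ.+ k ≡ suc d → (fam : Family r) → Independent fam →
             ∃₂ λ r (fam : Family r) → r ℕ.≤ d × Spanning fam
        go zero r eq fam ind with refl ← ≡.trans (≡.sym (ℕ.+-identityʳ r)) eq = contradiction ind (¬independent fam)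
        go (suc k) r eq fam ind with em {P = ∃₂ λ j x → X j x × ¬ Spanned fam j x}
        ... | yes (j , x , Xx , ¬span) =
                go k (suc r) (≡.trans (≡.sym (ℕ.+-suc r k)) eq) (cons fam Xx) (cons-independent fam ind Xx ¬span)
        ... | no none = r , fam , ℕ.m+n≤o⇒m≤o r (ℕ.≤-reflexive (ℕ.suc-injective (≡.trans (≡.sym (ℕ.+-suc r k)) eq))) , span
          where
          span : Spanning fam
          span j x Xx with em {P = Spanned fam j x}
          ... | yes s = s
          ... | no ¬s = contradiction (j , x , Xx , ¬s) none

-- Generators of a saturated module from a spanning family.

module Generation {a} (em : ∀ {ℓ} → ExcludedMiddle ℓ) {D : CompleteDVR a} {α-1 : ℕ} {β : ℤ}
                  (S : SeriesRing D α-1 β) where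
  open SeriesRing S hiding (A)
  open Weights D α-1
  open Saturated em S

  module _ (V : LeftModule A.ring a a)
           {P : Pred (LeftModule.Carrierᴹ V) a} (P-sub : Spans.IsSub {A = A} V (F 0ℤ) P)
           (saturated : ∀ {z} → P (LeftModule._*ₗ_ V ϖ z) → P (LeftModule._*ₗ_ V η z) → P z) where
    open LeftModule V
    open Spans {A = A} V (F 0ℤ)
    open IsSub P-sub
    open Graded V P-sub saturated
    open Family
    open CommutativeSemigroupProperties
      (CommutativeMonoid.commutativeSemigroup +ᴹ-commutativeMonoid) using (interchange)
    open SetoidReasoning ≈ᴹ-setoid

    module _ {r} (fam : Family r) (spanning : Spanning fam) {G : Pred Carrierᴹ a} (G-sub : IsSub G)
             (monomials : ∀ i c s → Wt (ℤ.- js fam s ℤ.- β ℤ.* + i) c → G (mono i c *ₗ zs fam s)) where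

      Generated : Pred Carrierᴹ a
      Generated z = ∃₂ λ q x → ∃ λ y → G q × P x × P y × z ≈ᴹ q +ᴹ (ϖ *ₗ x +ᴹ η *ₗ y)

      private
        module G = IsSub G-sub

        Generated-+ : ∀ {z z′} → Generated z → Generated z′ → Generated (z +ᴹ z′)
        Generated-+ {z} {z′} (q , x , y , q∈ , x∈ , y∈ , z≈) (q′ , x′ , y′ , q′∈ , x′∈ , y′∈ , z′≈) =
          q +ᴹ q′ , x +ᴹ x′ , y +ᴹ y′ , G.+∈ q∈ q′∈ , +∈ x∈ x′∈ , +∈ y∈ y′∈ , (begin
            z +ᴹ z′
              ≈⟨ +ᴹ-cong z≈ z′≈ ⟩
            (q +ᴹ (ϖ *ₗ x +ᴹ η *ₗ y)) +ᴹ (q′ +ᴹ (ϖ *ₗ x′ +ᴹ η *ₗ y′))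
              ≈⟨ interchange _ _ _ _ ⟩
            (q +ᴹ q′) +ᴹ ((ϖ *ₗ x +ᴹ η *ₗ y) +ᴹ (ϖ *ₗ x′ +ᴹ η *ₗ y′))
              ≈⟨ +ᴹ-congˡ (interchange _ _ _ _) ⟩
            (q +ᴹ q′) +ᴹ ((ϖ *ₗ x +ᴹ ϖ *ₗ x′) +ᴹ (η *ₗ y +ᴹ η *ₗ y′))
              ≈⟨ +ᴹ-congˡ (+ᴹ-cong (*ₗ-distribˡ ϖ x x′) (*ₗ-distribˡ η y y′)) ⟨
            (q +ᴹ q′) +ᴹ (ϖ *ₗ (x +ᴹ x′) +ᴹ η *ₗ (y +ᴹ y′)) ∎)

        Generated-resp : ∀ {z z′} → z ≈ᴹ z′ → Generated z → Generated z′
        Generated-resp z≈z′ (q , x , y , q∈ , x∈ , y∈ , z≈) =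
          q , x , y , q∈ , x∈ , y∈ , ≈ᴹ-trans (≈ᴹ-sym z≈z′) z≈

        G⇒Generated : ∀ {z} → G z → Generated z
        G⇒Generated {z} z∈ = z , 0ᴹ , 0ᴹ , z∈ , 0∈ , 0∈ , ≈ᴹ-sym (begin
          z +ᴹ (ϖ *ₗ 0ᴹ +ᴹ η *ₗ 0ᴹ)   ≈⟨ +ᴹ-congˡ (+ᴹ-cong (*ₗ-zeroʳ ϖ) (*ₗ-zeroʳ η)) ⟩
          z +ᴹ (0ᴹ +ᴹ 0ᴹ)             ≈⟨ +ᴹ-congˡ (+ᴹ-identityˡ 0ᴹ) ⟩
          z +ᴹ 0ᴹ                     ≈⟨ +ᴹ-identityʳ z ⟩
          z                           ∎)

        ϖ⇒Generated : ∀ {z} → P z → Generated (ϖ *ₗ z)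
        ϖ⇒Generated {z} z∈ = 0ᴹ , z , 0ᴹ , G.0∈ , z∈ , 0∈ , ≈ᴹ-sym (begin
          0ᴹ +ᴹ (ϖ *ₗ z +ᴹ η *ₗ 0ᴹ)   ≈⟨ +ᴹ-identityˡ _ ⟩
          ϖ *ₗ z +ᴹ η *ₗ 0ᴹ           ≈⟨ +ᴹ-congˡ (*ₗ-zeroʳ η) ⟩
          ϖ *ₗ z +ᴹ 0ᴹ                ≈⟨ +ᴹ-identityʳ _ ⟩
          ϖ *ₗ z                      ∎)

        η⇒Generated : ∀ {z} → P z → Generated (η *ₗ z)
        η⇒Generated {z} z∈ = 0ᴹ , 0ᴹ , z , G.0∈ , 0∈ , z∈ , ≈ᴹ-sym (begin
          0ᴹ +ᴹ (ϖ *ₗ 0ᴹ +ᴹ η *ₗ z)   ≈⟨ +ᴹ-identityˡ _ ⟩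
          ϖ *ₗ 0ᴹ +ᴹ η *ₗ z           ≈⟨ +ᴹ-congʳ (*ₗ-zeroʳ ϖ) ⟩
          0ᴹ +ᴹ η *ₗ z                ≈⟨ +ᴹ-identityˡ _ ⟩
          η *ₗ z                      ∎)

        split : ∀ i k x y z → mono (i ℕ.+ k) (x K.* y) *ₗ z ≈ᴹ mono i x *ₗ (mono k y *ₗ z)
        split i k x y z = ≈ᴹ-trans (*ₗ-cong (A.sym (mono-* i k x y)) ≈ᴹ-refl) (*ₗ-assoc _ _ _)

        ϖ-inverse : ∀ m → ∃ λ y → ϖ⟨ m ⟩ K.* y K.≈ K.1# × Wt (α ℤ.* ℤ.- m) y
        ϖ-inverse m = let (y , xy≈1 , vy) = invert (v-ϖ m) in y , xy≈1 , wt-exact vy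

        -- The factor `ϖ` can be split off: `ϖ⁻¹ uᵠ` has weight `β q - α`, and `p ≥ α` ensures that
        -- it still sends `x` into `P`.
        deep-ϖ : ∀ {p q x} → suc α-1 ℕ.≤ p → X (+ p ℤ.- β ℤ.* + q) x → Generated (mono q K.1# *ₗ x)
        deep-ϖ {p} {q} {x} α≤p ⟪ Xx ⟫ = let (e , ϖe≈1 , We) = ϖ-inverse 1ℤ in Generated-resp
          (≈ᴹ-trans (≈ᴹ-sym (split 0 q ϖ⟨ 1ℤ ⟩ e x)) (*ₗ-cong (mono-cong q ϖe≈1) ≈ᴹ-refl))
          (ϖ⇒Generated (Xx (mono q e) (mono-F q (wt-mono bound We))))
          where
          bound : ℤ.- (+ p ℤ.- β ℤ.* + q) ℤ.- β ℤ.* + q ℤ.≤ α ℤ.* ℤ.- 1ℤ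
          bound = ℤ.0≤i-j⇒j≤i (subst (0ℤ ℤ.≤_) (lem α β (+ p) (+ q)) (ℤ.i≤j⇒0≤j-i (ℤ.+≤+ α≤p)))
            where
            lem : ∀ α β p q → p ℤ.- α ≡ α ℤ.* ℤ.- 1ℤ ℤ.- (ℤ.- (p ℤ.- β ℤ.* q) ℤ.- β ℤ.* q)
            lem = ℤ-Solver.solve-∀

        -- Here `u` occurs at least `α` times, so `η` can be split off; as `η` has weight 0, no
        -- condition on `p` arises.
        deep-η : ∀ {p k x} → X (+ p ℤ.- β ℤ.* + (suc α-1 ℕ.+ k)) x → Generated (mono (suc α-1 ℕ.+ k) K.1# *ₗ x)
        deep-η {p} {k} {x} ⟪ Xx ⟫ = let (e , ηe≈1 , We) = ϖ-inverse (ℤ.- β) in Generated-resp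
          (≈ᴹ-trans (≈ᴹ-sym (split (suc α-1) k ϖ⟨ ℤ.- β ⟩ e x)) (*ₗ-cong (mono-cong (suc α-1 ℕ.+ k) ηe≈1) ≈ᴹ-refl))
          (η⇒Generated (Xx (mono k e) (mono-F k (wt-mono bound We))))
          where
          bound : ℤ.- (+ p ℤ.- β ℤ.* (+ (suc α-1 ℕ.+ k))) ℤ.- β ℤ.* + k ℤ.≤ α ℤ.* ℤ.- (ℤ.- β)
          bound = ℤ.0≤i-j⇒j≤i (subst (0ℤ ℤ.≤_) (≡.trans (lem α β (+ p) (+ k))
                    (cong (λ q → α ℤ.* ℤ.- (ℤ.- β) ℤ.- (ℤ.- (+ p ℤ.- β ℤ.* q) ℤ.- β ℤ.* + k)) (≡.sym (ℤ.pos-+ (suc α-1) k))))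
                    (ℤ.+≤+ {0} {p} ℕ.z≤n))
            where
            lem : ∀ α β p k → p ≡ α ℤ.* ℤ.- (ℤ.- β) ℤ.- (ℤ.- (p ℤ.- β ℤ.* (α ℤ.+ k)) ℤ.- β ℤ.* k)
            lem = ℤ-Solver.solve-∀

        -- Expanding `x` modulo `Y` leaves two remainders, one with `p` raised and one with `q`
        -- raised. Once `p + q` reaches `2 α`, one of them is at least `α`, and the remainder is a
        -- multiple of `ϖ` or of `η`. Hence no convergence argument is involved.
        approximate : ∀ N p q → suc α-1 ℕ.+ suc α-1 ℕ.≤ p ℕ.+ q ℕ.+ N →
                      ∀ {x} → X (+ p ℤ.- β ℤ.* + q) x → Generated (mono q K.1# *ₗ x)
        approximate zero p q 2α≤ Xx =
          [ (λ α≤p → deep-ϖ {p} α≤p Xx)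
          , (λ α≤q → subst (λ q → X (+ p ℤ.- β ℤ.* + q) _ → Generated (mono q K.1# *ₗ _))
              (ℕ.m+[n∸m]≡n α≤q) (deep-η {p}) Xx)
          ]′ (halves {suc α-1} {p} {q} (ℕ.≤-trans 2α≤ (ℕ.≤-reflexive (ℕ.+-identityʳ (p ℕ.+ q)))))
        approximate (suc N) p q 2α≤ {x} Xx = go (spanning (+ p ℤ.- β ℤ.* + q) x Xx)
          where
          go : Spanned fam (+ p ℤ.- β ℤ.* + q) x → Generated (mono q K.1# *ₗ x)
          go (c , y , Wc , ⟪ y₁ , y₂ , Xy₁ , Xy₂ , y≈ ⟫ʸ , x≈) = Generated-resp (≈ᴹ-sym expand)
            (Generated-+ (G⇒Generated lin∈G) (Generated-+
              (approximate N (suc p) q (ℕ.≤-trans 2α≤ (ℕ.≤-reflexive (ℕ.+-suc (p ℕ.+ q) N))) (X≡ (lem₁ (+ p) β (+ q)) Xy₁))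
              (approximate N p (suc q) (ℕ.≤-trans 2α≤ (ℕ.≤-reflexive (≡.trans (ℕ.+-suc (p ℕ.+ q) N) (cong (ℕ._+ N) (≡.sym (ℕ.+-suc p q))))))
                (X≡ (lem₂ (+ p) β (+ q)) Xy₂))))
            where
            lem₁ : ∀ p β q → p ℤ.- β ℤ.* q ℤ.+ 1ℤ ≡ 1ℤ ℤ.+ p ℤ.- β ℤ.* q
            lem₁ = ℤ-Solver.solve-∀
            lem₂ : ∀ p β q → p ℤ.- β ℤ.* q ℤ.- β ≡ p ℤ.- β ℤ.* (1ℤ ℤ.+ q)
            lem₂ = ℤ-Solver.solve-∀
            U = mono q K.1#
            C = lin (zs fam) (const ∘ c)
            lin∈G : G (U *ₗ C)
            lin∈G = G.resp (lin-* (zs fam) U (const ∘ c)) (closed-lin {Q = G} G.0∈ G.+∈ (zs fam) _ λ s →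
              G.resp (*ₗ-cong (A.sym (A.trans (mono-* q 0 K.1# (c s))
                (A.reflexive (cong (λ n → mono n (K.1# K.* c s)) (ℕ.+-identityʳ q))))) ≈ᴹ-refl)
                (monomials q (K.1# K.* c s) s (wt-mono (bound s) (wt-resp (K.sym (K.*-identityˡ (c s))) (Wc s)))))
              where
              bound : ∀ s → ℤ.- js fam s ℤ.- β ℤ.* + q ℤ.≤ + p ℤ.- β ℤ.* + q ℤ.- js fam s
              bound s = ℤ.0≤i-j⇒j≤i (subst (0ℤ ℤ.≤_) (lem (+ p) β (+ q) (js fam s)) (ℤ.+≤+ {0} {p} ℕ.z≤n))
                where
                lem : ∀ p β q j → p ≡ p ℤ.- β ℤ.* q ℤ.- j ℤ.- (ℤ.- j ℤ.- β ℤ.* q)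
                lem = ℤ-Solver.solve-∀
            U*u≈ : U A.* u A.≈ mono (suc q) K.1#
            U*u≈ = A.trans (mono-* q 1 K.1# K.1#) (A.trans (mono-cong (q ℕ.+ 1) (K.*-identityˡ K.1#))
                     (A.reflexive (cong (λ n → mono n K.1#) (ℕ.+-comm q 1))))
            expand : U *ₗ x ≈ᴹ U *ₗ C +ᴹ (U *ₗ y₁ +ᴹ mono (suc q) K.1# *ₗ y₂)
            expand = begin
              U *ₗ x                                     ≈⟨ *ₗ-cong A.refl (≈ᴹ-trans x≈ (+ᴹ-congˡ y≈)) ⟩
              U *ₗ (C +ᴹ (y₁ +ᴹ u *ₗ y₂))                ≈⟨ *ₗ-distribˡ U _ _ ⟩
              U *ₗ C +ᴹ U *ₗ (y₁ +ᴹ u *ₗ y₂)             ≈⟨ +ᴹ-congˡ (*ₗ-distribˡ U _ _) ⟩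
              U *ₗ C +ᴹ (U *ₗ y₁ +ᴹ U *ₗ (u *ₗ y₂))      ≈⟨ +ᴹ-congˡ (+ᴹ-congˡ (*ₗ-assoc U u y₂)) ⟨
              U *ₗ C +ᴹ (U *ₗ y₁ +ᴹ (U A.* u) *ₗ y₂)     ≈⟨ +ᴹ-congˡ (+ᴹ-congˡ (*ₗ-cong U*u≈ ≈ᴹ-refl)) ⟩
              U *ₗ C +ᴹ (U *ₗ y₁ +ᴹ mono (suc q) K.1# *ₗ y₂) ∎

      generated : ∀ {z} → P z → Generated z
      generated {z} z∈ = Generated-resp (≈ᴹ-trans (*ₗ-cong mono-1 ≈ᴹ-refl) (*ₗ-identityˡ z))
        (approximate (suc α-1 ℕ.+ suc α-1) 0 0 ℕ.≤-refl (X≡ (lem β) (P⇒X₀ z∈)))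
        where
        lem : ∀ β → 0ℤ ≡ 0ℤ ℤ.- β ℤ.* 0ℤ
        lem = ℤ-Solver.solve-∀

    module _ (d B : ℕ)
             (dependent : ∀ (zs : Fin (suc d) → Carrierᴹ) → (∀ s → ∃ λ j → X j (zs s)) →
               ∃₂ λ c e → (∀ s → F e (c s)) × ¬ (∀ s → c s A.≈ A.0#) × lin zs c ≈ᴹ 0ᴹ)
             (monomials : ∀ j → ∃ λ L → length L ℕ.≤ B × All (F j) L ×
               (∀ i c → Wt (j ℤ.- β ℤ.* + i) c → Any (λ t → ∃ λ e → F 0ℤ e × mono i c A.≈ e A.* t) L)) where

      open SpanProperties {A = A} V F₀-sub

      private
        multiples-of : ℤ → List A.Carrier
        multiples-of j = proj₁ (monomials (ℤ.- j))

        gens : ∀ {r} → (Fin r → ℤ) → (Fin r → Carrierᴹ) → List Carrierᴹ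
        gens {zero}  js zs = []
        gens {suc r} js zs = List.map (_*ₗ zs Fin.zero) (multiples-of (js Fin.zero))
                             List.++ gens (js ∘ Fin.suc) (zs ∘ Fin.suc)

        length-gens : ∀ {r} (js : Fin r → ℤ) zs → length (gens js zs) ℕ.≤ r ℕ.* B
        length-gens {zero}  js zs = ℕ.z≤n
        length-gens {suc r} js zs = ℕ.≤-trans
          (ℕ.≤-reflexive (≡.trans (length-++ (List.map (_*ₗ zs Fin.zero) (multiples-of (js Fin.zero))))
            (cong (ℕ._+ length (gens (js ∘ Fin.suc) (zs ∘ Fin.suc))) (length-map (_*ₗ zs Fin.zero) (multiples-of (js Fin.zero))))))
          (ℕ.+-mono-≤ (proj₁ (proj₂ (monomials (ℤ.- js Fin.zero)))) (length-gens (js ∘ Fin.suc) (zs ∘ Fin.suc)))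

        gens∈P : ∀ {r} (js : Fin r → ℤ) zs → (∀ s → X (js s) (zs s)) → All P (gens js zs)
        gens∈P {zero}  js zs mem = []
        gens∈P {suc r} js zs mem = All.++⁺
          (All.map⁺ (All.map (λ {t} Ft → X.multiples (mem Fin.zero) t Ft) (proj₁ (proj₂ (proj₂ (monomials (ℤ.- js Fin.zero)))))))
          (gens∈P (js ∘ Fin.suc) (zs ∘ Fin.suc) (mem ∘ Fin.suc))

        gens-multiple : ∀ {r} (js : Fin r → ℤ) zs i c s → Wt (ℤ.- js s ℤ.- β ℤ.* + i) c →
                        Any (λ g → ∃ λ e → F 0ℤ e × mono i c *ₗ zs s ≈ᴹ e *ₗ g) (gens js zs)
        gens-multiple {suc r} js zs i c Fin.zero W = Any.++⁺ˡ (Any.map⁺ (Any.map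
          (λ {t} (e , Fe , eq) → e , Fe , ≈ᴹ-trans (*ₗ-cong eq ≈ᴹ-refl) (*ₗ-assoc e t (zs Fin.zero)))
          (proj₂ (proj₂ (proj₂ (monomials (ℤ.- js Fin.zero)))) i c W)))
        gens-multiple {suc r} js zs i c (Fin.suc s) W =
          Any.++⁺ʳ (List.map (_*ₗ zs Fin.zero) (multiples-of (js Fin.zero)))
            (gens-multiple (js ∘ Fin.suc) (zs ∘ Fin.suc) i c s W)

      -- Nakayama's lemma consumes the finiteness of `xs`; the count comes from `gens`, where each
      -- `zₛ` is multiplied by the at most `B` monomials generating `F (- jₛ)`.
      few-generators : ∀ xs → All P xs → (∀ {z} → P z → (Zero ⟨ xs ⟩) z) →
                       ∃ λ gs → length gs ℕ.≤ d ℕ.* B × All P gs × (∀ {z} → P z → (Zero ⟨ gs ⟩) z)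
      few-generators xs xs∈P P⊆xs =
        let (r , fam , r≤d , spanning) = spanning-family d dependent
            gs = gens (js fam) (zs fam)
            G-sub = span-isSub Zero-isSub gs
            in-G = λ i c s W → span-multiple Zero-isSub (gens-multiple (js fam) (zs fam) i c s W)
        in gs
         , ℕ.≤-trans (length-gens (js fam) (zs fam)) (ℕ.*-monoˡ-≤ B r≤d)
         , gens∈P (js fam) (zs fam) (mem fam)
         , nakayama P-sub G-sub ϖ η ϖ-F₀ η-F₀ unit (generated fam spanning G-sub in-G) xs xs∈P
             (λ z∈ → span-mono (λ z≈0 → IsSub.resp G-sub (≈ᴹ-sym z≈0) (IsSub.0∈ G-sub)) xs (P⊆xs z∈))
        where
        ϖ-F₀ : F 0ℤ ϖ
        ϖ-F₀ = F-mono (ℤ.+≤+ ℕ.z≤n) ϖ-F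
        η-F₀ : F 0ℤ η
        η-F₀ = mono-F (suc α-1) (Wt≡ (lem α β) (wt-exact (v-ϖ (ℤ.- β))))
          where
          lem : ∀ α β → α ℤ.* ℤ.- β ≡ 0ℤ ℤ.- β ℤ.* α
          lem = ℤ-Solver.solve-∀

-- The ring of power series with its weight filtration.

module Series {a} (D : CompleteDVR a) (α-1 : ℕ) (β : ℤ) where
  open Weights D α-1
  open CompleteDVR D using (K; v; v-cong)
  open PowerSeries K
  private
    module A = CommutativeRing powerSeries
  open K using (Carrier; _≈_; _+_; _*_; -_; 0#; 1#) renaming (refl to ≈-refl; sym to ≈-sym; trans to ≈-trans)
  open MonoidSum K.+-monoid using (sum; sum-cong-≋)

  F : ℤ → (ℕ → Carrier) → Set
  F j f = ∀ i → Wt (j ℤ.- β ℤ.* + i) (f i)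

  F-* : ∀ {j k f g} → F j f → F k g → F (j ℤ.+ k) (f *ₚ g)
  F-* {j} {k} Ff Fg n = wt-sum (suc n) _ λ l → Wt≡ (index l) (wt-* (Ff (toℕ l)) (Fg (n ∸ toℕ l)))
    where
    index : ∀ l → j ℤ.- β ℤ.* + toℕ l ℤ.+ (k ℤ.- β ℤ.* + (n ∸ toℕ l)) ≡ j ℤ.+ k ℤ.- β ℤ.* + n
    index l = ≡.trans (lem j k β (+ toℕ l) (+ (n ∸ toℕ l)))
      (cong (λ i → j ℤ.+ k ℤ.- β ℤ.* i) (≡.trans (≡.sym (ℤ.pos-+ (toℕ l) _)) (cong +_ (ℕ.m+[n∸m]≡n (toℕ≤pred[n] l)))))
      where
      lem : ∀ j k β l m → j ℤ.- β ℤ.* l ℤ.+ (k ℤ.- β ℤ.* m) ≡ j ℤ.+ k ℤ.- β ℤ.* (l ℤ.+ m)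
      lem = ℤ-Solver.solve-∀

  shift : (ℕ → Carrier) → ℕ → Carrier
  shift f zero    = 0#
  shift f (suc i) = f i

  mono : ℕ → Carrier → ℕ → Carrier
  mono zero    x zero    = x
  mono zero    x (suc _) = 0#
  mono (suc n) x         = shift (mono n x)

  shift-cong : ∀ {f g} → f ≈ₚ g → shift f ≈ₚ shift g
  shift-cong f≈g zero    = ≈-refl
  shift-cong f≈g (suc i) = f≈g i

  shift-* : ∀ f g → shift f *ₚ g ≈ₚ shift (f *ₚ g)
  shift-* f g zero    = ≈-trans (K.+-identityʳ _) (K.zeroˡ _)
  shift-* f g (suc i) = ≈-trans (K.+-congʳ (K.zeroˡ _)) (K.+-identityˡ _)

  const-* : ∀ x g i → (mono 0 x *ₚ g) i ≈ x * g i
  const-* x g zero    = K.+-identityʳ _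
  const-* x g (suc i) = ≈-trans (K.+-congˡ (A.zeroˡ g i)) (K.+-identityʳ _)

  mono-cong : ∀ {x y} n → x ≈ y → mono n x ≈ₚ mono n y
  mono-cong zero    x≈y zero    = x≈y
  mono-cong zero    x≈y (suc i) = ≈-refl
  mono-cong (suc n) x≈y         = shift-cong (mono-cong n x≈y)

  mono-neg : ∀ n x → mono n (- x) ≈ₚ (λ i → - mono n x i)
  mono-neg zero    x zero    = ≈-refl
  mono-neg zero    x (suc i) = ≈-sym (RingProperties.-0#≈0# K.ring)
  mono-neg (suc n) x zero    = ≈-sym (RingProperties.-0#≈0# K.ring)
  mono-neg (suc n) x (suc i) = mono-neg n x i

  scale-mono : ∀ n x y i → x * mono n y i ≈ mono n (x * y) i
  scale-mono zero    x y zero    = ≈-refl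
  scale-mono zero    x y (suc i) = K.zeroʳ x
  scale-mono (suc n) x y zero    = K.zeroʳ x
  scale-mono (suc n) x y (suc i) = scale-mono n x y i

  mono-* : ∀ i k x y → mono i x *ₚ mono k y ≈ₚ mono (i ℕ.+ k) (x * y)
  mono-* zero    k x y n = ≈-trans (const-* x (mono k y) n) (scale-mono k x y n)
  mono-* (suc i) k x y n = ≈-trans (shift-* (mono i x) (mono k y) n) (shift-cong (mono-* i k x y) n)

  mono-F : ∀ {j x} n → Wt (j ℤ.- β ℤ.* + n) x → F j (mono n x)
  mono-F zero    w zero    = w
  mono-F zero    w (suc i) = wt-0
  mono-F (suc n) w zero    = wt-0
  mono-F {j} {x} (suc n) w (suc i) = Wt≡ (lem j β (+ i)) (mono-F {j ℤ.- β} n (Wt≡ (≡.sym (lem j β (+ n))) w) i)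
    where
    lem : ∀ j β i → j ℤ.- β ℤ.- β ℤ.* i ≡ j ℤ.- β ℤ.* (1ℤ ℤ.+ i)
    lem = ℤ-Solver.solve-∀

  mono-1 : mono 0 1# ≈ₚ 1ₚ
  mono-1 zero    = ≈-refl
  mono-1 (suc i) = ≈-refl

  head+tail : ∀ f i → f i ≈ mono 0 (f 0) i + (mono 1 1# *ₚ (f ∘ suc)) i
  head+tail f zero    = ≈-sym (≈-trans (K.+-congˡ (shift-* (mono 0 1#) (f ∘ suc) 0)) (K.+-identityʳ _))
  head+tail f (suc i) = ≈-sym (≈-trans (K.+-congˡ (shift-* (mono 0 1#) (f ∘ suc) (suc i)))
    (≈-trans (K.+-identityˡ _) (≈-trans (const-* 1# (f ∘ suc) i) (K.*-identityˡ _))))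

  *ₚ-cong-≤ : ∀ f {g g′} i → (∀ j → j ℕ.≤ i → g j ≈ g′ j) → (f *ₚ g) i ≈ (f *ₚ g′) i
  *ₚ-cong-≤ f i g≈g′ = sum-cong-≋ {suc i} λ j → K.*-congˡ {f (toℕ j)} (g≈g′ (i ∸ toℕ j) (ℕ.m∸n≤m i (toℕ j)))

  -- The recursion gᵢ₊₁ = - f₀⁻¹ Σ fⱼ₊₁ gᵢ₋ⱼ for 1 / f, truncated at depth n.
  module Inverse (f : ℕ → Carrier) (c : Carrier) (f₀c≈1 : f 0 * c ≈ 1#) where
    approx : ℕ → ℕ → Carrier
    approx n       zero    = c
    approx zero    (suc i) = 0#
    approx (suc n) (suc i) = - (c * (f ∘ suc *ₚ approx n) i)

    inv : ℕ → Carrier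
    inv i = approx i i

    approx-step : ∀ n i → i ℕ.≤ n → approx (suc n) i ≈ approx n i
    approx-step n       zero    _         = ≈-refl
    approx-step (suc n) (suc i) (ℕ.s≤s p) = K.-‿cong (K.*-congˡ
      (*ₚ-cong-≤ (f ∘ suc) i λ j j≤i → approx-step n j (ℕ.≤-trans j≤i p)))

    approx-inv : ∀ n i → i ℕ.≤ n → approx n i ≈ inv i
    approx-inv n i i≤n = go (ℕ.≤⇒≤′ i≤n)
      where
      go : ∀ {n} → i ℕ.≤′ n → approx n i ≈ inv i
      go (ℕ.≤′-reflexive refl) = ≈-refl
      go (ℕ.≤′-step i≤′n)      = ≈-trans (approx-step _ i (ℕ.≤′⇒≤ i≤′n)) (go i≤′n)

    f*inv≈1 : f *ₚ inv ≈ₚ 1ₚ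
    f*inv≈1 zero    = ≈-trans (K.+-identityʳ _) f₀c≈1
    f*inv≈1 (suc i) = begin
      f 0 * - (c * T) + (f ∘ suc *ₚ inv) i   ≈⟨ K.+-congˡ (*ₚ-cong-≤ (f ∘ suc) i λ j j≤i → ≈-sym (approx-inv i j j≤i)) ⟩
      f 0 * - (c * T) + T                    ≈⟨ K.+-congʳ (≈-sym (RingProperties.-‿distribʳ-* K.ring _ _)) ⟩
      - (f 0 * (c * T)) + T                  ≈⟨ K.+-congʳ (K.-‿cong (≈-sym (K.*-assoc _ _ _))) ⟩
      - (f 0 * c * T) + T                    ≈⟨ K.+-congʳ (K.-‿cong (≈-trans (K.*-congʳ f₀c≈1) (K.*-identityˡ T))) ⟩
      - T + T                                ≈⟨ K.-‿inverseˡ T ⟩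
      0#                                     ∎
      where
      open SetoidReasoning K.setoid
      T = (f ∘ suc *ₚ approx i) i

    -- The recursion preserves weight: `c` has weight 0, and dropping the first coefficient of `f`
    -- costs exactly the weight `β` that the shift of the index gives back.
    approx-F : F 0ℤ f → Wt 0ℤ c → ∀ n → F 0ℤ (approx n)
    approx-F Ff Wc n zero = Wt≡ (lem β) Wc
      where
      lem : ∀ β → 0ℤ ≡ 0ℤ ℤ.- β ℤ.* 0ℤ
      lem = ℤ-Solver.solve-∀
    approx-F Ff Wc zero    (suc i) = wt-0
    approx-F Ff Wc (suc n) (suc i) = wt-neg (Wt≡ (lem β (+ i)) (wt-* Wc (F-* {ℤ.- β} {0ℤ} tail-F (approx-F Ff Wc n) i)))
      where
      tail-F : F (ℤ.- β) (f ∘ suc)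
      tail-F i = Wt≡ (lem β (+ i)) (Ff (suc i))
        where
        lem : ∀ β i → 0ℤ ℤ.- β ℤ.* (1ℤ ℤ.+ i) ≡ ℤ.- β ℤ.- β ℤ.* i
        lem = ℤ-Solver.solve-∀
      lem : ∀ β i → 0ℤ ℤ.+ (ℤ.- β ℤ.+ 0ℤ ℤ.- β ℤ.* i) ≡ 0ℤ ℤ.- β ℤ.* (1ℤ ℤ.+ i)
      lem = ℤ-Solver.solve-∀

  residue : ∀ {x} → Wt 0ℤ x → v x ≡ [ 0ℤ ]⁺ ⊎ Wt 1ℤ x
  residue {x} W with v x in eq
  ... | ⊤⁺     = inj₂ λ m ()
  ... | [ m ]⁺ with m ℤ.≟ 0ℤ
  ...   | yes refl = inj₁ refl
  ...   | no  m≢0  = inj₂ λ k eq → subst (λ k → 1ℤ ℤ.≤ α ℤ.* k) ([]-injective eq) $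
    positive m m≢0 (ℤ.*-cancelˡ-≤-pos 0ℤ m α (subst (ℤ._≤ α ℤ.* m) (≡.sym (ℤ.*-zeroʳ α)) (W m refl)))
    where
    positive : ∀ m → m ≢ 0ℤ → 0ℤ ℤ.≤ m → 1ℤ ℤ.≤ α ℤ.* m
    positive (+ zero)  m≢0 _ = contradiction refl m≢0
    positive (+ suc m) m≢0 _ = ℤ.+≤+ (ℕ.s≤s ℕ.z≤n)

  1∉Wt₁ : ¬ Wt 1ℤ 1#
  1∉Wt₁ W with subst (1ℤ ℤ.≤_) (ℤ.*-zeroʳ α) (W 0ℤ v-1)
  ... | ℤ.+≤+ ()

  -- Otherwise `1 - x` would have positive weight as well, and so would `1 = (1 - x) + x`.
  complement : ∀ {x} → Wt 1ℤ x → v (1# + - x) ≡ [ 0ℤ ]⁺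
  complement {x} W =
    [ (λ e → e) , (λ W′ → contradiction (wt-resp back (wt-+ W′ W)) 1∉Wt₁) ]′
      (residue (wt-+ wt-1 (wt-mono (ℤ.+≤+ ℕ.z≤n) (wt-neg W))))
    where
    back : 1# + - x + x ≈ 1#
    back = ≈-trans (K.+-assoc _ _ _) (≈-trans (K.+-congˡ (K.-‿inverseˡ x)) (K.+-identityʳ 1#))

  unit : ∀ {f} → F 0ℤ f → v (f 0) ≡ [ 0ℤ ]⁺ → ∃ λ g → F 0ℤ g × g *ₚ f ≈ₚ 1ₚ
  unit {f} Ff vf₀ = inv , (λ i → approx-F Ff (Wt≡ (ℤ.*-zeroʳ α) (wt-exact vc)) i i)
    , A.trans {inv *ₚ f} {f *ₚ inv} {1ₚ} (A.*-comm inv f) f*inv≈1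
    where
    vc = proj₂ (proj₂ (invert vf₀))
    open Inverse f (proj₁ (invert vf₀)) (proj₁ (proj₂ (invert vf₀)))

  local : ∀ {f} → F 0ℤ f → (∃ λ e → F 0ℤ e × e *ₚ f ≈ₚ 1ₚ) ⊎ Wt 1ℤ (f 0)
  local Ff = [ (λ vf₀ → inj₁ (unit Ff vf₀)) , inj₂ ]′ (residue (Wt≡ (lem β) (Ff 0)))
    where
    lem : ∀ β → 0ℤ ℤ.- β ℤ.* 0ℤ ≡ 0ℤ
    lem = ℤ-Solver.solve-∀

  1-ϖf-ηg-unit : ∀ {f g} → F 0ℤ f → F 0ℤ g → ∃ λ e → F 0ℤ e ×
    e *ₚ (1ₚ A.+ A.- (mono 0 ϖ⟨ 1ℤ ⟩ *ₚ f A.+ mono (suc α-1) ϖ⟨ ℤ.- β ⟩ *ₚ g)) ≈ₚ 1ₚ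
  1-ϖf-ηg-unit {f} {g} Ff Fg = unit F-arg (complement W₁)
    where
    ϖ = mono 0 ϖ⟨ 1ℤ ⟩
    η = mono (suc α-1) ϖ⟨ ℤ.- β ⟩
    ϖ-F : F 0ℤ ϖ
    ϖ-F = mono-F {0ℤ} 0 (wt-mono (subst₂ ℤ._≤_ (lem β) refl (ℤ.+≤+ ℕ.z≤n)) (wt-exact (v-ϖ 1ℤ)))
      where
      lem : ∀ β → 0ℤ ≡ 0ℤ ℤ.- β ℤ.* 0ℤ
      lem = ℤ-Solver.solve-∀
    η-F : F 0ℤ η
    η-F = mono-F {0ℤ} (suc α-1) (Wt≡ (lem α β) (wt-exact (v-ϖ (ℤ.- β))))
      where
      lem : ∀ α β → α ℤ.* ℤ.- β ≡ 0ℤ ℤ.- β ℤ.* α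
      lem = ℤ-Solver.solve-∀
    F-arg : F 0ℤ (1ₚ A.+ A.- (ϖ *ₚ f A.+ η *ₚ g))
    F-arg i = wt-+ (wt-resp (mono-1 i) (mono-F {0ℤ} {1#} 0 (Wt≡ (lem β) wt-1) i))
      (wt-neg (wt-+ (F-* {0ℤ} {0ℤ} ϖ-F Ff i) (F-* {0ℤ} {0ℤ} η-F Fg i)))
      where
      lem : ∀ β → 0ℤ ≡ 0ℤ ℤ.- β ℤ.* 0ℤ
      lem = ℤ-Solver.solve-∀
    -- Only `ϖ f` contributes to the constant term, because `η` is a multiple of `u`.
    W₁ : Wt 1ℤ ((ϖ *ₚ f) 0 + (η *ₚ g) 0)
    W₁ = wt-+ (wt-resp (≈-sym (const-* ϖ⟨ 1ℤ ⟩ f 0)) (wt-mono {j = α} (ℤ.+≤+ (ℕ.s≤s ℕ.z≤n))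
                (Wt≡ (lem α β) (wt-* (wt-exact (v-ϖ 1ℤ)) (Ff 0)))))
              (wt-resp (≈-sym (shift-* (mono α-1 ϖ⟨ ℤ.- β ⟩) g 0)) wt-0)
      where
      lem : ∀ α β → α ℤ.* 1ℤ ℤ.+ (0ℤ ℤ.- β ℤ.* 0ℤ) ≡ α
      lem = ℤ-Solver.solve-∀

  seriesRing : SeriesRing D α-1 β
  seriesRing = record
    { A = powerSeries
    ; F = F
    ; F-resp = λ f≈g Ff i → wt-resp (f≈g i) (Ff i)
    ; F-mono = λ k≤j Ff i → wt-mono (ℤ.+-monoˡ-≤ (ℤ.- (β ℤ.* + i)) k≤j) (Ff i)
    ; F-+ = λ Ff Fg i → wt-+ (Ff i) (Fg i)
    ; F-neg = λ Ff i → wt-neg (Ff i)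
    ; F-* = λ {j} {k} {f} {g} → F-* {j} {k} {f} {g}
    ; F-0 = λ i → wt-0
    ; F-1 = λ i → wt-resp (mono-1 i) (mono-F {0ℤ} {1#} 0 (Wt≡ (lem₀ β) wt-1) i)
    ; F-⋂ = λ j Ff i → wt-⋂ (j ℤ.- β ℤ.* + i) λ n → Wt≡ (lem₁ j (+ n) β (+ i)) (Ff n i)
    ; mono = mono
    ; mono-cong = mono-cong
    ; mono-neg = mono-neg
    ; mono-* = mono-*
    ; mono-F = λ {j} {x} → mono-F {j} {x}
    ; coeff = λ i f → f i
    ; tail = _∘ suc
    ; head+tail = head+tail
    ; coeff-tail = λ i f → refl
    ; F⇒Wt = λ i Ff → Ff i
    ; Wt⇒F = λ W → W
    ; mono-1 = mono-1
    ; local = local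
    ; unit = 1-ϖf-ηg-unit
    }
    where
    lem₀ : ∀ β → 0ℤ ≡ 0ℤ ℤ.- β ℤ.* 0ℤ
    lem₀ = ℤ-Solver.solve-∀
    lem₁ : ∀ j n β i → j ℤ.+ n ℤ.- β ℤ.* i ≡ j ℤ.- β ℤ.* i ℤ.+ n
    lem₁ = ℤ-Solver.solve-∀

  -- Since `a₀` is invertible, `b₀ = 0`; then the shift of `b` is again annihilated by `a`, and its
  -- coefficients follow in turn.
  head-cancel : ∀ a b → ¬ (a 0 ≈ 0#) → a *ₚ b ≈ₚ (λ _ → 0#) → b ≈ₚ (λ _ → 0#)
  head-cancel a b a₀≉0 ab≈0 i = go i b ab≈0
    where
    b₀≈0 : ∀ b → a *ₚ b ≈ₚ (λ _ → 0#) → b 0 ≈ 0#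
    b₀≈0 b ab≈0 = begin
      b 0               ≈⟨ K.*-identityˡ _ ⟨
      1# * b 0          ≈⟨ K.*-congʳ (≈-trans (K.*-comm c (a 0)) a₀c≈1) ⟨
      c * a 0 * b 0     ≈⟨ K.*-assoc _ _ _ ⟩
      c * (a 0 * b 0)   ≈⟨ K.*-congˡ (≈-trans (≈-sym (K.+-identityʳ _)) (ab≈0 0)) ⟩
      c * 0#            ≈⟨ K.zeroʳ c ⟩
      0#                ∎
      where
      open SetoidReasoning K.setoid
      inverse = invert (proj₂ (v-finite a₀≉0))
      c = proj₁ inverse
      a₀c≈1 = proj₁ (proj₂ inverse)
    go : ∀ i b → a *ₚ b ≈ₚ (λ _ → 0#) → b i ≈ 0#
    go zero    b ab≈0 = b₀≈0 b ab≈0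
    go (suc i) b ab≈0 = go i (b ∘ suc) λ n → begin
      (a *ₚ (b ∘ suc)) n                    ≈⟨ A.*-comm a (b ∘ suc) n ⟩
      ((b ∘ suc) *ₚ a) n                    ≈⟨ K.+-identityˡ _ ⟨
      0# + ((b ∘ suc) *ₚ a) n               ≈⟨ K.+-congʳ (≈-trans (K.*-congʳ (b₀≈0 b ab≈0)) (K.zeroˡ _)) ⟨
      b 0 * a (suc n) + ((b ∘ suc) *ₚ a) n  ≈⟨ A.*-comm b a (suc n) ⟩
      (a *ₚ b) (suc n)                      ≈⟨ ab≈0 (suc n) ⟩
      0#                                    ∎
      where open SetoidReasoning K.setoid

  -- Vanishing initial coefficients of `a` are shifted away; the index `i` of a non-zero coefficient
  -- guarantees that this stops.
  *-cancelˡ-0 : ∀ i a b → ¬ (a i ≈ 0#) → a *ₚ b ≈ₚ (λ _ → 0#) → b ≈ₚ (λ _ → 0#)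
  *-cancelˡ-0 zero    a b a₀≉0 ab≈0 = head-cancel a b a₀≉0 ab≈0
  *-cancelˡ-0 (suc i) a b aᵢ≉0 ab≈0 with ≈0? (a 0)
  ... | no  a₀≉0 = head-cancel a b a₀≉0 ab≈0
  ... | yes a₀≈0 = *-cancelˡ-0 i (a ∘ suc) b aᵢ≉0 λ n →
    ≈-trans (≈-sym (≈-trans (K.+-congʳ (≈-trans (K.*-congʳ a₀≈0) (K.zeroˡ _))) (K.+-identityˡ _))) (ab≈0 (suc n))

-- Modules of finite length over a local ring.

module FiniteLengths {a} (A : CommutativeRing a a) where
  private module A = CommutativeRing A
  open Modules A

  -- Isomorphisms as correspondences, so that no inverse has to be chosen.
  record _≅_ (M N : Mod) : Set (lsuc a) where
    private
      module M = LeftModule M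
      module N = LeftModule N
    infix 4 _~_
    field
      _~_    : M.Carrierᴹ → N.Carrierᴹ → Set a
      ~-+    : ∀ {x x′ y y′} → x ~ y → x′ ~ y′ → x M.+ᴹ x′ ~ y N.+ᴹ y′
      ~-*    : ∀ c {x y} → x ~ y → c M.*ₗ x ~ c N.*ₗ y
      ~-0    : M.0ᴹ ~ N.0ᴹ
      total  : ∀ x → ∃ λ y → x ~ y
      onto   : ∀ y → ∃ λ x → x ~ y
      zero⇒  : ∀ {x y} → x ~ y → x M.≈ᴹ M.0ᴹ → y N.≈ᴹ N.0ᴹ
      zero⇐  : ∀ {x y} → x ~ y → y N.≈ᴹ N.0ᴹ → x M.≈ᴹ M.0ᴹ

  module _ (M : Mod) where
    open LeftModule M
    open SetoidReasoning ≈ᴹ-setoid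

    infixl 6 _⊝_
    _⊝_ : Carrierᴹ → Carrierᴹ → Carrierᴹ
    x ⊝ y = x +ᴹ (A.- A.1#) *ₗ y

    -1*≈-ᴹ : ∀ x → (A.- A.1#) *ₗ x ≈ᴹ -ᴹ x
    -1*≈-ᴹ x = LeftModuleProperties.inverseˡ-uniqueᴹ M _ _ (begin
      (A.- A.1#) *ₗ x +ᴹ x           ≈⟨ +ᴹ-congˡ (*ₗ-identityˡ x) ⟨
      (A.- A.1#) *ₗ x +ᴹ A.1# *ₗ x   ≈⟨ *ₗ-distribʳ x _ _ ⟨
      ((A.- A.1#) A.+ A.1#) *ₗ x     ≈⟨ *ₗ-cong (A.-‿inverseˡ A.1#) ≈ᴹ-refl ⟩
      A.0# *ₗ x                      ≈⟨ *ₗ-zeroˡ x ⟩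
      0ᴹ                             ∎)

    ≈⇒⊝≈0 : ∀ {x y} → x ≈ᴹ y → x ⊝ y ≈ᴹ 0ᴹ
    ≈⇒⊝≈0 {x} {y} x≈y = ≈ᴹ-trans (+ᴹ-cong x≈y (-1*≈-ᴹ y)) (-ᴹ‿inverseʳ y)

    ⊝≈0⇒≈ : ∀ {x y} → x ⊝ y ≈ᴹ 0ᴹ → x ≈ᴹ y
    ⊝≈0⇒≈ {x} {y} p = begin
      x                    ≈⟨ +ᴹ-identityʳ x ⟨
      x +ᴹ 0ᴹ              ≈⟨ +ᴹ-congˡ (-ᴹ‿inverseˡ y) ⟨
      x +ᴹ (-ᴹ y +ᴹ y)     ≈⟨ +ᴹ-assoc _ _ _ ⟨
      (x +ᴹ -ᴹ y) +ᴹ y     ≈⟨ +ᴹ-congʳ (+ᴹ-congˡ (-1*≈-ᴹ y)) ⟨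
      (x ⊝ y) +ᴹ y         ≈⟨ +ᴹ-congʳ p ⟩
      0ᴹ +ᴹ y              ≈⟨ +ᴹ-identityˡ y ⟩
      y                    ∎

    x-0≈x : ∀ x → x +ᴹ -ᴹ 0ᴹ ≈ᴹ x
    x-0≈x x = ≈ᴹ-trans (+ᴹ-congˡ (≈ᴹ-trans (≈ᴹ-sym (+ᴹ-identityˡ _)) (-ᴹ‿inverseʳ 0ᴹ))) (+ᴹ-identityʳ x)

  module _ {M N : Mod} (I : M ≅ N) where
    private
      module M = LeftModule M
      module N = LeftModule N
    open _≅_ I

    -- The correspondence is linear, so a difference of two pairs is again a pair, and the condition
    -- at zero is enough.
    ~-functional : ∀ {x x′ y y′} → x ~ y → x′ ~ y′ → x M.≈ᴹ x′ → y N.≈ᴹ y′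
    ~-functional p q x≈x′ = ⊝≈0⇒≈ N (zero⇒ (~-+ p (~-* _ q)) (≈⇒⊝≈0 M x≈x′))

    ~-injective : ∀ {x x′ y y′} → x ~ y → x′ ~ y′ → y N.≈ᴹ y′ → x M.≈ᴹ x′
    ~-injective p q y≈y′ = ⊝≈0⇒≈ M (zero⇐ (~-+ p (~-* _ q)) (≈⇒⊝≈0 N y≈y′))

    image : Submodule M → Submodule N
    image L = record
      { _∈N    = λ y → ∃₂ λ x y′ → x ∈N × x ~ y′ × y′ N.≈ᴹ y
      ; ∈-resp = λ y≈z (x , y′ , x∈ , x~y′ , y′≈y) → x , y′ , x∈ , x~y′ , N.≈ᴹ-trans y′≈y y≈z
      ; 0∈N    = M.0ᴹ , N.0ᴹ , 0∈N , ~-0 , N.≈ᴹ-refl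
      ; +∈N    = λ (x , x′ , x∈ , x~x′ , x′≈) (y , y′ , y∈ , y~y′ , y′≈) →
                   x M.+ᴹ y , x′ N.+ᴹ y′ , +∈N x∈ y∈ , ~-+ x~x′ y~y′ , N.+ᴹ-cong x′≈ y′≈
      ; *∈N    = λ c (x , x′ , x∈ , x~x′ , x′≈) →
                   c M.*ₗ x , c N.*ₗ x′ , *∈N c x∈ , ~-* c x~x′ , N.*ₗ-cong A.refl x′≈
      }
      where open Submodule L

    preimage : Submodule N → Submodule M
    preimage L = record
      { _∈N    = λ x → ∃ λ y → y ∈N × x ~ y
      ; ∈-resp = λ {x} {x′} x≈x′ (y , y∈ , x~y) → let (y′ , x′~y′) = total x′ in
                   y′ , ∈-resp (~-functional x~y x′~y′ x≈x′) y∈ , x′~y′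
      ; 0∈N    = N.0ᴹ , 0∈N , ~-0
      ; +∈N    = λ (y , y∈ , p) (y′ , y′∈ , p′) → y N.+ᴹ y′ , +∈N y∈ y′∈ , ~-+ p p′
      ; *∈N    = λ c (y , y∈ , p) → c N.*ₗ y , *∈N c y∈ , ~-* c p
      }
      where open Submodule L

    simple-≅ : Simple M → Simple N
    simple-≅ s = record
      { nontrivial = let (x , x≉0) = nontrivial ; (y , x~y) = total x in y , λ y≈0 → x≉0 (zero⇐ x~y y≈0)
      ; minimal    = λ L → go L (minimal (preimage L))
      }
      where
      open Simple s
      go : ∀ L (let open Submodule) →
           (∀ x → _∈N (preimage L) x → x M.≈ᴹ M.0ᴹ) ⊎ (∀ x → _∈N (preimage L) x) →
           (∀ y → _∈N L y → y N.≈ᴹ N.0ᴹ) ⊎ (∀ y → _∈N L y)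
      go L (inj₁ none) = inj₁ λ y y∈ → let (x , x~y) = onto y in zero⇒ x~y (none x (y , y∈ , x~y))
      go L (inj₂ all)  = inj₂ λ y → let (x , x~y) = onto y ; (y′ , y′∈ , x~y′) = all x in
                           Submodule.∈-resp L (~-functional x~y′ x~y M.≈ᴹ-refl) y′∈

    quotient-≅ : ∀ L → Quotient L ≅ Quotient (image L)
    quotient-≅ L = record
      { _~_   = _~_
      ; ~-+   = ~-+
      ; ~-*   = ~-*
      ; ~-0   = ~-0
      ; total = total
      ; onto  = onto
      ; zero⇒ = λ {x} {y} x~y x∈ → x , y , ∈-resp (x-0≈x M x) x∈ , x~y , N.≈ᴹ-sym (x-0≈x N y)
      ; zero⇐ = λ {x} {y} x~y (x′ , y′ , x′∈ , x′~y′ , y′≈) → ∈-resp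
                  (M.≈ᴹ-trans (~-injective x′~y′ x~y (N.≈ᴹ-trans y′≈ (x-0≈x N y))) (M.≈ᴹ-sym (x-0≈x M x))) x′∈
      }
      where open Submodule L

    sub-≅ : ∀ L → ⌊ L ⌋ ≅ ⌊ image L ⌋
    sub-≅ L = record
      { _~_   = λ x y → ∃ λ y′ → proj₁ x ~ y′ × y′ N.≈ᴹ proj₁ y
      ; ~-+   = λ (x , p , x≈) (y , q , y≈) → x N.+ᴹ y , ~-+ p q , N.+ᴹ-cong x≈ y≈
      ; ~-*   = λ c (x , p , x≈) → c N.*ₗ x , ~-* c p , N.*ₗ-cong A.refl x≈
      ; ~-0   = N.0ᴹ , ~-0 , N.≈ᴹ-refl
      ; total = λ (x , x∈) → let (y , x~y) = total x in
                  (y , x , y , x∈ , x~y , N.≈ᴹ-refl) , y , x~y , N.≈ᴹ-refl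
      ; onto  = λ (y , x , y′ , x∈ , x~y′ , y′≈) → (x , x∈) , y′ , x~y′ , y′≈
      ; zero⇒ = λ (y′ , x~y′ , y′≈) x≈0 → N.≈ᴹ-trans (N.≈ᴹ-sym y′≈) (zero⇒ x~y′ x≈0)
      ; zero⇐ = λ (y′ , x~y′ , y′≈) y≈0 → zero⇐ x~y′ (N.≈ᴹ-trans y′≈ y≈0)
      }

  finiteLength-≅ : ∀ {M N} → M ≅ N → FiniteLength M → FiniteLength N
  finiteLength-≅ I (trivial x≈0)   = trivial λ y → let (x , x~y) = _≅_.onto I y in _≅_.zero⇒ I x~y (x≈0 x)
  finiteLength-≅ I (extend L s fl) =
    extend (image I L) (simple-≅ (quotient-≅ I L) s) (finiteLength-≅ (sub-≅ I L) fl)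

  module _ {s : A.Carrier} (radical : ∀ c → ∃ λ e → e A.* (A.1# A.+ A.- (s A.* c)) A.≈ A.1#) where

    -- `s M` is 0 or `M`. In the second case a non-zero `x₀`, which generates `M`, satisfies
    -- `x₀ = s x₁ = s c x₀`, and `1 - s c` is invertible, so `x₀ = 0`.
    simple-annihilated : ∀ {M} → Simple M → (let open LeftModule M) → ∀ x → s *ₗ x ≈ᴹ 0ᴹ
    simple-annihilated {M} simple x with Simple.minimal simple multiples
      where
      open LeftModule M
      multiples : Submodule M
      multiples = record
        { _∈N    = λ y → ∃ λ x → y ≈ᴹ s *ₗ x
        ; ∈-resp = λ y≈z (x , y≈) → x , ≈ᴹ-trans (≈ᴹ-sym y≈z) y≈
        ; 0∈N    = 0ᴹ , ≈ᴹ-sym (*ₗ-zeroʳ s)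
        ; +∈N    = λ (x , p) (y , q) → x +ᴹ y , ≈ᴹ-trans (+ᴹ-cong p q) (≈ᴹ-sym (*ₗ-distribˡ s x y))
        ; *∈N    = λ c (x , p) → c *ₗ x , ≈ᴹ-trans (*ₗ-cong A.refl p)
                     (≈ᴹ-trans (≈ᴹ-sym (*ₗ-assoc c s x)) (≈ᴹ-trans (*ₗ-cong (A.*-comm c s) ≈ᴹ-refl) (*ₗ-assoc s c x)))
        }
    ... | inj₁ none = none _ (x , LeftModule.≈ᴹ-refl M)
    ... | inj₂ all  = contradiction x₀≈0 x₀≉0
      where
      open LeftModule M
      open SetoidReasoning ≈ᴹ-setoid
      x₀ = proj₁ (Simple.nontrivial simple)
      x₀≉0 = proj₂ (Simple.nontrivial simple)
      cyclic : Submodule M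
      cyclic = record
        { _∈N    = λ y → ∃ λ c → y ≈ᴹ c *ₗ x₀
        ; ∈-resp = λ y≈z (c , y≈) → c , ≈ᴹ-trans (≈ᴹ-sym y≈z) y≈
        ; 0∈N    = A.0# , ≈ᴹ-sym (*ₗ-zeroˡ x₀)
        ; +∈N    = λ (c , p) (d , q) → c A.+ d , ≈ᴹ-trans (+ᴹ-cong p q) (≈ᴹ-sym (*ₗ-distribʳ x₀ c d))
        ; *∈N    = λ c (d , p) → c A.* d , ≈ᴹ-trans (*ₗ-cong A.refl p) (≈ᴹ-sym (*ₗ-assoc c d x₀))
        }
      generated : ∀ y → ∃ λ c → y ≈ᴹ c *ₗ x₀
      generated with Simple.minimal simple cyclic
      ... | inj₁ none = contradiction (none x₀ (A.1# , ≈ᴹ-sym (*ₗ-identityˡ x₀))) x₀≉0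
      ... | inj₂ all  = all
      x₀≈0 : x₀ ≈ᴹ 0ᴹ
      x₀≈0 = let (x₁ , x₀≈sx₁) = all x₀
                 (c , x₁≈cx₀) = generated x₁
                 (e , e[1-sc]≈1) = radical c in begin
        x₀                                             ≈⟨ *ₗ-identityˡ x₀ ⟨
        A.1# *ₗ x₀                                     ≈⟨ *ₗ-cong e[1-sc]≈1 ≈ᴹ-refl ⟨
        (e A.* (A.1# A.+ A.- (s A.* c))) *ₗ x₀         ≈⟨ *ₗ-assoc _ _ _ ⟩
        e *ₗ ((A.1# A.+ A.- (s A.* c)) *ₗ x₀)          ≈⟨ *ₗ-cong A.refl (*ₗ-distribʳ x₀ _ _) ⟩
        e *ₗ (A.1# *ₗ x₀ +ᴹ (A.- (s A.* c)) *ₗ x₀)     ≈⟨ *ₗ-cong A.refl (+ᴹ-congʳ (≈ᴹ-trans (*ₗ-identityˡ x₀)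
                                                            (≈ᴹ-trans x₀≈sx₁ (≈ᴹ-trans (*ₗ-cong A.refl x₁≈cx₀) (≈ᴹ-sym (*ₗ-assoc s c x₀)))))) ⟩
        e *ₗ ((s A.* c) *ₗ x₀ +ᴹ (A.- (s A.* c)) *ₗ x₀) ≈⟨ *ₗ-cong A.refl (*ₗ-distribʳ x₀ _ _) ⟨
        e *ₗ ((s A.* c A.+ A.- (s A.* c)) *ₗ x₀)       ≈⟨ *ₗ-cong A.refl (≈ᴹ-trans (*ₗ-cong (A.-‿inverseʳ _) ≈ᴹ-refl) (*ₗ-zeroˡ x₀)) ⟩
        e *ₗ 0ᴹ                                        ≈⟨ *ₗ-zeroʳ e ⟩
        0ᴹ                                             ∎

    -- Each step of the composition series costs one factor `s`. The predicate `T` lets the caller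
    -- retain whatever property of the powers of `s` it wants.
    finiteLength-torsion : ∀ {T : A.Carrier → Set a} → T A.1# → (∀ {t} → T t → T (t A.* s)) →
      ∀ {M} → FiniteLength M → (let open LeftModule M) → ∀ x → ∃ λ t → T t × t *ₗ x ≈ᴹ 0ᴹ
    finiteLength-torsion T1 Ts {M} (trivial x≈0) x = A.1# , T1 , LeftModule.≈ᴹ-trans M (LeftModule.*ₗ-identityˡ M x) (x≈0 x)
    finiteLength-torsion {T} T1 Ts {M} (extend L simple fl) x =
      let s*x∈L = Submodule.∈-resp L (x-0≈x M (s *ₗ x)) (simple-annihilated simple x)
          (t , Tt , t*s*x≈0) = finiteLength-torsion {T} T1 Ts fl (s *ₗ x , s*x∈L)
      in t A.* s , Ts Tt , ≈ᴹ-trans (*ₗ-assoc t s x) t*s*x≈0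
      where open LeftModule M

  module _ (M : Mod) where
    open LeftModule M
    open SetoidReasoning ≈ᴹ-setoid

    x+y-y≈x : ∀ x y → (x +ᴹ y) +ᴹ -ᴹ y ≈ᴹ x
    x+y-y≈x x y = ≈ᴹ-trans (+ᴹ-assoc _ _ _) (≈ᴹ-trans (+ᴹ-congˡ (-ᴹ‿inverseʳ y)) (+ᴹ-identityʳ x))

    x-y+y≈x : ∀ x y → (x +ᴹ -ᴹ y) +ᴹ y ≈ᴹ x
    x-y+y≈x x y = ≈ᴹ-trans (+ᴹ-assoc _ _ _) (≈ᴹ-trans (+ᴹ-congˡ (-ᴹ‿inverseˡ y)) (+ᴹ-identityʳ x))

  module _ (em : ∀ {ℓ} → ExcludedMiddle ℓ) {𝔪 : A.Carrier → Set}
           (local : ∀ c → (∃ λ e → e A.* c A.≈ A.1#) ⊎ 𝔪 c)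
           {M : Mod} (L : Submodule M) (w : LeftModule.Carrierᴹ M) where
    open LeftModule M
    open Submodule L
    open SetoidReasoning ≈ᴹ-setoid
    open CommutativeSemigroupProperties
      (CommutativeMonoid.commutativeSemigroup +ᴹ-commutativeMonoid) using (interchange)

    -- An element outside `L` must have a unit as coefficient of `w`, because `𝔪 w ⊂ L`. So a
    -- submodule strictly larger than `L` contains `w` modulo `L`, and thus everything.
    simple-quotient : ¬ w ∈N → (∀ c → 𝔪 c → c *ₗ w ∈N) →
                      (∀ x → ∃₂ λ c q → q ∈N × x ≈ᴹ c *ₗ w +ᴹ q) → Simple (Quotient L)
    simple-quotient w∉L 𝔪w⊆L cyclic = record
      { nontrivial = w , λ w-0∈L → w∉L (∈-resp (x-0≈x M w) w-0∈L)
      ; minimal    = λ Q → decide Q em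
      }
      where
      decide : (Q : Submodule (Quotient L)) → Dec (∃ λ x → Submodule._∈N Q x × ¬ x ∈N) →
               (∀ x → Submodule._∈N Q x → (x +ᴹ -ᴹ 0ᴹ) ∈N) ⊎ (∀ x → Submodule._∈N Q x)
      decide Q (no none) = inj₁ λ x x∈Q → ∈-resp (≈ᴹ-sym (x-0≈x M x)) (decidable-stable em λ x∉L → none (x , x∈Q , x∉L))
      decide Q (yes (x , x∈Q , x∉L)) = let (c , q , q∈L , x≈) = cyclic x in inj₂ (go c q q∈L x≈ (local c))
        where
        go : ∀ c q → q ∈N → x ≈ᴹ c *ₗ w +ᴹ q → (∃ λ e → e A.* c A.≈ A.1#) ⊎ 𝔪 c → ∀ y → Submodule._∈N Q y
        go c q q∈L x≈ (inj₂ c∈𝔪) y = contradiction (∈-resp (≈ᴹ-sym x≈) (+∈N (𝔪w⊆L c c∈𝔪) q∈L)) x∉L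
        go c q q∈L x≈ (inj₁ (e , ec≈1)) y =
          let (d , q′ , q′∈L , y≈) = cyclic y in
          Submodule.∈-resp Q {(d A.* e) *ₗ x} {y} (∈-resp (difference d q′ y≈) (+∈N (*∈N (d A.* e) q∈L) (-∈N q′∈L)))
            (Submodule.*∈N Q (d A.* e) {x} x∈Q)
          where
          difference : ∀ d q′ → y ≈ᴹ d *ₗ w +ᴹ q′ → (d A.* e) *ₗ q +ᴹ -ᴹ q′ ≈ᴹ (d A.* e) *ₗ x +ᴹ -ᴹ y
          difference d q′ y≈ = begin
            r *ₗ q +ᴹ -ᴹ q′                              ≈⟨ x+y-y≈x M _ y ⟨
            ((r *ₗ q +ᴹ -ᴹ q′) +ᴹ y) +ᴹ -ᴹ y             ≈⟨ +ᴹ-congʳ (begin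
              (r *ₗ q +ᴹ -ᴹ q′) +ᴹ y                     ≈⟨ +ᴹ-congˡ (≈ᴹ-trans y≈ (+ᴹ-comm _ _)) ⟩
              (r *ₗ q +ᴹ -ᴹ q′) +ᴹ (q′ +ᴹ d *ₗ w)        ≈⟨ +ᴹ-assoc _ _ _ ⟨
              ((r *ₗ q +ᴹ -ᴹ q′) +ᴹ q′) +ᴹ d *ₗ w        ≈⟨ +ᴹ-congʳ (x-y+y≈x M _ _) ⟩
              r *ₗ q +ᴹ d *ₗ w                           ≈⟨ +ᴹ-congˡ (*ₗ-cong rc≈d ≈ᴹ-refl) ⟨
              r *ₗ q +ᴹ (r A.* c) *ₗ w                   ≈⟨ +ᴹ-congˡ (*ₗ-assoc r c w) ⟩
              r *ₗ q +ᴹ r *ₗ (c *ₗ w)                    ≈⟨ *ₗ-distribˡ r _ _ ⟨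
              r *ₗ (q +ᴹ c *ₗ w)                         ≈⟨ *ₗ-cong A.refl (≈ᴹ-trans (+ᴹ-comm _ _) (≈ᴹ-sym x≈)) ⟩
              r *ₗ x                                     ∎) ⟩
            r *ₗ x +ᴹ -ᴹ y                               ∎
            where
            r = d A.* e
            rc≈d : r A.* c A.≈ d
            rc≈d = A.trans (A.*-assoc d e c) (A.trans (A.*-congˡ ec≈1) (A.*-identityʳ d))

  -- An extension of X = Max(M) by a simple module maps back to X over M.
  module _ (em : ∀ {ℓ} → ExcludedMiddle ℓ) {𝔪 : A.Carrier → Set}
           (local : ∀ c → (∃ λ e → e A.* c A.≈ A.1#) ⊎ 𝔪 c)
           {M X N : Mod} {f : Hom M X} (max : IsMax M X f) (f′ : Hom M N)
           (Q : Submodule N) (I : X ≅ ⌊ Q ⌋) where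
    private
      module M = LeftModule M
      module X = LeftModule X
      module N = LeftModule N
      module f = Hom f
      module f′ = Hom f′
    open Submodule Q
    open _≅_ I
    open IsMax max

    retraction : (∀ p → Σ (f′.⟦_⟧ p ∈N) λ f′p∈Q → f.⟦_⟧ p ~ (f′.⟦_⟧ p , f′p∈Q)) →
                 (∀ p → f′.⟦_⟧ p N.≈ᴹ N.0ᴹ → p M.≈ᴹ M.0ᴹ) →
                 ∀ w → ¬ w ∈N → (∀ c → 𝔪 c → c N.*ₗ w ∈N) →
                 (∀ x → ∃₂ λ c q → q ∈N × x N.≈ᴹ c N.*ₗ w N.+ᴹ q) →
                 FinitelyGenerated N → TorsionFree N →
                 ∃ λ (g : Hom N X) → ∀ p → Hom.⟦_⟧ g (f′.⟦_⟧ p) X.≈ᴹ f.⟦_⟧ p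
    retraction over-M f′-injective w w∉Q 𝔪w⊆Q cyclic fg tf = universal N fg tf f′ (kernel , cokernel)
      where
      -- `Q` contains the image of `f′`, so it also respects the coarser equality of the cokernel.
      L : Submodule (Cokernel f′)
      L = record
        { _∈N    = _∈N
        ; ∈-resp = λ {x} {y} (p , f′p≈x-y) x∈ → ∈-resp (minus-swap f′p≈x-y) (+∈N x∈ (-∈N (proj₁ (over-M p))))
        ; 0∈N    = 0∈N
        ; +∈N    = +∈N
        ; *∈N    = *∈N
        }
        where
        minus-swap : ∀ {x y z} → x N.≈ᴹ y N.+ᴹ N.-ᴹ z → y N.+ᴹ N.-ᴹ x N.≈ᴹ z
        minus-swap {x} {y} {z} x≈ = begin
          y N.+ᴹ N.-ᴹ x                        ≈⟨ N.+ᴹ-congʳ (x-y+y≈x N y z) ⟨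
          (y N.+ᴹ N.-ᴹ z N.+ᴹ z) N.+ᴹ N.-ᴹ x   ≈⟨ N.+ᴹ-congʳ (N.≈ᴹ-trans (N.+ᴹ-congʳ (N.≈ᴹ-sym x≈)) (N.+ᴹ-comm x z)) ⟩
          (z N.+ᴹ x) N.+ᴹ N.-ᴹ x               ≈⟨ x+y-y≈x N z x ⟩
          z                                    ∎
          where open SetoidReasoning N.≈ᴹ-setoid

      L-simple : Simple (Quotient L)
      L-simple = simple-quotient em {𝔪} local L w w∉Q 𝔪w⊆Q λ x →
        let (c , q , q∈Q , x≈) = cyclic x in
        c , q , q∈Q , M.0ᴹ , N.≈ᴹ-trans f′.0ᴹ-homo (N.≈ᴹ-sym (N.≈ᴹ-trans (N.+ᴹ-congʳ x≈) (N.-ᴹ‿inverseʳ _)))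

      coker-≅ : Cokernel f ≅ ⌊ L ⌋
      coker-≅ = record
        { _~_   = _~_
        ; ~-+   = ~-+
        ; ~-*   = ~-*
        ; ~-0   = ~-0
        ; total = total
        ; onto  = onto
        ; zero⇒ = λ {x} {y} x~y (p , fp≈) → p , N.≈ᴹ-trans
                    (~-functional I (proj₂ (over-M p)) x~y (X.≈ᴹ-trans fp≈ (x-0≈x X x))) (N.≈ᴹ-sym (x-0≈x N (proj₁ y)))
        ; zero⇐ = λ {x} {y} x~y (p , f′p≈) → p , X.≈ᴹ-trans
                    (~-injective I (proj₂ (over-M p)) x~y (N.≈ᴹ-trans f′p≈ (x-0≈x N (proj₁ y)))) (X.≈ᴹ-sym (x-0≈x X x))
        }

      kernel : FiniteLength (Kernel f′)
      kernel = trivial λ (p , f′p≈0) → f′-injective p f′p≈0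

      -- The cokernel of `f` sits inside that of `f′` with a simple quotient, so one step is added
      -- to its composition series.
      cokernel : FiniteLength (Cokernel f′)
      cokernel = extend L L-simple (finiteLength-≅ coker-≅ (proj₂ isQuasiIsomorphism))

-- Linear dependence of `d + 1` vectors with `d` coordinates.

module LinearDependence {a} (em : ∀ {ℓ} → ExcludedMiddle ℓ) (A : CommutativeRing a a) where
  open CommutativeRing A renaming (refl to ≈-refl; sym to ≈-sym; trans to ≈-trans)
  open MonoidSum +-monoid using (sum; sum-cong-≋)
  open RingProperties ring using (-1*x≈-x)
  open SetoidReasoning setoid

  private
    n : Carrier
    n = - 1#

    -- The element `n = -1` is treated as a variable, which makes every inductive step an identity
    -- of commutative semirings.
    eliminate : ∀ {r} p b (c x y : Fin r → Carrier) →
      (n * sum (λ s → c s * x s)) * b + sum (λ s → (p * c s) * y s) ≈ sum (λ s → c s * (p * y s + n * (x s * b)))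
    eliminate {zero} p b c x y = ≈-trans (+-congʳ (≈-trans (*-congʳ (zeroʳ n)) (zeroˡ b))) (+-identityˡ 0#)
    eliminate {suc r} p b c x y = ≈-trans (step n (c Fin.zero) (x Fin.zero) (y Fin.zero) p b _ _)
      (+-congˡ (eliminate p b (c ∘ Fin.suc) (x ∘ Fin.suc) (y ∘ Fin.suc)))
      where
      step : ∀ n c x y p b X Y → (n * (c * x + X)) * b + ((p * c) * y + Y) ≈
                                 c * (p * y + n * (x * b)) + ((n * X) * b + Y)
      step = solve 8 (λ n c x y p b X Y → (n :* (c :* x :+ X)) :* b :+ ((p :* c) :* y :+ Y) :=
                                 c :* (p :* y :+ n :* (x :* b)) :+ ((n :* X) :* b :+ Y)) ≈-refl
        where open SemiringSolver commutativeSemiring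

    sum-zero : ∀ {r} (f : Fin r → Carrier) → (∀ s → f s ≈ 0#) → sum f ≈ 0#
    sum-zero {zero}  f f≈0 = ≈-refl
    sum-zero {suc r} f f≈0 = ≈-trans (+-cong (f≈0 Fin.zero) (sum-zero (f ∘ Fin.suc) (f≈0 ∘ Fin.suc))) (+-identityˡ 0#)

  module _ (1≉0 : ¬ (1# ≈ 0#)) (cancel : ∀ {x y} → ¬ (x ≈ 0#) → x * y ≈ 0# → y ≈ 0#)
           {B : Carrier → Set} (B-0 : B 0#) (B-1 : B 1#) (B-neg : ∀ {x} → B x → B (- x))
           (B-+ : ∀ {x y} → B x → B y → B (x + y)) (B-* : ∀ {x y} → B x → B y → B (x * y)) where

    private
      B-sum : ∀ {r} (f : Fin r → Carrier) → (∀ s → B (f s)) → B (sum f)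
      B-sum {zero}  f Bf = B-0
      B-sum {suc r} f Bf = B-+ (Bf Fin.zero) (B-sum (f ∘ Fin.suc) (Bf ∘ Fin.suc))

    -- Fraction-free elimination: rows are multiplied by the pivot instead of divided by it, so the
    -- coefficients remain in `B`.
    dependent : ∀ d (zs : Fin (suc d) → Fin d → Carrier) → (∀ s k → B (zs s k)) →
                ∃ λ (c : Fin (suc d) → Carrier) → (∀ s → B (c s)) × ¬ (∀ s → c s ≈ 0#) × (∀ k → sum (λ s → c s * zs s k) ≈ 0#)
    dependent zero    zs Bz = (λ _ → 1#) , (λ _ → B-1) , (λ c≈0 → 1≉0 (c≈0 Fin.zero)) , λ ()
    dependent (suc d) zs Bz with em {P = ∃ λ k → ¬ (zs Fin.zero k ≈ 0#)}
    ... | no ¬pivot = c , Bc , (λ c≈0 → 1≉0 (c≈0 Fin.zero)) , relation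
      where
      c : Fin (suc (suc d)) → Carrier
      c Fin.zero    = 1#
      c (Fin.suc _) = 0#
      Bc : ∀ s → B (c s)
      Bc Fin.zero    = B-1
      Bc (Fin.suc _) = B-0
      relation : ∀ k → sum (λ s → c s * zs s k) ≈ 0#
      relation k with em {_} {P = zs Fin.zero k ≈ 0#}
      ... | yes z≈0 = sum-zero (λ s → c s * zs s k) λ where
              Fin.zero    → ≈-trans (*-identityˡ (zs Fin.zero k)) z≈0
              (Fin.suc s) → zeroˡ (zs (Fin.suc s) k)
      ... | no  z≉0 = contradiction (k , z≉0) ¬pivot
    ... | yes (k , p≉0) = c , Bc , c≉0 , relation
      where
      p = zs Fin.zero k
      -- The 2 by 2 minors through the pivot. They vanish in column `k`, so the induction may forget
      -- that column.
      minor : Fin (suc d) → Fin (suc d) → Carrier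
      minor s l = p * zs (Fin.suc s) l + n * (zs (Fin.suc s) k * zs Fin.zero l)
      IH = dependent d (λ s l → minor s (punchIn k l)) λ s l →
        B-+ (B-* (Bz Fin.zero k) (Bz (Fin.suc s) (punchIn k l)))
            (B-* (B-neg B-1) (B-* (Bz (Fin.suc s) k) (Bz Fin.zero (punchIn k l))))
      c′ = proj₁ IH
      Bc′ = proj₁ (proj₂ IH)
      c′≉0 = proj₁ (proj₂ (proj₂ IH))
      rel′ = proj₂ (proj₂ (proj₂ IH))
      c : Fin (suc (suc d)) → Carrier
      -- Chosen so that, by `eliminate`, the combination of the given rows is the combination of the
      -- minors with coefficients `c′`.
      c Fin.zero    = n * sum (λ s → c′ s * zs (Fin.suc s) k)
      c (Fin.suc s) = p * c′ s
      Bc : ∀ s → B (c s)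
      Bc Fin.zero    = B-* (B-neg B-1) (B-sum _ λ s → B-* (Bc′ s) (Bz (Fin.suc s) k))
      Bc (Fin.suc s) = B-* (Bz Fin.zero k) (Bc′ s)
      c≉0 : ¬ (∀ s → c s ≈ 0#)
      c≉0 c≈0 = c′≉0 λ s → cancel p≉0 (c≈0 (Fin.suc s))
      minor-k : ∀ s → minor s k ≈ 0#
      minor-k s = begin
        p * zs (Fin.suc s) k + n * (zs (Fin.suc s) k * p)    ≈⟨ +-congˡ (≈-trans (-1*x≈-x _) (-‿cong (*-comm _ p))) ⟩
        p * zs (Fin.suc s) k + - (p * zs (Fin.suc s) k)      ≈⟨ -‿inverseʳ _ ⟩
        0#                                                   ∎
      minors : ∀ l → sum (λ s → c′ s * minor s l) ≈ 0#
      minors l with k ≟ᶠ l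
      ... | yes refl = sum-zero _ λ s → ≈-trans (*-congˡ {c′ s} (minor-k s)) (zeroʳ (c′ s))
      ... | no  k≢l  = subst (λ l → sum (λ s → c′ s * minor s l) ≈ 0#) (punchIn-punchOut k≢l) (rel′ (punchOut k≢l))
      relation : ∀ l → sum (λ s → c s * zs s l) ≈ 0#
      relation l = ≈-trans (eliminate p (zs Fin.zero l) c′ (λ s → zs (Fin.suc s) k) (λ s → zs (Fin.suc s) l)) (minors l)

-- Realising `Max(M)` inside a module over the larger ring.

record Extension a : Set (lsuc a) where
  field
    A B : CommutativeRing a a
    ι   : CommutativeRing.Carrier B → CommutativeRing.Carrier A
    isRingMonomorphism : IsRingMonomorphism (CommutativeRing.rawRing B) (CommutativeRing.rawRing A) ι
  module A = CommutativeRing A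
  module B = CommutativeRing B
  open IsRingMonomorphism isRingMonomorphism public
    renaming (⟦⟧-cong to ι-cong; +-homo to ι-+; *-homo to ι-*; 1#-homo to ι-1; 0#-homo to ι-0;
              injective to ι-injective; -‿homo to ι-neg)
    using ()

  restrict : LeftModule A.ring a a → LeftModule B.ring a a
  restrict V = record
    { Carrierᴹ = Carrierᴹ
    ; _≈ᴹ_     = _≈ᴹ_
    ; _+ᴹ_     = _+ᴹ_
    ; _*ₗ_     = λ s x → ι s *ₗ x
    ; 0ᴹ       = 0ᴹ
    ; -ᴹ_      = -ᴹ_
    ; isLeftModule = record
      { isLeftSemimodule = record
        { +ᴹ-isCommutativeMonoid = +ᴹ-isCommutativeMonoid
        ; isPreleftSemimodule = record
          { *ₗ-cong      = λ s≈t x≈y → *ₗ-cong (ι-cong s≈t) x≈y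
          ; *ₗ-zeroˡ     = λ x → ≈ᴹ-trans (*ₗ-cong ι-0 ≈ᴹ-refl) (*ₗ-zeroˡ x)
          ; *ₗ-distribʳ  = λ x s t → ≈ᴹ-trans (*ₗ-cong (ι-+ s t) ≈ᴹ-refl) (*ₗ-distribʳ x (ι s) (ι t))
          ; *ₗ-identityˡ = λ x → ≈ᴹ-trans (*ₗ-cong ι-1 ≈ᴹ-refl) (*ₗ-identityˡ x)
          ; *ₗ-assoc     = λ s t x → ≈ᴹ-trans (*ₗ-cong (ι-* s t) ≈ᴹ-refl) (*ₗ-assoc (ι s) (ι t) x)
          ; *ₗ-zeroʳ     = λ s → *ₗ-zeroʳ (ι s)
          ; *ₗ-distribˡ  = λ s → *ₗ-distribˡ (ι s)
          }
        }
      ; -ᴹ‿cong    = -ᴹ‿cong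
      ; -ᴹ‿inverse = -ᴹ‿inverse
      }
    }
    where open LeftModule V

module Realisation {a} (em : ∀ {ℓ} → ExcludedMiddle ℓ) (E : Extension a) where
  open Extension E
  open Modules B
  open FiniteLengths B

  -- Invertible in `A`, not in `B`: multiplication by such an element can be undone in `V`. Powers
  -- of `ϖ` are the case in view.
  Invertible : B.Carrier → Set a
  Invertible s = ∃ λ t → t A.* ι s A.≈ A.1#

  invertible-1 : Invertible B.1#
  invertible-1 = A.1# , A.trans (A.*-identityˡ _) ι-1

  invertible-* : ∀ {s t} → Invertible s → Invertible t → Invertible (s B.* t)
  invertible-* {s} {t} (s⁻¹ , s⁻¹s≈1) (t⁻¹ , t⁻¹t≈1) = t⁻¹ A.* s⁻¹ , (begin
    t⁻¹ A.* s⁻¹ A.* ι (s B.* t)      ≈⟨ A.*-congˡ (ι-* s t) ⟩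
    t⁻¹ A.* s⁻¹ A.* (ι s A.* ι t)    ≈⟨ A.*-assoc _ _ _ ⟩
    t⁻¹ A.* (s⁻¹ A.* (ι s A.* ι t))  ≈⟨ A.*-congˡ (A.*-assoc _ _ _) ⟨
    t⁻¹ A.* (s⁻¹ A.* ι s A.* ι t)    ≈⟨ A.*-congˡ (A.trans (A.*-congʳ s⁻¹s≈1) (A.*-identityˡ _)) ⟩
    t⁻¹ A.* ι t                      ≈⟨ t⁻¹t≈1 ⟩
    A.1#                             ∎)
    where open SetoidReasoning A.setoid

  module Swap (M : Mod) where
    open LeftModule M
    swap : ∀ s t x → s *ₗ (t *ₗ x) ≈ᴹ t *ₗ (s *ₗ x)
    swap s t x = ≈ᴹ-trans (≈ᴹ-sym (*ₗ-assoc s t x)) (≈ᴹ-trans (*ₗ-cong (B.*-comm s t) ≈ᴹ-refl) (*ₗ-assoc t s x))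

  -- X = Max(M) for M ⊂ V is realised inside V: x ∈ X corresponds to z ∈ V
  -- when s x and s z come from the same element of M, for some s that is
  -- invertible on V.
  module Image (1≉0 : ¬ (A.1# A.≈ A.0#)) (V : LeftModule A.ring a a)
           (V-torsionFree : TorsionFree (restrict V))
           {M X : Mod} (j : Hom M (restrict V))
           (j-injective : ∀ x → LeftModule._≈ᴹ_ V (Hom.⟦_⟧ j x) (LeftModule.0ᴹ V) →
                          LeftModule._≈ᴹ_ M x (LeftModule.0ᴹ M))
           (f : Hom M X) (max : IsMax M X f)
           (ϖ : B.Carrier) (ϖ-invertible : Invertible ϖ)
           (radical : ∀ c → ∃ λ e → e B.* (B.1# B.+ B.- (ϖ B.* c)) B.≈ B.1#) where
    private
      W = restrict V
      module M = LeftModule M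
      module X = LeftModule X
      module V = LeftModule V
      module W = LeftModule W
      module j = Hom j
      module f = Hom f
    open IsMax max

    torsion : ∀ {N} → FiniteLength N → ∀ x → ∃ λ t → Invertible t × LeftModule._≈ᴹ_ N (LeftModule._*ₗ_ N t x) (LeftModule.0ᴹ N)
    torsion = finiteLength-torsion radical {Invertible} invertible-1 (λ Tt → invertible-* Tt ϖ-invertible)

    V-cancel : ∀ {s} → Invertible s → ∀ {z} → s W.*ₗ z V.≈ᴹ V.0ᴹ → z V.≈ᴹ V.0ᴹ
    V-cancel {s} (t , ts≈1) {z} sz≈0 = begin
      z                     ≈⟨ V.*ₗ-identityˡ z ⟨
      A.1# V.*ₗ z           ≈⟨ V.*ₗ-cong ts≈1 V.≈ᴹ-refl ⟨
      (t A.* ι s) V.*ₗ z    ≈⟨ V.*ₗ-assoc t (ι s) z ⟩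
      t V.*ₗ (s W.*ₗ z)     ≈⟨ V.*ₗ-cong A.refl sz≈0 ⟩
      t V.*ₗ V.0ᴹ           ≈⟨ V.*ₗ-zeroʳ t ⟩
      V.0ᴹ                  ∎
      where open SetoidReasoning V.≈ᴹ-setoid

    X-cancel : ∀ {s} → Invertible s → ∀ {x} → s X.*ₗ x X.≈ᴹ X.0ᴹ → x X.≈ᴹ X.0ᴹ
    X-cancel {s} (t , ts≈1) {x} sx≈0 = [ (λ s≈0 → contradiction (1≈0 s≈0) 1≉0) , (λ x≈0 → x≈0) ]′ (torsionFree s x sx≈0)
      where
      1≈0 : s B.≈ B.0# → A.1# A.≈ A.0#
      1≈0 s≈0 = A.trans (A.sym ts≈1) (A.trans (A.*-congˡ (A.trans (ι-cong s≈0) ι-0)) (A.zeroʳ t))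

    -- The kernel of `f` has finite length, so its elements are killed by invertible scalars,
    -- whereas `M` embeds into `V`, where these act injectively.
    f-injective : ∀ x → f.⟦_⟧ x X.≈ᴹ X.0ᴹ → x M.≈ᴹ M.0ᴹ
    f-injective x fx≈0 = let (t , Tt , tx≈0) = torsion (proj₁ isQuasiIsomorphism) (x , fx≈0) in
      j-injective x (V-cancel Tt (V.≈ᴹ-trans (V.≈ᴹ-sym (j.*ₗ-homo t x)) (V.≈ᴹ-trans (j.⟦⟧-cong tx≈0) j.0ᴹ-homo)))

    infix 4 _~_
    record _~_ (x : X.Carrierᴹ) (z : V.Carrierᴹ) : Set a where
      constructor mk~
      field
        s     : B.Carrier
        p     : M.Carrierᴹ
        s-inv : Invertible s
        sx≈fp : s X.*ₗ x X.≈ᴹ f.⟦_⟧ p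
        sz≈jp : s W.*ₗ z V.≈ᴹ j.⟦_⟧ p

    ~-resp : ∀ {x y z w} → x X.≈ᴹ y → z V.≈ᴹ w → x ~ z → y ~ w
    ~-resp x≈y z≈w (mk~ s p T e₁ e₂) = mk~ s p T
      (X.≈ᴹ-trans (X.*ₗ-cong B.refl (X.≈ᴹ-sym x≈y)) e₁) (V.≈ᴹ-trans (V.*ₗ-cong A.refl (V.≈ᴹ-sym z≈w)) e₂)

    from-M : ∀ p → f.⟦_⟧ p ~ j.⟦_⟧ p
    from-M p = mk~ B.1# p invertible-1 (X.*ₗ-identityˡ _) (W.*ₗ-identityˡ _)

    private
      merge : ∀ (N : Mod) (let open LeftModule N) {s t x y x′ y′} → s *ₗ x ≈ᴹ x′ → t *ₗ y ≈ᴹ y′ →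
              (s B.* t) *ₗ (x +ᴹ y) ≈ᴹ t *ₗ x′ +ᴹ s *ₗ y′
      merge N {s} {t} {x} {y} {x′} {y′} e₁ e₂ = begin
        (s B.* t) *ₗ (x +ᴹ y)             ≈⟨ *ₗ-assoc s t _ ⟩
        s *ₗ (t *ₗ (x +ᴹ y))              ≈⟨ *ₗ-cong B.refl (*ₗ-distribˡ t x y) ⟩
        s *ₗ (t *ₗ x +ᴹ t *ₗ y)           ≈⟨ *ₗ-distribˡ s _ _ ⟩
        s *ₗ (t *ₗ x) +ᴹ s *ₗ (t *ₗ y)    ≈⟨ +ᴹ-cong (≈ᴹ-trans (Swap.swap N s t x) (*ₗ-cong B.refl e₁)) (*ₗ-cong B.refl e₂) ⟩
        t *ₗ x′ +ᴹ s *ₗ y′                ∎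
        where
        open LeftModule N
        open SetoidReasoning ≈ᴹ-setoid

      homo₂ : ∀ {N : Mod} (h : Hom M N) (let module N = LeftModule N) s t x y →
              Hom.⟦_⟧ h (s M.*ₗ x M.+ᴹ t M.*ₗ y) N.≈ᴹ s N.*ₗ Hom.⟦_⟧ h x N.+ᴹ t N.*ₗ Hom.⟦_⟧ h y
      homo₂ {N} h s t x y = N.≈ᴹ-trans (h.+ᴹ-homo _ _) (N.+ᴹ-cong (h.*ₗ-homo s x) (h.*ₗ-homo t y))
        where
        module h = Hom h
        module N = LeftModule N

    ~-+ : ∀ {x y z w} → x ~ z → y ~ w → x X.+ᴹ y ~ z V.+ᴹ w
    ~-+ (mk~ s p S e₁ e₂) (mk~ t q T e₃ e₄) = mk~ (s B.* t) (t M.*ₗ p M.+ᴹ s M.*ₗ q) (invertible-* S T)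
      (X.≈ᴹ-trans (merge X e₁ e₃) (X.≈ᴹ-sym (homo₂ f t s p q)))
      (V.≈ᴹ-trans (merge W e₂ e₄) (V.≈ᴹ-sym (homo₂ j t s p q)))

    ~-* : ∀ c {x z} → x ~ z → c X.*ₗ x ~ c W.*ₗ z
    ~-* c (mk~ s p S e₁ e₂) = mk~ s (c M.*ₗ p) S
      (X.≈ᴹ-trans (Swap.swap X s c _) (X.≈ᴹ-trans (X.*ₗ-cong B.refl e₁) (X.≈ᴹ-sym (f.*ₗ-homo c p))))
      (V.≈ᴹ-trans (Swap.swap W s c _) (V.≈ᴹ-trans (V.*ₗ-cong A.refl e₂) (V.≈ᴹ-sym (j.*ₗ-homo c p))))

    ~-0 : X.0ᴹ ~ V.0ᴹ
    ~-0 = ~-resp f.0ᴹ-homo j.0ᴹ-homo (from-M M.0ᴹ)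

    ~-zero⇒ : ∀ {x z} → x ~ z → x X.≈ᴹ X.0ᴹ → z V.≈ᴹ V.0ᴹ
    ~-zero⇒ (mk~ s p S e₁ e₂) x≈0 = V-cancel S (V.≈ᴹ-trans e₂ (V.≈ᴹ-trans (j.⟦⟧-cong p≈0) j.0ᴹ-homo))
      where
      p≈0 : p M.≈ᴹ M.0ᴹ
      p≈0 = f-injective p (X.≈ᴹ-trans (X.≈ᴹ-sym e₁) (X.≈ᴹ-trans (X.*ₗ-cong B.refl x≈0) (X.*ₗ-zeroʳ s)))

    ~-zero⇐ : ∀ {x z} → x ~ z → z V.≈ᴹ V.0ᴹ → x X.≈ᴹ X.0ᴹ
    ~-zero⇐ (mk~ s p S e₁ e₂) z≈0 = X-cancel S (X.≈ᴹ-trans e₁ (X.≈ᴹ-trans (f.⟦⟧-cong p≈0) f.0ᴹ-homo))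
      where
      p≈0 : p M.≈ᴹ M.0ᴹ
      p≈0 = j-injective p (V.≈ᴹ-trans (V.≈ᴹ-sym e₂) (V.≈ᴹ-trans (V.*ₗ-cong A.refl z≈0) (V.*ₗ-zeroʳ _)))

    -- The cokernel of `f` is killed elementwise by invertible scalars, so `s x = f p` for some such
    -- `s`; the partner of `x` is `s⁻¹ (j p)`.
    ~-total : ∀ x → ∃ λ z → x ~ z
    ~-total x = let (s , S , p , fp≈) = torsion (proj₂ isQuasiIsomorphism) x in
      proj₁ S V.*ₗ j.⟦_⟧ p , mk~ s p S (X.≈ᴹ-sym (X.≈ᴹ-trans fp≈ (x-0≈x X _))) (begin
        ι s V.*ₗ (proj₁ S V.*ₗ j.⟦_⟧ p)    ≈⟨ V.*ₗ-assoc _ _ _ ⟨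
        (ι s A.* proj₁ S) V.*ₗ j.⟦_⟧ p     ≈⟨ V.*ₗ-cong (A.trans (A.*-comm _ _) (proj₂ S)) V.≈ᴹ-refl ⟩
        A.1# V.*ₗ j.⟦_⟧ p                  ≈⟨ V.*ₗ-identityˡ _ ⟩
        j.⟦_⟧ p                            ∎)
      where open SetoidReasoning V.≈ᴹ-setoid

    realisation : Submodule W
    realisation = record
      { _∈N    = λ z → ∃ λ x → x ~ z
      ; ∈-resp = λ z≈w (x , x~z) → x , ~-resp X.≈ᴹ-refl z≈w x~z
      ; 0∈N    = X.0ᴹ , ~-0
      ; +∈N    = λ (x , p) (y , q) → x X.+ᴹ y , ~-+ p q
      ; *∈N    = λ c (x , p) → c X.*ₗ x , ~-* c p
      }
    open Submodule realisation public using ()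
      renaming (_∈N to P; ∈-resp to P-resp; 0∈N to P-0; +∈N to P-+; *∈N to P-*)

    X≅P : X ≅ ⌊ realisation ⌋
    X≅P = record
      { _~_   = λ x z → x ~ proj₁ z
      ; ~-+   = λ p q → ~-+ p q
      ; ~-*   = λ c p → ~-* c p
      ; ~-0   = ~-0
      ; total = λ x → let (z , x~z) = ~-total x in (z , x , x~z) , x~z
      ; onto  = λ (z , x , x~z) → x , x~z
      ; zero⇒ = λ p → ~-zero⇒ p
      ; zero⇐ = λ p → ~-zero⇐ p
      }

    ~-functionalᵛ : ∀ {x x′ z z′} → x ~ z → x′ ~ z′ → x X.≈ᴹ x′ → z V.≈ᴹ z′
    ~-functionalᵛ {x} {x′} {z} {z′} p q = ~-functional X≅P {x} {x′} {z , x , p} {z′ , x′ , q} p q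

    ~-sumᵛ : ∀ {k} (c : Fin k → B.Carrier) {g : Fin k → X.Carrierᴹ} {h : Fin k → V.Carrierᴹ} → (∀ i → g i ~ h i) →
             MonoidSum.sum X.+ᴹ-monoid (λ i → c i X.*ₗ g i) ~ MonoidSum.sum V.+ᴹ-monoid (λ i → c i W.*ₗ h i)
    ~-sumᵛ {zero}  c p = ~-0
    ~-sumᵛ {suc k} c p = ~-+ (~-* _ (p Fin.zero)) (~-sumᵛ (c ∘ Fin.suc) (p ∘ Fin.suc))

    -- P contains every w with 𝔪 w ⊂ P: otherwise P + B w would be a module
    -- quasi-isomorphic to M that does not map to X.
    module Socle (𝔪 : B.Carrier → Set) (ϖ∈𝔪 : 𝔪 ϖ) (local : ∀ c → (∃ λ e → e B.* c B.≈ B.1#) ⊎ 𝔪 c)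
                 (w : V.Carrierᴹ) (𝔪w⊆P : ∀ c → 𝔪 c → P (c W.*ₗ w)) where

      open CommutativeSemigroupProperties
        (CommutativeMonoid.commutativeSemigroup V.+ᴹ-commutativeMonoid) using (interchange)
      open SetoidReasoning V.≈ᴹ-setoid

      P+Bw : Submodule W
      P+Bw = record
        { _∈N    = λ z → ∃₂ λ c q → P q × z V.≈ᴹ c W.*ₗ w V.+ᴹ q
        ; ∈-resp = λ y≈z (c , q , q∈ , y≈) → c , q , q∈ , V.≈ᴹ-trans (V.≈ᴹ-sym y≈z) y≈
        ; 0∈N    = B.0# , V.0ᴹ , P-0 , V.≈ᴹ-sym (V.≈ᴹ-trans (V.+ᴹ-identityʳ _) (W.*ₗ-zeroˡ w))
        ; +∈N    = λ (c , q , q∈ , y≈) (d , r , r∈ , z≈) → c B.+ d , q V.+ᴹ r , P-+ q∈ r∈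
                   , V.≈ᴹ-trans (V.+ᴹ-cong y≈ z≈) (V.≈ᴹ-trans (interchange _ _ _ _) (V.+ᴹ-congʳ (V.≈ᴹ-sym (W.*ₗ-distribʳ w c d))))
        ; *∈N    = λ e (c , q , q∈ , y≈) → e B.* c , e W.*ₗ q , P-* e q∈
                   , V.≈ᴹ-trans (V.*ₗ-cong A.refl y≈) (V.≈ᴹ-trans (V.*ₗ-distribˡ _ _ _) (V.+ᴹ-congʳ (V.≈ᴹ-sym (W.*ₗ-assoc e c w))))
        }

      N = ⌊ P+Bw ⌋
      module N = LeftModule N

      P⊆N : ∀ {z} → P z → Submodule._∈N P+Bw z
      P⊆N {z} z∈ = B.0# , z , z∈ , V.≈ᴹ-sym (V.≈ᴹ-trans (V.+ᴹ-congʳ (W.*ₗ-zeroˡ w)) (V.+ᴹ-identityˡ z))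

      ŵ : N.Carrierᴹ
      ŵ = w , B.1# , V.0ᴹ , P-0 , V.≈ᴹ-sym (V.≈ᴹ-trans (V.+ᴹ-identityʳ _) (W.*ₗ-identityˡ w))

      f′ : Hom M N
      f′ = record
        { ⟦_⟧   = λ p → j.⟦_⟧ p , P⊆N (f.⟦_⟧ p , from-M p)
        ; isHom = record
          { +ᴹ-isGroupHomomorphism = record
            { isMonoidHomomorphism = record
              { isMagmaHomomorphism = record
                { isRelHomomorphism = record { cong = j.⟦⟧-cong }
                ; homo = j.+ᴹ-homo
                }
              ; ε-homo = j.0ᴹ-homo
              }
            ; ⁻¹-homo = j.-ᴹ-homo
            }
          ; *ₗ-homo = j.*ₗ-homo
          }
        }

      Q : Submodule N
      Q = record
        { _∈N    = λ t → P (proj₁ t)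
        ; ∈-resp = λ y≈z y∈ → P-resp y≈z y∈
        ; 0∈N    = P-0
        ; +∈N    = λ p q → P-+ p q
        ; *∈N    = λ c p → P-* c p
        }

      X≅Q : X ≅ ⌊ Q ⌋
      X≅Q = record
        { _~_   = λ x t → x ~ proj₁ (proj₁ t)
        ; ~-+   = λ p q → ~-+ p q
        ; ~-*   = λ c p → ~-* c p
        ; ~-0   = ~-0
        ; total = λ x → let (z , x~z) = ~-total x in ((z , P⊆N (x , x~z)) , x , x~z) , x~z
        ; onto  = λ (t , x , x~z) → x , x~z
        ; zero⇒ = λ p → ~-zero⇒ p
        ; zero⇐ = λ p → ~-zero⇐ p
        }

      N-sum : ∀ {k} (t : Fin k → N.Carrierᴹ) → proj₁ (MonoidSum.sum N.+ᴹ-monoid t) V.≈ᴹ MonoidSum.sum V.+ᴹ-monoid (proj₁ ∘ t)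
      N-sum {zero}  t = V.≈ᴹ-refl
      N-sum {suc k} t = V.+ᴹ-congˡ (N-sum (t ∘ Fin.suc))

      N-finitelyGenerated : FinitelyGenerated N
      N-finitelyGenerated = let (k , h , generates) = finitelyGenerated in suc k , gens h , λ (z , c , q , (x , x~q) , z≈) →
        let (cs , x≈) = generates x in coeffs c cs , (begin
          z                                       ≈⟨ z≈ ⟩
          c W.*ₗ w V.+ᴹ q                         ≈⟨ V.+ᴹ-congˡ (~-functionalᵛ x~q (~-sumᵛ cs (λ i → proj₂ (~-total (h i)))) x≈) ⟩
          c W.*ₗ w V.+ᴹ MonoidSum.sum V.+ᴹ-monoid (λ i → cs i W.*ₗ proj₁ (~-total (h i)))
                                                  ≈⟨ V.+ᴹ-congˡ (N-sum (λ i → cs i N.*ₗ gens h (Fin.suc i))) ⟨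
          c W.*ₗ w V.+ᴹ proj₁ (MonoidSum.sum N.+ᴹ-monoid (λ i → cs i N.*ₗ gens h (Fin.suc i))) ∎)
        where
        gens : ∀ {k} → (Fin k → X.Carrierᴹ) → Fin (suc k) → N.Carrierᴹ
        gens h Fin.zero    = ŵ
        gens h (Fin.suc i) = proj₁ (~-total (h i)) , P⊆N (h i , proj₂ (~-total (h i)))
        coeffs : ∀ {k} → B.Carrier → (Fin k → B.Carrier) → Fin (suc k) → B.Carrier
        coeffs c cs Fin.zero    = c
        coeffs c cs (Fin.suc i) = cs i

      back : ¬ P w → ∃ λ (g : Hom N X) → ∀ p → Hom.⟦_⟧ g (Hom.⟦_⟧ f′ p) X.≈ᴹ f.⟦_⟧ p
      back w∉P = retraction em {𝔪} local max f′ Q X≅Q (λ p → (f.⟦_⟧ p , from-M p) , from-M p) j-injective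
        ŵ w∉P 𝔪w⊆P (λ (z , c , q , q∈P , z≈) → c , (q , P⊆N q∈P) , q∈P , z≈)
        N-finitelyGenerated (λ s (z , _) → V-torsionFree s z)

      -- The element of `X` paired with `w` is its image under `g`: a multiple `s ϖ w` equals some
      -- `j p`, and since `g` is compatible with the maps from `M`, the same multiple of `g ŵ` is
      -- `f p`.
      escape : ¬ P w → P w
      escape w∉P = Hom.⟦_⟧ g ŵ , mk~ (s B.* ϖ) p (invertible-* s-inv ϖ-invertible)
          (X.≈ᴹ-trans (X.≈ᴹ-sym (Hom.*ₗ-homo g _ ŵ)) (X.≈ᴹ-trans (Hom.⟦⟧-cong g sϖ*w≈) (proj₂ (back w∉P) p)))
          sϖ*w≈
        where
        g = proj₁ (back w∉P)
        open _~_ (proj₂ (𝔪w⊆P ϖ ϖ∈𝔪)) using (s; p; s-inv; sz≈jp)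
        sϖ*w≈ : (s B.* ϖ) W.*ₗ w V.≈ᴹ j.⟦_⟧ p
        sϖ*w≈ = V.≈ᴹ-trans (W.*ₗ-assoc s ϖ w) sz≈jp

      w∈P : P w
      w∈P = decidable-stable em λ w∉P → w∉P (escape w∉P)

-- From the maximal ideal to `ϖ` and `η`.

module Descent {a} (em : ∀ {ℓ} → ExcludedMiddle ℓ) {D : CompleteDVR a} {α-1 : ℕ} {β : ℤ}
               (S : SeriesRing D α-1 β) where
  open SeriesRing S hiding (A)
  open Weights D α-1
  open Saturated em S

  module _ (V : LeftModule A.ring a a)
           {P : Pred (LeftModule.Carrierᴹ V) a} (P-sub : Spans.IsSub {A = A} V (F 0ℤ) P)
           (socle : ∀ w → (∀ c → F 0ℤ c → Wt 1ℤ (coeff 0 c) → P (LeftModule._*ₗ_ V c w)) → P w) where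
    open LeftModule V
    open Spans {A = A} V (F 0ℤ)
    open IsSub P-sub
    open SetoidReasoning ≈ᴹ-setoid

    -- If z ∉ P, some w = uᵠ c z ∉ P has 𝔪 w ⊂ P: take (p , q) maximal with
    -- uᵠ F(p - β q) z ⊄ P.
    saturated : ∀ {z} → P (ϖ *ₗ z) → P (η *ₗ z) → P z
    saturated {z} ϖz∈P ηz∈P = decidable-stable em λ z∉P →
      let (p , q , ¬In-pq , In-p , In-q) = search (suc α-1 ℕ.+ suc α-1) 0 0 ℕ.≤-refl (¬In-00 z∉P)
      in ¬In-pq λ c Fc → socle _ (𝔪w⊆P p q In-p In-q c Fc)
      where
      -- The scalars involved are the series of weight at least `p` that are divisible by `uᵠ`.
      In : ℕ → ℕ → Set a
      In p q = ∀ c → F (+ p ℤ.- β ℤ.* + q) c → P ((mono q K.1# A.* c) *ₗ z)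

      ¬In-00 : ¬ P z → ¬ In 0 0
      ¬In-00 z∉P In-00 = z∉P (resp (≈ᴹ-trans (*ₗ-cong (A.trans (A.*-identityʳ _) mono-1) ≈ᴹ-refl) (*ₗ-identityˡ z))
        (In-00 A.1# (subst (λ j → F j A.1#) (lem β) F-1)))
        where
        lem : ∀ β → 0ℤ ≡ 0ℤ ℤ.- β ℤ.* 0ℤ
        lem = ℤ-Solver.solve-∀

      factor : ∀ i k x y c → x K.* y K.≈ K.1# →
               (mono k y A.* c) *ₗ (mono i x *ₗ z) ≈ᴹ (mono (i ℕ.+ k) K.1# A.* c) *ₗ z
      factor i k x y c xy≈1 = begin
        (mono k y A.* c) *ₗ (mono i x *ₗ z)    ≈⟨ *ₗ-assoc _ _ _ ⟨
        (mono k y A.* c A.* mono i x) *ₗ z     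
          ≈⟨ *ₗ-cong (A.trans (A.*-comm _ (mono i x)) (A.sym (A.*-assoc _ _ c))) ≈ᴹ-refl ⟩
        (mono i x A.* mono k y A.* c) *ₗ z
          ≈⟨ *ₗ-cong (A.*-congʳ (A.trans (mono-* i k x y) (mono-cong (i ℕ.+ k) xy≈1))) ≈ᴹ-refl ⟩
        (mono (i ℕ.+ k) K.1# A.* c) *ₗ z       ∎

      In-ϖ : ∀ p q → suc α-1 ℕ.≤ p → In p q
      In-ϖ p q α≤p c Fc = let (y , xy≈1 , vy) = invert (v-ϖ 1ℤ) in
        resp (factor 0 q ϖ⟨ 1ℤ ⟩ y c xy≈1) (*∈ (F-mono bound (F-* (mono-F {j = α ℤ.* ℤ.- 1ℤ ℤ.+ β ℤ.* + q} q
          (subst (λ k → Wt k y) (lem₁ α β (+ q)) (wt-exact vy))) Fc)) ϖz∈P)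
        where
        lem₁ : ∀ α β q → α ℤ.* ℤ.- 1ℤ ≡ α ℤ.* ℤ.- 1ℤ ℤ.+ β ℤ.* q ℤ.- β ℤ.* q
        lem₁ = ℤ-Solver.solve-∀
        bound : 0ℤ ℤ.≤ α ℤ.* ℤ.- 1ℤ ℤ.+ β ℤ.* + q ℤ.+ (+ p ℤ.- β ℤ.* + q)
        bound = subst (0ℤ ℤ.≤_) (lem α β (+ p) (+ q)) (ℤ.i≤j⇒0≤j-i (ℤ.+≤+ α≤p))
          where
          lem : ∀ α β p q → p ℤ.- α ≡ α ℤ.* ℤ.- 1ℤ ℤ.+ β ℤ.* q ℤ.+ (p ℤ.- β ℤ.* q)
          lem = ℤ-Solver.solve-∀

      In-η : ∀ p k → In p (suc α-1 ℕ.+ k)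
      In-η p k c Fc = let (y , xy≈1 , vy) = invert (v-ϖ (ℤ.- β)) in
        resp (factor (suc α-1) k ϖ⟨ ℤ.- β ⟩ y c xy≈1) (*∈ (F-mono bound (F-* (mono-F {j = α ℤ.* ℤ.- (ℤ.- β) ℤ.+ β ℤ.* + k} k
          (subst (λ k → Wt k y) (lem₁ (α ℤ.* ℤ.- (ℤ.- β)) β (+ k)) (wt-exact vy))) Fc)) ηz∈P)
        where
        lem₁ : ∀ j β k → j ≡ j ℤ.+ β ℤ.* k ℤ.- β ℤ.* k
        lem₁ = ℤ-Solver.solve-∀
        bound : 0ℤ ℤ.≤ α ℤ.* ℤ.- (ℤ.- β) ℤ.+ β ℤ.* + k ℤ.+ (+ p ℤ.- β ℤ.* + (suc α-1 ℕ.+ k))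
        bound = subst (0ℤ ℤ.≤_) (≡.trans (lem α β (+ p) (+ k))
                  (cong (λ q → α ℤ.* ℤ.- (ℤ.- β) ℤ.+ β ℤ.* + k ℤ.+ (+ p ℤ.- β ℤ.* q)) (≡.sym (ℤ.pos-+ (suc α-1) k))))
                  (ℤ.+≤+ {0} {p} ℕ.z≤n)
          where
          lem : ∀ α β p k → p ≡ α ℤ.* ℤ.- (ℤ.- β) ℤ.+ β ℤ.* k ℤ.+ (p ℤ.- β ℤ.* (α ℤ.+ k))
          lem = ℤ-Solver.solve-∀

      Maximal : Set a
      Maximal = ∃₂ λ p q → ¬ In p q × In (suc p) q × In p (suc q)

      -- `In p q` holds as soon as `p ≥ α`, through `ϖ z`, or `q ≥ α`, through `η z`. A climb
      -- through failing pairs therefore ends before `p + q` reaches `2 α`.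
      search : ∀ N p q → suc α-1 ℕ.+ suc α-1 ℕ.≤ p ℕ.+ q ℕ.+ N → ¬ In p q → Maximal
      search zero p q 2α≤ ¬In = contradiction In-pq ¬In
        where
        In-pq : In p q
        In-pq = [ In-ϖ p q , (λ α≤q → subst (In p) (ℕ.m+[n∸m]≡n α≤q) (In-η p (q ∸ suc α-1))) ]′
          (halves (ℕ.≤-trans 2α≤ (ℕ.≤-reflexive (ℕ.+-identityʳ (p ℕ.+ q)))))
      search (suc N) p q 2α≤ ¬In = step em em
        where
        step : Dec (In (suc p) q) → Dec (In p (suc q)) → Maximal
        step (yes In-p) (yes In-q) = p , q , ¬In , In-p , In-q
        step (no ¬In-p) _          = search N (suc p) q (ℕ.≤-trans 2α≤ (ℕ.≤-reflexive (ℕ.+-suc (p ℕ.+ q) N))) ¬In-p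
        step (yes _)    (no ¬In-q) = search N p (suc q) (ℕ.≤-trans 2α≤ (ℕ.≤-reflexive
          (≡.trans (ℕ.+-suc (p ℕ.+ q) N) (cong (ℕ._+ N) (≡.sym (ℕ.+-suc p q)))))) ¬In-q

      -- Split `s = s₀ + u s₁`. The constant `s₀` has positive weight and raises `p`, the factor `u`
      -- raises `q`, and both raised pairs satisfy `In`.
      𝔪w⊆P : ∀ p q → In (suc p) q → In p (suc q) → ∀ c → F (+ p ℤ.- β ℤ.* + q) c →
             ∀ s → F 0ℤ s → Wt 1ℤ (coeff 0 s) → P (s *ₗ ((mono q K.1# A.* c) *ₗ z))
      𝔪w⊆P p q In-p In-q c Fc s Fs Ws = resp (≈ᴹ-sym expand)
        (+∈ (In-p (const (coeff 0 s) A.* c) (subst (λ j → F j _) (lem₁ (+ p) β (+ q)) (F-* (const-F Ws) Fc)))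
            (In-q (tail s A.* c) (subst (λ j → F j _) (lem₂ (+ p) β (+ q)) (F-* (tail-F Fs) Fc))))
        where
        lem₁ : ∀ p β q → 1ℤ ℤ.+ (p ℤ.- β ℤ.* q) ≡ 1ℤ ℤ.+ p ℤ.- β ℤ.* q
        lem₁ = ℤ-Solver.solve-∀
        lem₂ : ∀ p β q → 0ℤ ℤ.- β ℤ.+ (p ℤ.- β ℤ.* q) ≡ p ℤ.- β ℤ.* (1ℤ ℤ.+ q)
        lem₂ = ℤ-Solver.solve-∀
        U = mono q K.1#
        s₀ = const (coeff 0 s)
        s₁ = tail s
        swap : ∀ r → r A.* (U A.* c) A.≈ U A.* (r A.* c)
        swap r = A.trans (A.sym (A.*-assoc r U c)) (A.trans (A.*-congʳ (A.*-comm r U)) (A.*-assoc U r c))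
        uU≈ : u A.* U A.≈ mono (suc q) K.1#
        uU≈ = A.trans (mono-* 1 q K.1# K.1#) (mono-cong (suc q) (K.*-identityˡ K.1#))
        ring-identity : s A.* (U A.* c) A.≈ U A.* (s₀ A.* c) A.+ mono (suc q) K.1# A.* (s₁ A.* c)
        ring-identity = A.trans (A.*-congʳ (head+tail s)) (A.trans (A.distribʳ _ _ _) (A.+-cong (swap s₀)
          (A.trans (A.*-assoc u s₁ _) (A.trans (A.*-congˡ (swap s₁)) (A.trans (A.sym (A.*-assoc u U _)) (A.*-congʳ uU≈))))))
        expand : s *ₗ ((U A.* c) *ₗ z) ≈ᴹ (U A.* (s₀ A.* c)) *ₗ z +ᴹ (mono (suc q) K.1# A.* (s₁ A.* c)) *ₗ z
        expand = ≈ᴹ-trans (≈ᴹ-sym (*ₗ-assoc s _ z)) (≈ᴹ-trans (*ₗ-cong ring-identity ≈ᴹ-refl) (*ₗ-distribʳ z _ _))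

-- Counting generators of `Max(M)` over the abstract series ring.

module MaxGenerators {a} (em : ∀ {ℓ} → ExcludedMiddle ℓ) {D : CompleteDVR a} {α-1 : ℕ} {β : ℤ}
    (S : SeriesRing D α-1 β) {B : CommutativeRing a a}
    {ι : CommutativeRing.Carrier B → CommutativeRing.Carrier (SeriesRing.A S)}
    (ι-mono : IsRingMonomorphism (CommutativeRing.rawRing B) (CommutativeRing.rawRing (SeriesRing.A S)) ι)
    (ι-F : ∀ s → SeriesRing.F S 0ℤ (ι s))
    (lift : ∀ {f} → SeriesRing.F S 0ℤ f → ∃ λ s → CommutativeRing._≈_ (SeriesRing.A S) (ι s) f) where

  E : Extension a
  E = record { A = SeriesRing.A S ; B = B ; ι = ι ; isRingMonomorphism = ι-mono }

  open SeriesRing S hiding (A)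
  open Weights D α-1
  open Saturated em S using (const; const-F; ϖ-F; head-Wt; F₀-sub)
  open Extension E hiding (B; module B; ι)
  private module B = CommutativeRing B
  open Modules B
  open FiniteLengths B
  open Realisation em E

  ϖ-F₀ : F 0ℤ ϖ
  ϖ-F₀ = F-mono (ℤ.+≤+ ℕ.z≤n) ϖ-F

  π : B.Carrier
  π = proj₁ (lift ϖ-F₀)

  ιπ≈ϖ : ι π A.≈ ϖ
  ιπ≈ϖ = proj₂ (lift ϖ-F₀)

  const-invertible : ∀ m → ∃ λ t → t A.* const ϖ⟨ m ⟩ A.≈ A.1#
  const-invertible m = let (y , xy≈1 , _) = invert (v-ϖ m) in
    const y , A.trans (mono-* 0 0 y ϖ⟨ m ⟩) (A.trans (mono-cong 0 (K.trans (K.*-comm y _) xy≈1)) mono-1)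

  π-invertible : Invertible π
  π-invertible = let (t , tϖ≈1) = const-invertible 1ℤ in t , A.trans (A.*-congˡ ιπ≈ϖ) tϖ≈1

  lift-inverse : ∀ {e} → F 0ℤ e → ∀ c → e A.* ι c A.≈ A.1# → ∃ λ e → e B.* c B.≈ B.1#
  lift-inverse Fe c ec≈1 = let (e′ , ιe′≈e) = lift Fe in
    e′ , ι-injective (A.trans (ι-* e′ c) (A.trans (A.*-congʳ ιe′≈e) (A.trans ec≈1 (A.sym ι-1))))

  radical : ∀ c → ∃ λ e → e B.* (B.1# B.+ B.- (π B.* c)) B.≈ B.1#
  -- The case `g = 0` of `unit`, read in `B`: `π` lies in the Jacobson radical.
  radical c = let (e , Fe , e*≈1) = unit (ι-F c) F-0 in
    lift-inverse Fe (B.1# B.+ B.- (π B.* c)) (A.trans (A.*-congˡ step) e*≈1)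
    where
    step : ι (B.1# B.+ B.- (π B.* c)) A.≈ A.1# A.+ A.- (ϖ A.* ι c A.+ η A.* A.0#)
    step = A.trans (ι-+ _ _) (A.+-cong ι-1 (A.trans (ι-neg _) (A.-‿cong (A.trans (ι-* π c) (A.trans (A.*-congʳ ιπ≈ϖ)
      (A.sym (A.trans (A.+-congˡ (A.zeroʳ η)) (A.+-identityʳ _))))))))

  𝔪 : B.Carrier → Set
  𝔪 c = Wt 1ℤ (coeff 0 (ι c))

  π∈𝔪 : 𝔪 π
  π∈𝔪 = wt-mono (ℤ.+≤+ (ℕ.s≤s ℕ.z≤n)) (head-Wt (F-resp (A.sym ιπ≈ϖ) ϖ-F))

  𝔪-local : ∀ c → (∃ λ e → e B.* c B.≈ B.1#) ⊎ 𝔪 c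
  𝔪-local c = [ (λ (e , Fe , ec≈1) → inj₁ (lift-inverse Fe c ec≈1)) , inj₂ ]′ (local (ι-F c))

  module _ (1≉0 : ¬ (A.1# A.≈ A.0#)) (V : LeftModule A.ring a a)
           (V-torsionFree : TorsionFree (restrict V))
           {M X : Mod} (j : Hom M (restrict V))
           (j-injective : ∀ x → LeftModule._≈ᴹ_ V (Hom.⟦_⟧ j x) (LeftModule.0ᴹ V) →
                          LeftModule._≈ᴹ_ M x (LeftModule.0ᴹ M))
           (f : Hom M X) (max : IsMax M X f) where
    private
      W = restrict V
      module X = LeftModule X
      module V = LeftModule V
      module W = LeftModule W
    open Image 1≉0 V V-torsionFree j j-injective f max π π-invertible radical
    open Spans {A = A} V (F 0ℤ)
    open IsMax max using (finitelyGenerated)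

    P-sub : IsSub P
    P-sub = record
      { resp = P-resp
      ; 0∈   = P-0
      ; +∈   = P-+
      ; *∈   = λ Fc z∈P → let (s , ιs≈c) = lift Fc in P-resp (V.*ₗ-cong ιs≈c V.≈ᴹ-refl) (P-* s z∈P)
      }

    socle : ∀ w → (∀ c → F 0ℤ c → Wt 1ℤ (coeff 0 c) → P (c V.*ₗ w)) → P w
    socle w 𝔪w⊆P = Socle.w∈P 𝔪 π∈𝔪 𝔪-local w λ c c∈𝔪 → 𝔪w⊆P (ι c) (ι-F c) c∈𝔪

    P-saturated : ∀ {z} → P (ϖ V.*ₗ z) → P (η V.*ₗ z) → P z
    P-saturated = Descent.saturated em S V P-sub socle

    open Saturated.Graded em S V P-sub P-saturated using (lin) public renaming (X to Xᵍ)
    open SpanProperties {A = A} V F₀-sub using (Zero-isSub; span-isSub)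

    -- ϖⁿ X j ⊂ P, and every element of P has a multiple in M.
    X-bounded : ∀ {k z} → Xᵍ k z → ∃₂ λ t p → F 0ℤ t × (∃ λ t⁻¹ → t⁻¹ A.* t A.≈ A.1#) × t V.*ₗ z V.≈ᴹ Hom.⟦_⟧ j p
    X-bounded {k} {z} Xz = ι s A.* c , p , F-* (ι-F s) Fc , inverse , V.≈ᴹ-trans (V.*ₗ-assoc _ _ _) sz≈jp
      where
      n = + ℤ.∣ k ∣
      c = const ϖ⟨ n ⟩
      Fc : F 0ℤ c
      Fc = const-F (wt-mono (subst (ℤ._≤ α ℤ.* n) (ℤ.*-zeroʳ α) (ℤ.*-monoˡ-≤-nonNeg α (ℤ.+≤+ ℕ.z≤n))) (wt-exact (v-ϖ n)))
      bound : ℤ.- k ℤ.≤ α ℤ.* n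
      bound = ℤ.≤-trans (-k≤∣k∣ k) (subst (ℤ._≤ α ℤ.* n) (ℤ.*-identityˡ n) (ℤ.*-monoʳ-≤-nonNeg n {1ℤ} {α} (ℤ.+≤+ (ℕ.s≤s ℕ.z≤n))))
        where
        -k≤∣k∣ : ∀ k → ℤ.- k ℤ.≤ + ℤ.∣ k ∣
        -k≤∣k∣ (+ zero)      = ℤ.≤-refl
        -k≤∣k∣ (+ suc n)     = ℤ.-≤+
        -k≤∣k∣ ℤ.-[1+ n ]    = ℤ.≤-refl
      open _~_ (proj₂ (Xᵍ.multiples Xz c (F-mono bound (const-F (wt-exact (v-ϖ n)))))) using (s; p; s-inv; sz≈jp)
      inverse : ∃ λ t⁻¹ → t⁻¹ A.* (ι s A.* c) A.≈ A.1#
      inverse = let (s⁻¹ , s⁻¹s≈1) = s-inv ; (c⁻¹ , c⁻¹c≈1) = const-invertible n in c⁻¹ A.* s⁻¹ ,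
        A.trans (A.*-assoc _ _ _) (A.trans (A.*-congˡ (A.trans (A.sym (A.*-assoc _ _ _))
          (A.trans (A.*-congʳ s⁻¹s≈1) (A.*-identityˡ c)))) c⁻¹c≈1)

    P-finitelyGenerated : ∃ λ xs → All P xs × (∀ {z} → P z → (Zero ⟨ xs ⟩) z)
    P-finitelyGenerated = let (k , h , generates) = finitelyGenerated in
      tabulate (λ i → proj₁ (~-total (h i))) , All.tabulate⁺ (λ i → h i , proj₂ (~-total (h i))) ,
      λ (x , x~z) → let (cs , x≈) = generates x in
        IsSub.resp (span-isSub Zero-isSub (tabulate (λ i → proj₁ (~-total (h i)))))
          (~-functionalᵛ (~-sumᵛ cs (λ i → proj₂ (~-total (h i)))) x~z (X.≈ᴹ-sym x≈))
          (combination cs (λ i → proj₁ (~-total (h i))))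
      where
      combination : ∀ {k} (cs : Fin k → B.Carrier) (zs : Fin k → V.Carrierᴹ) →
                    (Zero ⟨ tabulate zs ⟩) (MonoidSum.sum V.+ᴹ-monoid (λ i → cs i W.*ₗ zs i))
      combination {zero}  cs zs = V.≈ᴹ-refl
      combination {suc k} cs zs = ι (cs Fin.zero) , _ , ι-F _ , combination (cs ∘ Fin.suc) (zs ∘ Fin.suc) , V.≈ᴹ-refl

    -- Generation is carried from `P` back to `X` along the correspondence: subtracting from `x` the
    -- first multiple leaves an element paired with the rest of the combination, down to 0.
    generatedBy : ∀ gs → All P gs → (∀ {z} → P z → (Zero ⟨ gs ⟩) z) → GeneratedBy X (length gs)
    generatedBy gs gs∈P P⊆gs = h gs gs∈P , λ x → let (z , x~z) = ~-total x in go gs gs∈P (P⊆gs (x , x~z)) x~z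
      where
      h : ∀ gs → All P gs → Fin (length gs) → X.Carrierᴹ
      h (g ∷ gs) ((x , _) ∷ _) Fin.zero    = x
      h (g ∷ gs) (_ ∷ gs∈P)    (Fin.suc i) = h gs gs∈P i
      go : ∀ gs gs∈P {x z} → (Zero ⟨ gs ⟩) z → x ~ z →
           ∃ λ (c : Fin (length gs) → B.Carrier) → x X.≈ᴹ MonoidSum.sum X.+ᴹ-monoid (λ i → c i X.*ₗ h gs gs∈P i)
      go [] [] z≈0 x~z = (λ ()) , ~-zero⇐ x~z z≈0
      go (g ∷ gs) ((y , y~g) ∷ gs∈P) {x} {z} (c , q , Fc , q∈ , z≈) x~z =
        let (s , ιs≈c) = lift Fc
            (cs , x-sy≈) = go gs gs∈P q∈ (rest~q s ιs≈c)
        in s ◂ cs , X.≈ᴹ-trans (restore s) (X.+ᴹ-congˡ x-sy≈)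
        where
        rest : B.Carrier → X.Carrierᴹ
        rest s = (B.- B.1#) X.*ₗ (s X.*ₗ y) X.+ᴹ x
        rest~q : ∀ s → ι s A.≈ c → rest s ~ q
        rest~q s ιs≈c = ~-resp X.≈ᴹ-refl cancel (~-+ (~-* (B.- B.1#) (~-* s y~g)) x~z)
          where
          cancel : (B.- B.1#) W.*ₗ (s W.*ₗ g) V.+ᴹ z V.≈ᴹ q
          cancel = V.≈ᴹ-trans (V.+ᴹ-congˡ (V.≈ᴹ-trans z≈ (V.+ᴹ-congʳ (V.*ₗ-cong (A.sym ιs≈c) V.≈ᴹ-refl))))
            (V.≈ᴹ-trans (V.≈ᴹ-sym (V.+ᴹ-assoc _ _ _)) (V.≈ᴹ-trans
              (V.+ᴹ-congʳ (V.≈ᴹ-trans (V.+ᴹ-congʳ (-1*≈-ᴹ W _)) (V.-ᴹ‿inverseˡ _))) (V.+ᴹ-identityˡ q)))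
        restore : ∀ s → x X.≈ᴹ s X.*ₗ y X.+ᴹ rest s
        restore s = X.≈ᴹ-sym (X.≈ᴹ-trans (X.≈ᴹ-sym (X.+ᴹ-assoc _ _ _)) (X.≈ᴹ-trans
          (X.+ᴹ-congʳ (X.≈ᴹ-trans (X.+ᴹ-congˡ (-1*≈-ᴹ X _)) (X.-ᴹ‿inverseʳ _))) (X.+ᴹ-identityˡ x)))

    few-generators-Max : ∀ d N →
      (∀ (zs : Fin (suc d) → V.Carrierᴹ) → (∀ s → ∃ λ p → zs s V.≈ᴹ Hom.⟦_⟧ j p) →
        ∃ λ c → (∀ s → F 0ℤ (c s)) × ¬ (∀ s → c s A.≈ A.0#) × lin zs c V.≈ᴹ V.0ᴹ) →
      (∀ k → ∃ λ L → length L ℕ.≤ N × All (F k) L ×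
        (∀ i c → Wt (k ℤ.- β ℤ.* + i) c → Any (λ t → ∃ λ e → F 0ℤ e × mono i c A.≈ e A.* t) L)) →
      GeneratedByAtMost X (d ℕ.* N)
    few-generators-Max d N dependent monomials =
      let (xs , xs∈P , P⊆xs) = P-finitelyGenerated
          (gs , bound , gs∈P , P⊆gs) =
            Generation.few-generators em S V P-sub P-saturated d N dependent′ monomials xs xs∈P P⊆xs
      in length gs , bound , generatedBy gs gs∈P P⊆gs
      where
      -- Each `zₛ` is moved into `M` by a scalar `tₛ` invertible in `A`. A relation among the moved
      -- vectors then gives one among the `zₛ`, with coefficients `cₛ tₛ` that cannot all vanish.
      dependent′ : ∀ (zs : Fin (suc d) → V.Carrierᴹ) → (∀ s → ∃ λ k → Xᵍ k (zs s)) →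
        ∃₂ λ c e → (∀ s → F e (c s)) × ¬ (∀ s → c s A.≈ A.0#) × lin zs c V.≈ᴹ V.0ᴹ
      dependent′ zs Xzs = (λ s → c s A.* t s) , 0ℤ , (λ s → F-* (Fc s) (Ft s)) , nontrivial
        , V.≈ᴹ-trans (MonoidSum.sum-cong-≋ V.+ᴹ-monoid λ s → V.*ₗ-assoc (c s) (t s) (zs s)) relation
        where
        bounded = λ s → X-bounded (proj₂ (Xzs s))
        t = λ s → proj₁ (bounded s)
        Ft = λ s → proj₁ (proj₂ (proj₂ (bounded s)))
        dep = dependent (λ s → t s V.*ₗ zs s) (λ s → proj₁ (proj₂ (bounded s)) , proj₂ (proj₂ (proj₂ (proj₂ (bounded s)))))
        c = proj₁ dep
        Fc = proj₁ (proj₂ dep)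
        relation = proj₂ (proj₂ (proj₂ dep))
        nontrivial : ¬ (∀ s → c s A.* t s A.≈ A.0#)
        nontrivial ct≈0 = proj₁ (proj₂ (proj₂ dep)) λ s →
          let (t⁻¹ , t⁻¹t≈1) = proj₁ (proj₂ (proj₂ (proj₂ (bounded s)))) in
          A.trans (A.sym (A.*-identityʳ (c s))) (A.trans (A.*-congˡ (A.trans (A.sym t⁻¹t≈1) (A.*-comm t⁻¹ (t s))))
            (A.trans (A.sym (A.*-assoc (c s) (t s) t⁻¹)) (A.trans (A.*-congʳ (ct≈0 s)) (A.zeroˡ t⁻¹))))

-- Monomial generators of `F k`.

module Monomials {a} (D : CompleteDVR a) (a₀ : ℤ) (as : List ℕ) (positive : All (0 ℕ.<_) as) where
  open LatticePoints

  α-1 : ℕ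
  α-1 = ℕ.pred (proj₁ (frac as))

  β : ℤ
  β = num as ℤ.+ a₀ ℤ.* den as

  open Series D α-1 β
  open Weights D α-1
  open CompleteDVR D using (K; v)
  open PowerSeries K
  private module A = CommutativeRing powerSeries

  private
    den≡α : den as ≡ α
    den≡α = cong +_ (≡.sym (ℕ.suc-pred (proj₁ (frac as)) {{ℕ.>-nonZero (den-positive as positive)}}))

    -- A shear that removes `a₀`: the monomial `uⁱ πᵉ` with `e = - m - a₀ i` has weight
    -- `α e + β i = num i - α m`. So only the fractional part of `ν` reaches the lattice problem.
    exponent : ℤ → ℤ → ℤ
    exponent i m = ℤ.- m ℤ.- a₀ ℤ.* i

    β≡ : β ≡ num as ℤ.+ a₀ ℤ.* α
    β≡ = cong (λ d → num as ℤ.+ a₀ ℤ.* d) den≡α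

    cover-α : ∀ x → Cover α (num as) x (2 ℕ.+ evenSum as)
    cover-α x = subst (λ d → Cover d (num as) x (2 ℕ.+ evenSum as)) den≡α (cover as positive x)

    monomial : ℤ × ℤ → ℕ → K.Carrier
    monomial (i , m) = mono ℤ.∣ i ∣ ϖ⟨ exponent i m ⟩

    monomial-F : ∀ k {p} → Valid α (num as) (ℤ.- k) p → F k (monomial p)
    monomial-F k {+ i , m} (_ , 0≤t , _) = mono-F {k} i (wt-mono bound (wt-exact (v-ϖ (exponent (+ i) m))))
      where
      bound : k ℤ.- β ℤ.* + i ℤ.≤ α ℤ.* exponent (+ i) m
      bound = ℤ.0≤i-j⇒j≤i (subst (0ℤ ℤ.≤_)
        (≡.trans (lem k (num as) a₀ α (+ i) m) (cong (λ b → α ℤ.* exponent (+ i) m ℤ.- (k ℤ.- b ℤ.* + i)) (≡.sym β≡))) 0≤t)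
        where
        lem : ∀ k b a₀ α i m → ℤ.- k ℤ.+ b ℤ.* i ℤ.- α ℤ.* m ≡
              α ℤ.* (ℤ.- m ℤ.- a₀ ℤ.* i) ℤ.- (k ℤ.- (b ℤ.+ a₀ ℤ.* α) ℤ.* i)
        lem = ℤ-Solver.solve-∀
    monomial-F k { ℤ.-[1+ _ ] , m} (() , _)

    weight : ∀ k i c → Wt (k ℤ.- β ℤ.* + i) c → ∃ λ m → k ℤ.- β ℤ.* + i ℤ.≤ α ℤ.* m × Wt (α ℤ.* m) c
    weight k i c W = decide (≈0? c)
      where
      n = ℤ.∣ k ℤ.- β ℤ.* + i ∣
      j≤∣j∣ : ∀ j → j ℤ.≤ + ℤ.∣ j ∣
      j≤∣j∣ (+ n)      = ℤ.≤-refl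
      j≤∣j∣ ℤ.-[1+ n ] = ℤ.-≤+
      decide : Dec (c K.≈ K.0#) → ∃ λ m → k ℤ.- β ℤ.* + i ℤ.≤ α ℤ.* m × Wt (α ℤ.* m) c
      -- Zero has every weight, so any `m` with `α m` large enough will do; `α ≥ 1` makes the
      -- absolute value sufficient.
      decide (yes c≈0) = + n , ℤ.≤-trans (j≤∣j∣ (k ℤ.- β ℤ.* + i))
          (subst (ℤ._≤ α ℤ.* + n) (ℤ.*-identityˡ (+ n)) (ℤ.*-monoʳ-≤-nonNeg (+ n) {1ℤ} {α} (ℤ.+≤+ (ℕ.s≤s ℕ.z≤n))))
        , wt-resp (K.sym c≈0) wt-0
      decide (no c≉0) = let (m , vc) = v-finite c≉0 in m , W m vc , wt-exact vc

    -- Domination in both coordinates is divisibility in `F 0`: the quotient has exponent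
    -- `i - i₁ ≥ 0` in `u`, and weight at least the difference of the heights.
    divides : ∀ k i c m → Wt (α ℤ.* m) c → ∀ {p} → 0ℤ ℤ.≤ proj₁ p →
              Below α (num as) (ℤ.- k) (+ i) (exponent (+ i) m) p →
              ∃ λ e → F 0ℤ e × mono i c ≈ₚ e *ₚ monomial p
    divides k i c m W {ℤ.-[1+ _ ] , m₁} () _
    divides k i c m W {+ i₁ , m₁} _ (ℤ.+≤+ i₁≤i , t₁≤t) = mono (i ∸ i₁) (c K.* y) , Fe , eq
      where
      inverse = invert (v-ϖ (exponent (+ i₁) m₁))
      y = proj₁ inverse
      Fe : F 0ℤ (mono (i ∸ i₁) (c K.* y))
      Fe = mono-F {0ℤ} (i ∸ i₁) (wt-mono bound (wt-* W (wt-exact (proj₂ (proj₂ inverse)))))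
        where
        l = i ∸ i₁
        i≡ : + i ≡ + l ℤ.+ + i₁
        i≡ = ≡.trans (cong +_ (≡.sym (ℕ.m∸n+n≡m i₁≤i))) (ℤ.pos-+ l i₁)
        lem : ∀ k b a₀ α l i₁ m m₁ →
          (ℤ.- k ℤ.+ b ℤ.* (l ℤ.+ i₁) ℤ.- α ℤ.* (ℤ.- m ℤ.- a₀ ℤ.* (l ℤ.+ i₁))) ℤ.- (ℤ.- k ℤ.+ b ℤ.* i₁ ℤ.- α ℤ.* m₁) ≡
          α ℤ.* m ℤ.+ α ℤ.* ℤ.- (ℤ.- m₁ ℤ.- a₀ ℤ.* i₁) ℤ.- (0ℤ ℤ.- (b ℤ.+ a₀ ℤ.* α) ℤ.* l)
        lem = ℤ-Solver.solve-∀
        bound : 0ℤ ℤ.- β ℤ.* + l ℤ.≤ α ℤ.* m ℤ.+ α ℤ.* ℤ.- exponent (+ i₁) m₁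
        bound = ℤ.0≤i-j⇒j≤i (subst (0ℤ ℤ.≤_)
          (≡.trans (cong (λ j → height α (num as) (ℤ.- k) j (exponent j m) ℤ.- height α (num as) (ℤ.- k) (+ i₁) m₁) i≡)
          (≡.trans (lem k (num as) a₀ α (+ l) (+ i₁) m m₁)
                   (cong (λ b → α ℤ.* m ℤ.+ α ℤ.* ℤ.- exponent (+ i₁) m₁ ℤ.- (0ℤ ℤ.- b ℤ.* + l)) (≡.sym β≡))))
          (ℤ.i≤j⇒0≤j-i t₁≤t))
      c≈cyϖ : c K.≈ c K.* y K.* ϖ⟨ exponent (+ i₁) m₁ ⟩
      c≈cyϖ = K.sym (K.trans (K.*-assoc c y _) (K.trans (K.*-congˡ (K.trans (K.*-comm y _) (proj₁ (proj₂ inverse)))) (K.*-identityʳ c)))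
      eq : mono i c ≈ₚ mono (i ∸ i₁) (c K.* y) *ₚ monomial (+ i₁ , m₁)
      eq = A.sym {mono (i ∸ i₁) (c K.* y) *ₚ monomial (+ i₁ , m₁)} {mono i c}
        (subst (λ n → mono (i ∸ i₁) (c K.* y) *ₚ monomial (+ i₁ , m₁) ≈ₚ mono n c) (ℕ.m∸n+n≡m i₁≤i)
          (A.trans {mono (i ∸ i₁) (c K.* y) *ₚ monomial (+ i₁ , m₁)} {_} {mono (i ∸ i₁ ℕ.+ i₁) c}
            (mono-* (i ∸ i₁) i₁ (c K.* y) ϖ⟨ exponent (+ i₁) m₁ ⟩) (mono-cong (i ∸ i₁ ℕ.+ i₁) (K.sym c≈cyϖ))))

  monomials : ∀ k → ∃ λ L → length L ℕ.≤ 2 ℕ.+ evenSum as × All (F k) L ×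
              (∀ i c → Wt (k ℤ.- β ℤ.* + i) c → Any (λ t → ∃ λ e → F 0ℤ e × mono i c ≈ₚ e *ₚ t) L)
  monomials k = map monomial points
    , subst (ℕ._≤ 2 ℕ.+ evenSum as) (≡.sym (length-map monomial points)) bounded
    , All.map⁺ (All.map (λ {p} → monomial-F k {p}) valid)
    , λ i c W → let (m , k≤αm , W′) = weight k i c W in
        Any.map⁺ (Any.map (λ {p} ((0≤i₁ , _) , below) → divides k i c m W′ {p} 0≤i₁ below)
          (both valid (covers (+ i) (exponent (+ i) m) (ℤ.+≤+ ℕ.z≤n) (nonneg i m k≤αm))))
    where
    open Cover (cover-α (ℤ.- k))
    nonneg : ∀ i m → k ℤ.- β ℤ.* + i ℤ.≤ α ℤ.* m → 0ℤ ℤ.≤ height α (num as) (ℤ.- k) (+ i) (exponent (+ i) m)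
    nonneg i m k≤αm = subst (0ℤ ℤ.≤_) (≡.trans (cong (λ b → α ℤ.* m ℤ.- (k ℤ.- b ℤ.* + i)) β≡) (lem k (num as) a₀ α (+ i) m))
                        (ℤ.i≤j⇒0≤j-i k≤αm)
      where
      lem : ∀ k b a₀ α i m → α ℤ.* m ℤ.- (k ℤ.- (b ℤ.+ a₀ ℤ.* α) ℤ.* i) ≡
            ℤ.- k ℤ.+ b ℤ.* i ℤ.- α ℤ.* (ℤ.- m ℤ.- a₀ ℤ.* i)
      lem = ℤ-Solver.solve-∀

-- Specialisation to `S_ν` and to submodules of its free modules.

module GeneratorBound (em : ∀ {ℓ} → ExcludedMiddle ℓ) {a} (D : CompleteDVR a) (d : ℕ) (ν : ℚ) (a₀ : ℤ) (as : List ℕ)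
            (ν≡ : ν ≡ ⟦ a₀ ⨾ as ⟧) (positive : All (0 ℕ.<_) as) where
  open Monomials D a₀ as positive
  open Series D α-1 β
  open Weights D α-1
  open CompleteDVR D using (K; v; 1≉0)
  open PowerSeries K
  private
    B = S D ν
    module A = CommutativeRing powerSeries
    module B = CommutativeRing B
    V = Modules.Free powerSeries d
    module V = LeftModule V
  open Modules B

  private
    bound⇔ : ∀ i m → 0ℚ ℚ.≤ m ℚ./ 1 ℚ.+ ν ℚ.* (+ i ℚ./ 1) ⇔ 0ℤ ℤ.≤ α ℤ.* m ℤ.+ β ℤ.* + i
    bound⇔ i m = subst (λ ν → 0ℚ ℚ.≤ m ℚ./ 1 ℚ.+ ν ℚ.* (+ i ℚ./ 1) ⇔ 0ℤ ℤ.≤ α ℤ.* m ℤ.+ β ℤ.* + i)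
      (≡.sym (≡.trans ν≡ (Fractions.value a₀ as positive))) (Fractions.nonneg⇔ β α-1 m i)

    rearrange : ∀ x y → x ℤ.+ y ≡ x ℤ.- (0ℤ ℤ.- y)
    rearrange = ℤ-Solver.solve-∀

    ι-F : ∀ (s : B.Carrier) → F 0ℤ (proj₁ s)
    ι-F (f , bounds) i m vfi = ℤ.0≤i-j⇒j≤i (subst (0ℤ ℤ.≤_) (rearrange (α ℤ.* m) (β ℤ.* + i))
      (Equivalence.to (bound⇔ i m) (bounds i m vfi)))

    lift : ∀ {f} → F 0ℤ f → ∃ λ (s : B.Carrier) → proj₁ s ≈ₚ f
    lift {f} Ff = (f , λ i m vfi → Equivalence.from (bound⇔ i m)
      (subst (0ℤ ℤ.≤_) (≡.sym (rearrange (α ℤ.* m) (β ℤ.* + i))) (ℤ.i≤j⇒0≤j-i (Ff i m vfi)))) , λ i → K.refl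

    ι-mono : IsRingMonomorphism B.rawRing A.rawRing proj₁
    ι-mono = record
      { isRingHomomorphism = record
        { isSemiringHomomorphism = record
          { isNearSemiringHomomorphism = record
            { +-isMonoidHomomorphism = record
              { isMagmaHomomorphism = record
                { isRelHomomorphism = record { cong = λ x≈y → x≈y }
                ; homo = λ _ _ _ → K.refl
                }
              ; ε-homo = λ _ → K.refl
              }
            ; *-homo = λ _ _ _ → K.refl
            }
          ; 1#-homo = λ _ → K.refl
          }
        ; -‿homo = λ _ _ → K.refl
        }
      ; injective = λ x≈y → x≈y
      }

    module MG = MaxGenerators em seriesRing {B} {proj₁} ι-mono ι-F lift

    cancel : ∀ {f g} → ¬ (f ≈ₚ A.0#) → f *ₚ g ≈ₚ A.0# → g ≈ₚ A.0#
    cancel {f} {g} f≉0 fg≈0 with em {P = ∃ λ i → ¬ (f i K.≈ K.0#)}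
    ... | yes (i , fi≉0) = *-cancelˡ-0 i f g fi≉0 fg≈0
    ... | no none = contradiction (λ i → decidable-stable (≈0? (f i)) λ fi≉0 → none (i , fi≉0)) f≉0

    W = Extension.restrict MG.E V

    V-torsionFree : TorsionFree W
    V-torsionFree s x sx≈0 with em {P = proj₁ s ≈ₚ A.0#}
    ... | yes s≈0 = inj₁ s≈0
    ... | no  s≉0 = inj₂ λ k → cancel s≉0 (sx≈0 k)

  module _ (M : Submodule (Free d)) where
    private
      j : Hom ⌊ M ⌋ W
      j = record
        { ⟦_⟧   = λ x k → proj₁ (proj₁ x k)
        ; isHom = record
          { +ᴹ-isGroupHomomorphism = record
            { isMonoidHomomorphism = record
              { isMagmaHomomorphism = record
                { isRelHomomorphism = record { cong = λ x≈y → x≈y }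
                ; homo = λ _ _ _ _ → K.refl
                }
              ; ε-homo = λ _ _ → K.refl
              }
            ; ⁻¹-homo = λ _ _ _ → K.refl
            }
          ; *ₗ-homo = λ _ _ _ _ → K.refl
          }
        }

      sum-coordinate : ∀ {r} (t : Fin r → V.Carrierᴹ) k →
        MonoidSum.sum V.+ᴹ-monoid t k A.≈ MonoidSum.sum A.+-monoid (λ s → t s k)
      sum-coordinate {zero}  t k i = K.refl
      sum-coordinate {suc r} t k i = K.+-congˡ (sum-coordinate (t ∘ Fin.suc) k i)

      -- Vectors coming from `M` have coordinates in `F 0`, and elimination without fractions keeps
      -- the coefficients of the relation there.
      dependent : (zs : Fin (suc d) → V.Carrierᴹ) → (∀ s → ∃ λ p → zs s V.≈ᴹ Hom.⟦_⟧ j p) →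
        ∃ λ c → (∀ s → F 0ℤ (c s)) × ¬ (∀ s → c s A.≈ A.0#) ×
                MonoidSum.sum V.+ᴹ-monoid (λ s → c s V.*ₗ zs s) V.≈ᴹ V.0ᴹ
      dependent zs integral =
        let (c , Fc , c≉0 , rel) = LinearDependence.dependent em powerSeries (λ 1≈0 → 1≉0 (1≈0 0)) cancel
              {F 0ℤ} (λ i → wt-0) (SeriesRing.F-1 seriesRing)
              (λ Ff i → wt-neg (Ff i)) (λ Ff Fg i → wt-+ (Ff i) (Fg i)) (F-* {0ℤ} {0ℤ})
              d zs (λ s k i → wt-resp (K.sym (proj₂ (integral s) k i)) (ι-F (proj₁ (proj₁ (integral s)) k) i))
        in c , Fc , c≉0 , λ k i → K.trans (sum-coordinate (λ s → c s V.*ₗ zs s) k i) (rel k i)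

    generated : (X : Mod) (f : Hom ⌊ M ⌋ X) → IsMax ⌊ M ⌋ X f → GeneratedByAtMost X (d ℕ.* (2 ℕ.+ evenSum as))
    generated X f max = MG.few-generators-Max (λ 1≈0 → 1≉0 (1≈0 0)) V V-torsionFree j (λ _ x≈0 → x≈0) f max
      d (2 ℕ.+ evenSum as) dependent monomials

open import Data.Nat.Base using (_+_; _*_; _<_)

theorem1p2 : (∀ {ℓ} → ExcludedMiddle ℓ) →
    ∀ {a} (D : CompleteDVR a) (d : ℕ) → 0 < d →
    (ν : ℚ) (a₀ : ℤ) (as : List ℕ) →
    ν ≡ ⟦ a₀ ⨾ as ⟧ → All (0 <_) as → last as ≢ just 1 →
    let open Modules (S D ν) in
    (M : Submodule (Free d)) (MaxM : Mod) (f : Hom ⌊ M ⌋ MaxM) → IsMax ⌊ M ⌋ MaxM f →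
    GeneratedByAtMost MaxM (d * (2 + evenSum as))
theorem1p2 em D d _ ν a₀ as ν≡ positive _ = GeneratorBound.generated em D d ν a₀ as ν≡ positive
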